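{- Let $n\ge 23$ and let $c^*=\frac{3n}{4}+\frac{21}{64}$. Define $$f_e(c)=c^3+(2n^2-2n-3)c^2+(-3n^3+3n-1)c+(6n^3-5n^2+2n)+\frac{ -3n^3+3n^2}{c},$$ $$f_o(c)=c^3+(2n^2-2n-3)c^2+(-3n^3+6n-1)c+(6n^3-5n^2-4n+3)+\frac{ -3n^3+3n^2+3n-3}{c}.$$ Consider the minimum of $\mathcal{K}(G)-\mathcal{K}(T)$ over all trees $T$ on $n$ vertices and all graphs $G$ obtained from $T$ by adding an edge between two non-adjacent vertices. If $n\equiv 0,1,6,7 \pmod 8$, this minimum value equals $$\frac{1}{6n(n-1)}\min\{f_e(\lfloor c^*\rfloor),f_e(\lfloor c^*\rfloor+2),f_o(\lceil c^*\rceil),f_o(\lceil c^*\rceil-2)\}.$$ If $n\equiv 2,3,4,5\pmod 8$, this minimum value equals $$\frac{1}{6n(n-1)}\min\{f_o(\lfloor c^*\rfloor),f_o(\lfloor c^*\rfloor+2),f_e(\lceil c^*\rceil),f_e(\lceil c^*\rceil-2)\}.$$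
   Context: Kemeny's constant: for a connected graph $H$ with adjacency matrix $A$ and diagonal degree matrix $\Delta$, consider the random walk with transition matrix $\Delta^{ -1}A$, its stationary distribution $w=(w_k)$ and mean first passage times $m_{j,k}$; then $\mathcal{K}(H)=\sum_{k\neq j} m_{j,k}w_k$, which is independent of $j$. -}

module Defs where

open import Algebra.Bundles using (CommutativeRing)
open import Data.Bool using (Bool; false; T; _∨_; _∧_; if_then_else_)
open import Data.Bool.Properties using (∨-comm; ∧-comm)
open import Data.Empty using (⊥-elim)
open import Data.Fin using (Fin; _≟_)
open import Data.Integer as ℤ using (ℤ; +_)
open import Data.List using (List; []; _∷_; _++_; length)
open import Data.List.Relation.Unary.Linked using (Linked)
open import Data.List.Relation.Unary.Unique.Propositional using (Unique)
open import Data.Nat as ℕ using (ℕ; zero; suc)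
open import Data.Product using (∃; _×_)
open import Data.Rational
  using (ℚ; 0ℚ; 1ℚ; _+_; _*_; _-_; -_; ∣_∣; _≤_; _<_; _/_; 1/_; ≢-nonZero)
import Data.Rational.Properties as ℚ
open import Level using (0ℓ)
open import Relation.Binary.Construct.Closure.ReflexiveTransitive using (Star)
open import Relation.Binary.PropositionalEquality
  using (_≡_; _≢_; refl; sym; trans; cong₂)
open import Relation.Nullary using (¬_; does; yes; no)
open import Relation.Unary using (Pred)

open CommutativeRing ℚ.+-*-commutativeRing using (semiring)
open import Algebra.Properties.Semiring.Sum semiring using (sum)
open import Algebra.Properties.Semiring.Exp semiring using (_^_)

fromℤ : ℤ → ℚ
fromℤ z = z / 1

fromℕ : ℕ → ℚ
fromℕ k = fromℤ (+ k)

-- Total reciprocal with inv 0ℚ ≡ 0ℚ. For connected graphs on n ≥ 23 vertices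
-- and integers c within 2 of 3n/4 + 21/64 every argument below is nonzero.
inv : ℚ → ℚ
inv q with q ℚ.≟ 0ℚ
... | yes _   = 0ℚ
... | no  q≢0 = 1/_ q {{≢-nonZero q≢0}}

_ConvergesTo_ : (ℕ → ℚ) → ℚ → Set
s ConvergesTo l =
  ∀ ε → 0ℚ < ε → ∃ λ N → ∀ M → N ℕ.≤ M → ∣ s M - l ∣ < ε

IsMinimum : Pred ℚ 0ℓ → ℚ → Set
IsMinimum S v = S v × (∀ d → S d → v ≤ d)

record Graph (n : ℕ) : Set where
  field
    adj     : Fin n → Fin n → Bool
    symm    : ∀ i j → adj i j ≡ adj j i
    irrefl  : ∀ i → adj i i ≡ false

  Adj : Fin n → Fin n → Set
  Adj i j = T (adj i j)

open Graph public

module _ {n : ℕ} where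

  Connected : Graph n → Set
  Connected G = Fin n × (∀ i j → Star (Adj G) i j)

  -- The cycle x, x₁, …, xₖ, x with k ≥ 2 is given by x and xs = x₁, …, xₖ.
  IsCycle : Graph n → Fin n → List (Fin n) → Set
  IsCycle G x xs =
    2 ℕ.≤ length xs × Unique (x ∷ xs) × Linked (Adj G) (x ∷ xs ++ x ∷ [])

  Acyclic : Graph n → Set
  Acyclic G = ∀ x xs → ¬ IsCycle G x xs

  IsTree : Graph n → Set
  IsTree G = Connected G × Acyclic G

  private
    _==_ : Fin n → Fin n → Bool
    i == j = does (i ≟ j)

  isPair : Fin n → Fin n → Fin n → Fin n → Bool
  isPair u v i j = (i == u ∧ j == v) ∨ (j == u ∧ i == v)

  addEdge : (G : Graph n) (u v : Fin n) → u ≢ v → Graph n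
  addEdge G u v u≢v = record
    { adj    = λ i j → adj G i j ∨ isPair u v i j
    ; symm   = λ i j → cong₂ _∨_ (symm G i j) (∨-comm (i == u ∧ j == v) _)
    ; irrefl = λ i → cong₂ _∨_ (irrefl G i) (noLoop i)
    }
    where
    noLoop : ∀ i → isPair u v i i ≡ false
    noLoop i with i ≟ u | i ≟ v
    ... | yes i≡u | yes i≡v = ⊥-elim (u≢v (trans (sym i≡u) i≡v))
    ... | yes _   | no  _   = refl
    ... | no  _   | yes _   = refl
    ... | no  _   | no  _   = refl

module _ {n : ℕ} where

  Matrix : Set
  Matrix = Fin n → Fin n → ℚ

  adjacency : Graph n → Matrix
  adjacency G i j = if adj G i j then 1ℚ else 0ℚ

  degree : Graph n → Fin n → ℚ
  degree G i = sum (adjacency G i)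

  transition : Graph n → Matrix
  transition G i j = inv (degree G i) * adjacency G i j

  record IsStationary (P : Matrix) (w : Fin n → ℚ) : Set where
    field
      nonneg    : ∀ k → 0ℚ ≤ w k
      total     : sum w ≡ 1ℚ
      invariant : ∀ k → sum (λ j → w j * P j k) ≡ w k

  sumExcept : Fin n → (Fin n → ℚ) → ℚ
  sumExcept k f = sum (λ i → if does (i ≟ k) then 0ℚ else f i)

  -- firstPassage P t j k is the probability that the chain started at j
  -- visits k at time t and at no time s with 0 < s < t.
  firstPassage : Matrix → ℕ → Matrix
  firstPassage P zero          j k = 0ℚ
  firstPassage P (suc zero)    j k = P j k
  firstPassage P (suc (suc t)) j k =
    sumExcept k (λ i → P j i * firstPassage P (suc t) i k)

  -- Partial sums of the expected first passage time Σ_t t · Pr(T = t).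
  partialMean : Matrix → Fin n → Fin n → ℕ → ℚ
  partialMean P j k zero    = 0ℚ
  partialMean P j k (suc t) =
    partialMean P j k t + fromℕ (suc t) * firstPassage P (suc t) j k

  -- Only j ≢ k is constrained, so no convention for m j j is needed.
  IsMeanFirstPassage : Matrix → Matrix → Set
  IsMeanFirstPassage P m =
    ∀ j k → j ≢ k → partialMean P j k ConvergesTo m j k

  -- κ is Kemeny's constant of the connected graph G. The constant is a
  -- relation because mean first passage times are limits; the defining sum
  -- takes the value κ for every starting vertex j.
  record IsKemeny (G : Graph n) (κ : ℚ) : Set where
    field
      connected  : Connected G
      w          : Fin n → ℚ
      m          : Matrix
      stationary : IsStationary (transition G) w
      passage    : IsMeanFirstPassage (transition G) m
      value      : ∀ j → sumExcept j (λ k → m j k * w k) ≡ κ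

-- KemenyChange n d: d = 𝒦(G) - 𝒦(T) for some tree T on n vertices and some
-- G obtained from T by joining two non-adjacent vertices.
record KemenyChange (n : ℕ) (d : ℚ) : Set where
  field
    tree       : Graph n
    isTree     : IsTree tree
    u v        : Fin n
    u≢v        : u ≢ v
    nonadj     : ¬ Adj tree u v
    κT κG      : ℚ
    kemenyTree : IsKemeny tree κT
    kemenyPlus : IsKemeny (addEdge tree u v u≢v) κG
    difference : d ≡ κG - κT

c* : ℕ → ℚ
c* n = fromℕ (3 ℕ.* n) * inv (fromℕ 4) + fromℕ 21 * inv (fromℕ 64)

prefactor : ℕ → ℚ
prefactor n = inv (fromℕ 6 * N * (N - 1ℚ))
  where N = fromℕ n

fₑ : ℕ → ℤ → ℚ
fₑ n z =
    c ^ 3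
  + (# 2 * N ^ 2 - # 2 * N - # 3) * c ^ 2
  + (- (# 3 * N ^ 3) + # 3 * N - # 1) * c
  + (# 6 * N ^ 3 - # 5 * N ^ 2 + # 2 * N)
  + (- (# 3 * N ^ 3) + # 3 * N ^ 2) * inv c
  where
  # = fromℕ
  N = fromℕ n
  c = fromℤ z

fₒ : ℕ → ℤ → ℚ
fₒ n z =
    c ^ 3
  + (# 2 * N ^ 2 - # 2 * N - # 3) * c ^ 2
  + (- (# 3 * N ^ 3) + # 6 * N - # 1) * c
  + (# 6 * N ^ 3 - # 5 * N ^ 2 - # 4 * N + # 3)
  + (- (# 3 * N ^ 3) + # 3 * N ^ 2 + # 3 * N - # 3) * inv c
  where
  # = fromℕ
  N = fromℕ n
  c = fromℤ z

{-# OPTIONS --safe #-}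
module Submission where

-- If r is a resistance metric, i.e. the Laplacian satisfies L r(·,k) = τ - 2 δ(·,k), then the hitting times are
-- h(j,k) = ½ Σ_z d(z) (r(j,k) + r(k,z) - r(j,z)), and Kemeny's constant is Σ d(j) d(k) r(j,k) / (2 Σ d). For a
-- tree r is the distance, and adding the edge uv changes r by a rank-one term. So 𝒦(G) - 𝒦(T) is a function of
-- the distances in T. By the four-point condition it can only decrease if every vertex is moved next to its
-- projection onto the u–v path, which leaves a cost Σ (|i - j| + (n - 1)/c (i - j)²) over pairs of positions on a
-- path with c vertices. By convexity this cost is largest when the n - c remaining vertices are shared as evenly
-- as possible between the two ends, i.e. for a double broom, and the value is then fₑ(c) or fₒ(c) according to
-- the parity of n - c. Along steps of 2 both functions decrease before c* and increase after it.

open import Defs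
open import Algebra.Bundles using (CommutativeRing)
open import Data.Bool using (true; false; T; _∨_; if_then_else_)
open import Data.Fin as Fin using (Fin; zero; suc; toℕ; _≟_)
import Data.Fin.Properties as Fin
open import Data.Integer as ℤ using (ℤ; +_; -[1+_])
import Data.Integer.DivMod as ℤ
import Data.Integer.Properties as ℤ
open import Data.List using (List; []; _∷_; _++_; length)
import Data.List.Membership.DecPropositional as DecMembership
open import Data.List.Membership.Propositional using (_∈_; _∉_)
open import Data.List.Relation.Unary.All using ([]; _∷_)
open import Data.List.Relation.Unary.All.Properties using (¬Any⇒All¬; All¬⇒¬Any)
open import Data.List.Relation.Unary.AllPairs using ([]; _∷_)
open import Data.List.Relation.Unary.Any using (here; there)
open import Data.List.Relation.Unary.Linked using (Linked; []; [-]; _∷_)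
open import Data.List.Relation.Unary.Unique.Propositional using (Unique)
open import Data.Nat as ℕ using (ℕ; zero; suc; _%_; z≤n; s≤s)
import Data.Nat.Coprimality as Coprime
import Data.Nat.DivMod as ℕ
import Data.Nat.Properties as ℕ
import Data.Nat.Tactic.RingSolver as ℕRing
open import Data.Product using (∃; ∃₂; _×_; _,_; proj₁; proj₂)
open import Data.Rational
  using (ℚ; mkℚ; 0ℚ; 1ℚ; ½; _+_; _*_; _-_; -_; ∣_∣; _≤_; _<_; _⊓_; floor; ceiling; _/_; ≢-nonZero)
import Data.Rational.Properties as ℚ
open import Data.Rational.Solver using (module +-*-Solver)
open import Data.Sum using (_⊎_; inj₁; inj₂)
open import Data.Unit using (tt)
open import Function using (_∘_; id; case_of_)
open import Relation.Binary.Construct.Closure.ReflexiveTransitive using (Star; ε; _◅_; _◅◅_)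
open import Relation.Binary.PropositionalEquality
  using (_≡_; _≢_; refl; sym; trans; cong; cong₂; subst; subst₂; module ≡-Reasoning)
open import Relation.Nullary using (¬_; Dec; does; yes; no; contradiction)

open +-*-Solver using (solve; con; _:+_; _:*_; _:-_; :-_; _:=_; Polynomial)
open CommutativeRing ℚ.+-*-commutativeRing using (semiring)
open import Algebra.Properties.Semiring.Sum semiring
  using (sum; sum-cong-≗; ∑-distrib-+; ∑-comm; *-distribˡ-sum; sum-replicate-zero)

-- Rationals and finite sums

-- `IsKemeny` constrains mean first passage times only as limits of partial sums over ℚ. The
-- resistance formula supplies the limit in closed form, so what remains is convergence, by an
-- explicit O(1/t) error bound, and uniqueness, by which every witness of `IsKemeny` has this value.
-- Trees are given as connected acyclic graphs. They are regrown leaf by leaf, since for a new leaf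
-- the Laplace equation and the four-point condition follow from those of its neighbour. The parity
-- split comes from integrality: with X = n - c vertices off the new cycle and an integer E, the
-- product E (X - E) is at most X²/4 or (X² - 1)/4, according to the parity of X. The four
-- candidates come from the monotonicity estimates. These compare c with c + 2 unless 3n - 6 ≤ 4c ≤
-- 3n + 1, which holds for exactly two consecutive values of c, namely ⌊c*⌋ - 1 and ⌊c*⌋, one of
-- each parity. The residue of n mod 8 determines the parity of n - ⌊c*⌋.

# : ∀ {n} → ℕ → Polynomial n
# k = con (fromℕ k)

fromℤ-mkℚ : ∀ z → fromℤ z ≡ mkℚ z 0 (Coprime.sym (Coprime.1-coprimeTo _))
fromℤ-mkℚ z = ℚ.↥p/↧p≡p (mkℚ z 0 _)

fromℤ-+ : ∀ a b → fromℤ (a ℤ.+ b) ≡ fromℤ a + fromℤ b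
fromℤ-+ a b rewrite fromℤ-mkℚ a | fromℤ-mkℚ b =
  cong fromℤ (sym (cong₂ ℤ._+_ (ℤ.*-identityʳ a) (ℤ.*-identityʳ b)))

fromℤ-* : ∀ a b → fromℤ (a ℤ.* b) ≡ fromℤ a * fromℤ b
fromℤ-* a b rewrite fromℤ-mkℚ a | fromℤ-mkℚ b = refl

fromℤ-neg : ∀ a → fromℤ (ℤ.- a) ≡ - fromℤ a
fromℤ-neg a = begin
  fromℤ (ℤ.- a)                         ≡⟨ shift (fromℤ (ℤ.- a)) (fromℤ a) ⟩
  (fromℤ (ℤ.- a) + fromℤ a) - fromℤ a   ≡⟨ cong (_- fromℤ a) (sym (fromℤ-+ (ℤ.- a) a)) ⟩
  fromℤ (ℤ.- a ℤ.+ a) - fromℤ a         ≡⟨ cong (λ z → fromℤ z - fromℤ a) (ℤ.+-inverseˡ a) ⟩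
  0ℚ - fromℤ a                          ≡⟨ ℚ.+-identityˡ _ ⟩
  - fromℤ a                             ∎
  where
  open ≡-Reasoning
  shift = solve 2 (λ x y → x := (x :+ y) :- y) refl

fromℕ-+ : ∀ a b → fromℕ (a ℕ.+ b) ≡ fromℕ a + fromℕ b
fromℕ-+ a b = fromℤ-+ (+ a) (+ b)

fromℕ-* : ∀ a b → fromℕ (a ℕ.* b) ≡ fromℕ a * fromℕ b
fromℕ-* a b = trans (cong fromℤ (ℤ.pos-* a b)) (fromℤ-* (+ a) (+ b))

fromℕ-suc : ∀ a → fromℕ (suc a) ≡ 1ℚ + fromℕ a
fromℕ-suc a = fromℕ-+ 1 a

fromℤ-mono-≤ : ∀ {a b} → a ℤ.≤ b → fromℤ a ≤ fromℤ b
fromℤ-mono-≤ {a} {b} a≤b rewrite fromℤ-mkℚ a | fromℤ-mkℚ b =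
  Data.Rational.*≤* (ℤ.*-monoʳ-≤-nonNeg (+ 1) a≤b)

fromℤ-cancel-≤ : ∀ {a b} → fromℤ a ≤ fromℤ b → a ℤ.≤ b
fromℤ-cancel-≤ {a} {b} p rewrite fromℤ-mkℚ a | fromℤ-mkℚ b =
  subst₂ ℤ._≤_ (ℤ.*-identityʳ a) (ℤ.*-identityʳ b) (ℚ.drop-*≤* p)

fromℕ-mono-≤ : ∀ {a b} → a ℕ.≤ b → fromℕ a ≤ fromℕ b
fromℕ-mono-≤ = fromℤ-mono-≤ ∘ ℤ.+≤+

fromℕ-cancel-≤ : ∀ {a b} → fromℕ a ≤ fromℕ b → a ℕ.≤ b
fromℕ-cancel-≤ p = ℤ.drop‿+≤+ (fromℤ-cancel-≤ p)

0≤fromℕ : ∀ a → 0ℚ ≤ fromℕ a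
0≤fromℕ a = fromℕ-mono-≤ {0} {a} z≤n

0<1 : 0ℚ < 1ℚ
0<1 = ℚ.positive⁻¹ 1ℚ

0≤⇒≤ : ∀ {p q} → 0ℚ ≤ q - p → p ≤ q
0≤⇒≤ {p} {q} h = subst₂ _≤_ (ℚ.+-identityˡ p) (cancel q p) (ℚ.+-monoˡ-≤ p h)
  where
  cancel = solve 2 (λ q p → q :- p :+ p := q) refl

≤⇒0≤ : ∀ {p q} → p ≤ q → 0ℚ ≤ q - p
≤⇒0≤ {p} {q} h = subst (_≤ q - p) (ℚ.+-inverseʳ p) (ℚ.+-monoˡ-≤ (- p) h)

≤-via : ∀ {p q x} → q - p ≡ x → 0ℚ ≤ x → p ≤ q
≤-via refl = 0≤⇒≤

0≤-+ : ∀ {p q} → 0ℚ ≤ p → 0ℚ ≤ q → 0ℚ ≤ p + q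
0≤-+ = ℚ.+-mono-≤

*-monoˡ-≤ : ∀ {p q r} → 0ℚ ≤ r → p ≤ q → r * p ≤ r * q
*-monoˡ-≤ {r = r} 0≤r = ℚ.*-monoˡ-≤-nonNeg r {{Data.Rational.nonNegative 0≤r}}

0≤-* : ∀ {p q} → 0ℚ ≤ p → 0ℚ ≤ q → 0ℚ ≤ p * q
0≤-* {p} {q} 0≤p 0≤q = subst (_≤ p * q) (ℚ.*-zeroʳ p) (*-monoˡ-≤ 0≤p 0≤q)

0<-* : ∀ {p q} → 0ℚ < p → 0ℚ < q → 0ℚ < p * q
0<-* {p} {q} 0<p 0<q =
  subst (_< p * q) (ℚ.*-zeroʳ p) (ℚ.*-monoʳ-<-pos p {{Data.Rational.positive 0<p}} 0<q)

*-cancelˡ-≤ : ∀ {p q r} → 0ℚ < r → r * p ≤ r * q → p ≤ q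
*-cancelˡ-≤ {r = r} 0<r = ℚ.*-cancelˡ-≤-pos r {{Data.Rational.positive 0<r}}

*-cancelˡ-≡ : ∀ {p q r} → 0ℚ < r → r * p ≡ r * q → p ≡ q
*-cancelˡ-≡ 0<r e = ℚ.≤-antisym (*-cancelˡ-≤ 0<r (ℚ.≤-reflexive e))
                                (*-cancelˡ-≤ 0<r (ℚ.≤-reflexive (sym e)))

>⇒≢ : ∀ {p} → 0ℚ < p → p ≢ 0ℚ
>⇒≢ 0<p e = ℚ.<⇒≢ 0<p (sym e)

≤∧≢⇒< : ∀ {p} → 0ℚ ≤ p → p ≢ 0ℚ → 0ℚ < p
≤∧≢⇒< {p} 0≤p p≢0 with 0ℚ ℚ.<? p
... | yes 0<p = 0<p
... | no  0≮p = contradiction (ℚ.≤-antisym (ℚ.≮⇒≥ 0≮p) 0≤p) p≢0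

*-inv : ∀ {q} → q ≢ 0ℚ → q * inv q ≡ 1ℚ
*-inv {q} q≢0 with q ℚ.≟ 0ℚ
... | yes q≡0 = contradiction q≡0 q≢0
... | no  q≢0′ = ℚ.*-inverseʳ q {{≢-nonZero q≢0′}}

0≤-square : ∀ p → 0ℚ ≤ p * p
0≤-square p with ℚ.≤-total 0ℚ p
... | inj₁ 0≤p = 0≤-* 0≤p 0≤p
... | inj₂ p≤0 = subst (0ℚ ≤_) (neg-sq p) (0≤-* 0≤-p 0≤-p)
  where
  0≤-p : 0ℚ ≤ - p
  0≤-p = ℚ.neg-antimono-≤ p≤0
  neg-sq = solve 1 (λ p → (:- p) :* (:- p) := p :* p) refl

0≤inv : ∀ {q} → 0ℚ < q → 0ℚ ≤ inv q
0≤inv {q} 0<q = *-cancelˡ-≤ 0<q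
  (subst₂ _≤_ (sym (ℚ.*-zeroʳ q)) (sym (*-inv (>⇒≢ 0<q))) (ℚ.<⇒≤ 0<1))

-- A denominator is at least 1, so the absolute value of the numerator is a bound.
archimedean : ∀ q → ∃ λ k → q ≤ fromℕ k
archimedean q@(mkℚ z d _) = ℤ.∣ z ∣ , subst (q ≤_) (sym (fromℤ-mkℚ (+ ℤ.∣ z ∣))) (Data.Rational.*≤* le)
  where
  open ℤ.≤-Reasoning
  z≤∣z∣ : ∀ z → z ℤ.≤ + ℤ.∣ z ∣
  z≤∣z∣ (+ n)    = ℤ.≤-refl
  z≤∣z∣ -[1+ n ] = ℤ.-≤+
  le : z ℤ.* + 1 ℤ.≤ + ℤ.∣ z ∣ ℤ.* + suc d
  le = begin
    z ℤ.* + 1                    ≡⟨ ℤ.*-identityʳ z ⟩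
    z                            ≤⟨ z≤∣z∣ z ⟩
    + ℤ.∣ z ∣                     ≤⟨ ℤ.+≤+ (ℕ.m≤m*n ℤ.∣ z ∣ (suc d)) ⟩
    + (ℤ.∣ z ∣ ℕ.* suc d)         ≡⟨ ℤ.pos-* ℤ.∣ z ∣ (suc d) ⟩
    + ℤ.∣ z ∣ ℤ.* + suc d         ∎

sum-const : ∀ n → sum {n} (λ _ → 1ℚ) ≡ fromℕ n
sum-const zero    = refl
sum-const (suc n) = trans (cong (_+_ 1ℚ) (sum-const n)) (sym (fromℕ-suc n))

sum-*ˡ : ∀ {n} x (f : Fin n → ℚ) → sum (λ i → x * f i) ≡ x * sum f
sum-*ˡ x f = sym (*-distribˡ-sum x f)

sum-*ʳ : ∀ {n} x (f : Fin n → ℚ) → sum (λ i → f i * x) ≡ sum f * x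
sum-*ʳ x f =
  trans (sum-cong-≗ (λ i → ℚ.*-comm (f i) x)) (trans (sum-*ˡ x f) (ℚ.*-comm x (sum f)))

sum-neg : ∀ {n} (f : Fin n → ℚ) → sum (λ i → - f i) ≡ - sum f
sum-neg f = trans (sum-cong-≗ λ i → neg (f i)) (trans (sum-*ˡ (- 1ℚ) f) (sym (neg (sum f))))
  where
  neg = solve 1 (λ x → :- x := :- con 1ℚ :* x) refl

sum-minus : ∀ {n} (f g : Fin n → ℚ) → sum (λ i → f i - g i) ≡ sum f - sum g
sum-minus f g = trans (∑-distrib-+ f (λ i → - g i)) (cong (_+_ (sum f)) (sum-neg g))

sum-mono : ∀ {n} {f g : Fin n → ℚ} → (∀ i → f i ≤ g i) → sum f ≤ sum g
sum-mono {zero}  h = ℚ.≤-refl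
sum-mono {suc n} h = ℚ.+-mono-≤ (h zero) (sum-mono (h ∘ suc))

0≤-sum : ∀ {n} {f : Fin n → ℚ} → (∀ i → 0ℚ ≤ f i) → 0ℚ ≤ sum f
0≤-sum {n} h = ℚ.≤-trans (ℚ.≤-reflexive (sym (sum-replicate-zero n))) (sum-mono h)

δ : ∀ {n} → Fin n → Fin n → ℚ
δ i k = if does (i ≟ k) then 1ℚ else 0ℚ

δ-refl : ∀ {n} (k : Fin n) → δ k k ≡ 1ℚ
δ-refl k with k ≟ k
... | yes _   = refl
... | no  k≢k = contradiction refl k≢k

δ-≢ : ∀ {n} {i k : Fin n} → i ≢ k → δ i k ≡ 0ℚ
δ-≢ {i = i} {k} i≢k with i ≟ k
... | yes i≡k = contradiction i≡k i≢k
... | no  _   = refl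

δ-sym : ∀ {n} (i k : Fin n) → δ i k ≡ δ k i
δ-sym i k with i ≟ k
... | yes refl = sym (δ-refl i)
... | no  i≢k  = sym (δ-≢ (i≢k ∘ sym))

0≤δ : ∀ {n} (i k : Fin n) → 0ℚ ≤ δ i k
0≤δ i k with i ≟ k
... | yes _ = ℚ.<⇒≤ 0<1
... | no _  = ℚ.≤-refl

δ-suc : ∀ {n} (i k : Fin n) → δ (suc i) (suc k) ≡ δ i k
δ-suc i k with i ≟ k
... | yes _ = refl
... | no  _ = refl

sum-zero : ∀ {n} {f : Fin n → ℚ} → (∀ i → f i ≡ 0ℚ) → sum f ≡ 0ℚ
sum-zero {n} h = trans (sum-cong-≗ h) (sum-replicate-zero n)

sum-δ : ∀ {n} (k : Fin n) (f : Fin n → ℚ) → sum (λ i → δ i k * f i) ≡ f k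
sum-δ zero f = trans
  (cong₂ _+_ (ℚ.*-identityˡ (f zero)) (sum-zero λ i → ℚ.*-zeroˡ (f (suc i))))
  (ℚ.+-identityʳ (f zero))
sum-δ (suc k) f = trans
  (cong₂ _+_ (ℚ.*-zeroˡ (f zero))
    (trans (sum-cong-≗ λ i → cong (_* f (suc i)) (δ-suc i k)) (sum-δ k (f ∘ suc))))
  (ℚ.+-identityˡ (f (suc k)))

sum-δʳ : ∀ {n} (k : Fin n) (f : Fin n → ℚ) → sum (λ i → f i * δ i k) ≡ f k
sum-δʳ k f = trans (sum-cong-≗ λ i → ℚ.*-comm (f i) (δ i k)) (sum-δ k f)

-- Graph Laplacians

term≤sum : ∀ {n} {f : Fin n → ℚ} → (∀ i → 0ℚ ≤ f i) → ∀ k → f k ≤ sum f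
term≤sum {f = f} 0≤f zero =
  ≤-via (drop (f zero) _) (0≤-sum (0≤f ∘ suc))
  where
  drop = solve 2 (λ x y → x :+ y :- x := y) refl
term≤sum {f = f} 0≤f (suc k) = ℚ.≤-trans (term≤sum (0≤f ∘ suc) k)
  (≤-via (drop (f zero) _) (0≤f zero))
  where
  drop = solve 2 (λ x y → x :+ y :- y := x) refl

-- For the minimum principle in `0≤h`. The first argument excludes the empty case.
argmin : ∀ {n} → Fin n → (f : Fin n → ℚ) → ∃ λ k → ∀ i → f k ≤ f i
argmin {suc zero}    _ f = zero , λ where zero → ℚ.≤-refl
argmin {suc (suc n)} _ f with argmin {suc n} zero (f ∘ suc)
... | k , least with ℚ.≤-total (f zero) (f (suc k))
...   | inj₁ p = zero , λ where
          zero    → ℚ.≤-refl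
          (suc i) → ℚ.≤-trans p (least i)
...   | inj₂ p = suc k , λ where
          zero    → p
          (suc i) → least i

-- The bound is a successor so that `B` in `Passage` is at least 1.
bounded : ∀ {n} (f : Fin n → ℚ) → ∃ λ H → ∀ i → f i ≤ fromℕ (suc H)
bounded {zero}  f = 0 , λ ()
bounded {suc n} f with bounded (f ∘ suc) | archimedean (f zero)
... | H , le | K , f₀≤K = H ℕ.+ K , λ where
      zero    → ℚ.≤-trans f₀≤K (fromℕ-mono-≤ {K} {suc (H ℕ.+ K)} (ℕ.m≤n⇒m≤1+n (ℕ.m≤n+m K H)))
      (suc i) → ℚ.≤-trans (le i) (fromℕ-mono-≤ {suc H} {suc (H ℕ.+ K)} (s≤s (ℕ.m≤m+n H K)))

-- A positive x would satisfy x < x for η = x/2. The bound η + η is what the triangle inequality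
-- yields in `limit-unique`.
≡-from-ε : ∀ {x} → 0ℚ ≤ x → (∀ η → 0ℚ < η → x < η + η) → x ≡ 0ℚ
≡-from-ε {x} 0≤x small with x ℚ.≟ 0ℚ
... | yes e  = e
... | no x≢0 = contradiction (subst (x <_) (halves x) (small (½ * x) (0<-* (ℚ.positive⁻¹ ½) (≤∧≢⇒< 0≤x x≢0))))
                 (ℚ.<-irrefl refl)
  where
  halves : ∀ x → ½ * x + ½ * x ≡ x
  halves x = trans (sym (ℚ.*-distribʳ-+ x ½ ½)) (ℚ.*-identityˡ x)

limit-unique : ∀ {s l l′} → s ConvergesTo l → s ConvergesTo l′ → l ≡ l′
limit-unique {s} {l} {l′} c c′ = ∣∣≡0⇒≡ (≡-from-ε (ℚ.0≤∣p∣ (l - l′)) close)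
  where
  open ℚ.≤-Reasoning
  split = solve 3 (λ l l′ t → l :- l′ := :- (t :- l) :+ (t :- l′)) refl
  back = solve 2 (λ x y → x :- y :+ y := x) refl
  ∣∣≡0⇒≡ : ∣ l - l′ ∣ ≡ 0ℚ → l ≡ l′
  ∣∣≡0⇒≡ e = trans (sym (back l l′))
    (trans (cong (_+ l′) (ℚ.∣p∣≡0⇒p≡0 (l - l′) e)) (ℚ.+-identityˡ l′))
  close : ∀ η → 0ℚ < η → ∣ l - l′ ∣ < η + η
  close η 0<η with c η 0<η | c′ η 0<η
  ... | N , near | N′ , near′ = begin-strict
    ∣ l - l′ ∣                       ≡⟨ cong ∣_∣ (split l l′ t) ⟩
    ∣ - (t - l) + (t - l′) ∣         ≤⟨ ℚ.∣p+q∣≤∣p∣+∣q∣ (- (t - l)) (t - l′) ⟩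
    ∣ - (t - l) ∣ + ∣ t - l′ ∣       ≡⟨ cong (_+ ∣ t - l′ ∣) (ℚ.∣-p∣≡∣p∣ (t - l)) ⟩
    ∣ t - l ∣ + ∣ t - l′ ∣           <⟨ ℚ.+-mono-< (near (N ℕ.+ N′) (ℕ.m≤m+n N N′))
                                                  (near′ (N ℕ.+ N′) (ℕ.m≤n+m N′ N)) ⟩
    η + η                           ∎
    where t = s (N ℕ.+ N′)

module Laplacian {n : ℕ} (H : Graph n) where

  A = adjacency H
  d = degree H

  A-sym : ∀ i j → A i j ≡ A j i
  A-sym i j = cong (λ b → if b then 1ℚ else 0ℚ) (symm H i j)

  0≤A : ∀ i j → 0ℚ ≤ A i j
  0≤A i j with adj H i j
  ... | true  = ℚ.<⇒≤ 0<1
  ... | false = ℚ.≤-refl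

  0≤d : ∀ i → 0ℚ ≤ d i
  0≤d i = 0≤-sum (0≤A i)

  lap : (Fin n → ℚ) → Fin n → ℚ
  lap f j = sum λ i → A j i * (f j - f i)

  lap-expand : ∀ f j → lap f j ≡ d j * f j - sum (λ i → A j i * f i)
  lap-expand f j = begin
    sum (λ i → A j i * (f j - f i))              ≡⟨ sum-cong-≗ (λ i → distrib (A j i) (f j) (f i)) ⟩
    sum (λ i → A j i * f j - A j i * f i)        ≡⟨ sum-minus {n} _ _ ⟩
    sum (λ i → A j i * f j) - sum (λ i → A j i * f i)
      ≡⟨ cong (_- sum (λ i → A j i * f i)) (sum-*ʳ (f j) (A j)) ⟩
    d j * f j - sum (λ i → A j i * f i)          ∎
    where
    open ≡-Reasoning
    distrib = solve 3 (λ a x y → a :* (x :- y) := a :* x :- a :* y) refl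

  lap-linear : ∀ a b f g j → lap (λ i → a * f i + b * g i) j ≡ a * lap f j + b * lap g j
  lap-linear a b f g j = begin
    lap (λ i → a * f i + b * g i) j
      ≡⟨ sum-cong-≗ (λ i → distrib a b (f j) (f i) (g j) (g i) (A j i)) ⟩
    sum (λ i → a * (A j i * (f j - f i)) + b * (A j i * (g j - g i)))
      ≡⟨ ∑-distrib-+ (λ i → a * (A j i * (f j - f i))) _ ⟩
    sum (λ i → a * (A j i * (f j - f i))) + sum (λ i → b * (A j i * (g j - g i)))
      ≡⟨ cong₂ _+_ (sum-*ˡ a (λ i → A j i * (f j - f i))) (sum-*ˡ b (λ i → A j i * (g j - g i))) ⟩
    a * lap f j + b * lap g j ∎
    where
    open ≡-Reasoning
    distrib = solve 7 (λ a b x x′ y y′ e →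
      e :* (a :* x :+ b :* y :- (a :* x′ :+ b :* y′)) :=
      a :* (e :* (x :- x′)) :+ b :* (e :* (y :- y′))) refl

  lap-sum : ∀ {m} (w : Fin m → ℚ) (f : Fin m → Fin n → ℚ) j →
            lap (λ i → sum λ z → w z * f z i) j ≡ sum λ z → w z * lap (f z) j
  lap-sum w f j = begin
    sum (λ i → A j i * (sum (λ z → w z * f z j) - sum (λ z → w z * f z i)))
      ≡⟨ sum-cong-≗ (λ i → trans (cong (A j i *_) (sym (sum-minus (λ z → w z * f z j) (λ z → w z * f z i))))
                                 (sym (sum-*ˡ (A j i) (λ z → w z * f z j - w z * f z i)))) ⟩
    sum (λ i → sum λ z → A j i * (w z * f z j - w z * f z i))
      ≡⟨ ∑-comm (λ i z → A j i * (w z * f z j - w z * f z i)) ⟩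
    sum (λ z → sum λ i → A j i * (w z * f z j - w z * f z i))
      ≡⟨ sum-cong-≗ (λ z → trans (sum-cong-≗ λ i → distrib (A j i) (w z) (f z j) (f z i))
                                 (sum-*ˡ (w z) (λ i → A j i * (f z j - f z i)))) ⟩
    sum (λ z → w z * lap (f z) j) ∎
    where
    open ≡-Reasoning
    distrib = solve 4 (λ a w x y → a :* (w :* x :- w :* y) := w :* (a :* (x :- y))) refl

-- If Γ is the pseudoinverse of the Laplacian, then r i k = Γ i i + Γ k k - 2 Γ i k satisfies
-- `laplace`, with a `τ` independent of k. This independence makes `τ` cancel in `lap-h`, so each
-- graph may bring its own.
record Resistance {n : ℕ} (H : Graph n) : Set where
  open Laplacian H
  field
    r        : Fin n → Fin n → ℚ
    r-sym    : ∀ a b → r a b ≡ r b a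
    r-diag   : ∀ a → r a a ≡ 0ℚ
    τ        : Fin n → ℚ
    laplace  : ∀ j k → lap (λ i → r i k) j ≡ τ j - fromℕ 2 * δ j k
    degree≢0 : ∀ j → d j ≢ 0ℚ

-- Hitting times and Kemeny's constant

module Hitting {n : ℕ} {H : Graph n} (res : Resistance H) where
  open Laplacian H
  open Resistance res

  P = transition H

  D : ℚ
  D = sum d

  s : Fin n → ℚ
  s k = sum λ z → d z * r z k

  W : ℚ
  W = sum λ k → d k * s k

  kemeny : ℚ
  kemeny = ½ * W * inv D

  h : Fin n → Fin n → ℚ
  h j k = ½ * (D * r j k + s k - s j)

  0<d : ∀ j → 0ℚ < d j
  0<d j = ≤∧≢⇒< (0≤d j) (degree≢0 j)

  0<D : Fin n → 0ℚ < D
  0<D j = ℚ.<-≤-trans (0<d j) (term≤sum 0≤d j)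

  0≤P : ∀ j i → 0ℚ ≤ P j i
  0≤P j i = 0≤-* (0≤inv (0<d j)) (0≤A j i)

  P-total : ∀ j → sum (P j) ≡ 1ℚ
  P-total j = begin
    sum (P j)        ≡⟨ sum-*ˡ (inv (d j)) (A j) ⟩
    inv (d j) * d j  ≡⟨ ℚ.*-comm (inv (d j)) (d j) ⟩
    d j * inv (d j)  ≡⟨ *-inv (degree≢0 j) ⟩
    1ℚ               ∎
    where open ≡-Reasoning

  sum-P : ∀ j (f : Fin n → ℚ) → sum (λ i → P j i * f i) ≡ inv (d j) * sum (λ i → A j i * f i)
  sum-P j f = trans (sum-cong-≗ {n} λ i → ℚ.*-assoc (inv (d j)) (A j i) (f i))
                    (sum-*ˡ (inv (d j)) (λ i → A j i * f i))

  lap-s : ∀ j → lap s j ≡ D * τ j - fromℕ 2 * d j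
  lap-s j = begin
    lap s j
      ≡⟨ lap-sum d r j ⟩
    sum (λ z → d z * lap (r z) j)
      ≡⟨ sum-cong-≗ (λ z → trans (cong (d z *_) (lap-row z)) (distrib (d z) (τ j) (δ z j))) ⟩
    sum (λ z → d z * τ j - fromℕ 2 * (d z * δ z j))
      ≡⟨ sum-minus {n} (λ z → d z * τ j) (λ z → fromℕ 2 * (d z * δ z j)) ⟩
    sum (λ z → d z * τ j) - sum (λ z → fromℕ 2 * (d z * δ z j))
      ≡⟨ cong₂ _-_ (sum-*ʳ (τ j) d)
          (trans (sum-*ˡ (fromℕ 2) (λ z → d z * δ z j)) (cong (fromℕ 2 *_) (sum-δʳ j d))) ⟩
    D * τ j - fromℕ 2 * d j ∎
    where
    open ≡-Reasoning
    distrib = solve 3 (λ a t e → a :* (t :- # 2 :* e) := a :* t :- # 2 :* (a :* e)) refl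
    lap-row : ∀ z → lap (r z) j ≡ τ j - fromℕ 2 * δ z j
    lap-row z = trans (sum-cong-≗ λ i → cong₂ (λ x y → A j i * (x - y)) (r-sym z j) (r-sym z i))
      (trans (laplace j z) (cong (λ e → τ j - fromℕ 2 * e) (δ-sym j z)))

  -- The multiples of `D * τ j` from `laplace` and `lap-s` cancel. The total over j is 0, as it must
  -- be for a Laplacian.
  lap-h : ∀ j k → lap (λ i → h i k) j ≡ d j - D * δ j k
  lap-h j k = begin
    lap (λ i → h i k) j
      ≡⟨ sum-cong-≗ (λ i → shape D (r j k) (r i k) (s k) (s j) (s i) (A j i)) ⟩
    lap (λ i → ½ * D * r i k + - ½ * s i) j
      ≡⟨ lap-linear (½ * D) (- ½) (λ i → r i k) s j ⟩
    ½ * D * lap (λ i → r i k) j + - ½ * lap s j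
      ≡⟨ cong₂ (λ x y → ½ * D * x + - ½ * y) (laplace j k) (lap-s j) ⟩
    ½ * D * (τ j - fromℕ 2 * δ j k) + - ½ * (D * τ j - fromℕ 2 * d j)
      ≡⟨ final D (τ j) (δ j k) (d j) ⟩
    d j - D * δ j k ∎
    where
    open ≡-Reasoning
    shape = solve 7 (λ D x x′ c y y′ a →
      a :* (con ½ :* (D :* x :+ c :- y) :- con ½ :* (D :* x′ :+ c :- y′)) :=
      a :* (con ½ :* D :* x :+ :- con ½ :* y :- (con ½ :* D :* x′ :+ :- con ½ :* y′))) refl
    final = solve 4 (λ D t e d → con ½ :* D :* (t :- # 2 :* e) :+ :- con ½ :* (D :* t :- # 2 :* d) := d :- D :* e) refl

  h-diag : ∀ k → h k k ≡ 0ℚ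
  h-diag k = trans (cong (λ x → ½ * (D * x + s k - s k)) (r-diag k)) (zero-form D (s k))
    where
    zero-form = solve 2 (λ D s → con ½ :* (D :* con 0ℚ :+ s :- s) := con 0ℚ) refl

  -- Division of `lap-h` by `d j`. For j = k this is Kac's formula: the mean return time to k is
  -- `D * inv (d k)`.
  h-step : ∀ j k → h j k + D * inv (d j) * δ j k ≡ 1ℚ + sum λ i → P j i * h i k
  h-step j k = begin
    h j k + D * ι * δ j k
      ≡⟨ expand (h j k) D ι (δ j k) (d j) Σh ⟩
    h j k + ι * d j - ι * (d j - D * δ j k)
      ≡⟨ cong (λ x → h j k + ι * d j - ι * x) (trans (sym (lap-h j k)) (lap-expand (λ i → h i k) j)) ⟩
    h j k + ι * d j - ι * (d j * h j k - Σh)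
      ≡⟨ collect (h j k) ι (d j) Σh ⟩
    h j k + d j * ι - d j * ι * h j k + ι * Σh
      ≡⟨ cong (λ x → h j k + x - x * h j k + ι * Σh) (*-inv (degree≢0 j)) ⟩
    h j k + 1ℚ - 1ℚ * h j k + ι * Σh
      ≡⟨ simp (h j k) (ι * Σh) ⟩
    1ℚ + ι * Σh
      ≡⟨ cong (_+_ 1ℚ) (sym (sum-P j (λ i → h i k))) ⟩
    1ℚ + sum (λ i → P j i * h i k) ∎
    where
    open ≡-Reasoning
    ι = inv (d j)
    Σh = sum λ i → A j i * h i k
    expand = solve 6 (λ h D ι e d S → h :+ D :* ι :* e := h :+ ι :* d :- ι :* (d :- D :* e)) refl
    collect = solve 4 (λ h ι d S → h :+ ι :* d :- ι :* (d :* h :- S) := h :+ d :* ι :- d :* ι :* h :+ ι :* S) refl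
    simp = solve 2 (λ h S → h :+ con 1ℚ :- con 1ℚ :* h :+ S := con 1ℚ :+ S) refl

  h-step-≢ : ∀ {j k} → j ≢ k → h j k ≡ 1ℚ + sum λ i → P j i * h i k
  h-step-≢ {j} {k} j≢k = trans (sym (trans
    (cong (λ e → h j k + D * inv (d j) * e) (δ-≢ j≢k)) (drop (h j k) (D * inv (d j)))))
    (h-step j k)
    where
    drop = solve 2 (λ x y → x :+ y :* con 0ℚ := x) refl

  -- At a minimum j ≢ k the recursion would give h j k ≥ 1 + h j k.
  0≤h : ∀ j k → 0ℚ ≤ h j k
  0≤h j k with argmin k (λ i → h i k)
  ... | m , least with m ≟ k
  ...   | yes refl = ℚ.≤-trans (ℚ.≤-reflexive (sym (h-diag k))) (least j)
  ...   | no  m≢k  = contradiction (ℚ.<-≤-trans below above) (ℚ.<-irrefl refl)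
    where
    below : h m k < 1ℚ + h m k
    below = subst (_< 1ℚ + h m k) (ℚ.+-identityˡ (h m k)) (ℚ.+-monoˡ-< (h m k) 0<1)
    open ℚ.≤-Reasoning
    above : 1ℚ + h m k ≤ h m k
    above = begin
      1ℚ + h m k                          ≡⟨ cong (_+_ 1ℚ) (sym (ℚ.*-identityˡ (h m k))) ⟩
      1ℚ + 1ℚ * h m k                     ≡⟨ cong (λ x → 1ℚ + x * h m k) (sym (P-total m)) ⟩
      1ℚ + sum (P m) * h m k              ≡⟨ cong (_+_ 1ℚ) (sym (sum-*ʳ (h m k) (P m))) ⟩
      1ℚ + sum (λ i → P m i * h m k)      ≤⟨ ℚ.+-monoʳ-≤ 1ℚ (sum-mono λ i → *-monoˡ-≤ (0≤P m i) (least i)) ⟩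
      1ℚ + sum (λ i → P m i * h i k)      ≡⟨ sym (h-step-≢ m≢k) ⟩
      h m k                               ∎

  1≤h : ∀ {j k} → j ≢ k → 1ℚ ≤ h j k
  1≤h {j} {k} j≢k = subst (1ℚ ≤_) (sym (h-step-≢ j≢k))
    (subst (_≤ 1ℚ + sum (λ i → P j i * h i k)) (ℚ.+-identityʳ 1ℚ)
      (ℚ.+-monoʳ-≤ 1ℚ (0≤-sum λ i → 0≤-* (0≤P j i) (0≤h i k))))

  module Passage (k : Fin n) where

    -- The transition operator killed at k: one step of the walk that does not land on k.
    Q : (Fin n → ℚ) → Fin n → ℚ
    Q f j = sumExcept k (λ i → P j i * f i)

    Q-cong : ∀ {f g} → (∀ i → i ≢ k → f i ≡ g i) → ∀ j → Q f j ≡ Q g j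
    Q-cong {f} {g} e j = sum-cong-≗ λ i → go i
      where
      go : ∀ i → (if does (i ≟ k) then 0ℚ else P j i * f i) ≡ (if does (i ≟ k) then 0ℚ else P j i * g i)
      go i with i ≟ k
      ... | yes _  = refl
      ... | no i≢k = cong (P j i *_) (e i i≢k)

    Q-mono : ∀ {f g} → (∀ i → i ≢ k → f i ≤ g i) → ∀ j → Q f j ≤ Q g j
    Q-mono {f} {g} le j = sum-mono λ i → go i
      where
      go : ∀ i → (if does (i ≟ k) then 0ℚ else P j i * f i) ≤ (if does (i ≟ k) then 0ℚ else P j i * g i)
      go i with i ≟ k
      ... | yes _  = ℚ.≤-refl
      ... | no i≢k = *-monoˡ-≤ (0≤P j i) (le i i≢k)

    Q-linear : ∀ a b f g j → Q (λ i → a * f i + b * g i) j ≡ a * Q f j + b * Q g j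
    Q-linear a b f g j = trans (sum-cong-≗ λ i → go i)
      (trans (∑-distrib-+ {n} (λ i → a * cut f i) (λ i → b * cut g i))
        (cong₂ _+_ (sum-*ˡ a (cut f)) (sum-*ˡ b (cut g))))
      where
      cut : (Fin n → ℚ) → Fin n → ℚ
      cut f i = if does (i ≟ k) then 0ℚ else P j i * f i
      distrib = solve 5 (λ p a b x y → p :* (a :* x :+ b :* y) := a :* (p :* x) :+ b :* (p :* y)) refl
      vanish = solve 2 (λ a b → con 0ℚ := a :* con 0ℚ :+ b :* con 0ℚ) refl
      go : ∀ i → cut (λ i → a * f i + b * g i) i ≡ a * cut f i + b * cut g i
      go i with i ≟ k
      ... | yes _ = vanish a b
      ... | no _  = distrib (P j i) a b (f i) (g i)

    Q-zero : ∀ j → Q (λ _ → 0ℚ) j ≡ 0ℚ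
    Q-zero j = sum-zero λ i → go i
      where
      go : ∀ i → (if does (i ≟ k) then 0ℚ else P j i * 0ℚ) ≡ 0ℚ
      go i with i ≟ k
      ... | yes _ = refl
      ... | no _  = ℚ.*-zeroʳ (P j i)

    Q-vanishing : ∀ f j → f k ≡ 0ℚ → Q f j ≡ sum λ i → P j i * f i
    Q-vanishing f j fk≡0 = sum-cong-≗ λ i → go i
      where
      go : ∀ i → (if does (i ≟ k) then 0ℚ else P j i * f i) ≡ P j i * f i
      go i with i ≟ k
      ... | yes refl = sym (trans (cong (P j i *_) fk≡0) (ℚ.*-zeroʳ (P j i)))
      ... | no _     = refl

    Q-one : ∀ j → P j k ≡ 1ℚ - Q (λ _ → 1ℚ) j
    Q-one j = begin
      P j k                                 ≡⟨ shift (P j k) (sum (P j)) ⟩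
      sum (P j) - (sum (P j) - P j k)       ≡⟨ cong₂ (λ x y → x - (sum (P j) - y)) (P-total j) (sym (sum-δ k (P j))) ⟩
      1ℚ - (sum (P j) - sum (λ i → δ i k * P j i))
        ≡⟨ cong (_-_ 1ℚ) (sym (sum-minus {n} (P j) (λ i → δ i k * P j i))) ⟩
      1ℚ - sum (λ i → P j i - δ i k * P j i) ≡⟨ cong (_-_ 1ℚ) (sum-cong-≗ go) ⟩
      1ℚ - Q (λ _ → 1ℚ) j                   ∎
      where
      open ≡-Reasoning
      shift = solve 2 (λ x y → x := y :- (y :- x)) refl
      one = solve 1 (λ x → x :- con 1ℚ :* x := con 0ℚ) refl
      none = solve 1 (λ x → x :- con 0ℚ :* x := x :* con 1ℚ) refl
      go : ∀ i → P j i - δ i k * P j i ≡ (if does (i ≟ k) then 0ℚ else P j i * 1ℚ)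
      go i with i ≟ k
      ... | yes _ = one (P j i)
      ... | no _  = none (P j i)

    -- The probability that the walk from j avoids k in the steps 1, ..., t.
    survival : ℕ → Fin n → ℚ
    survival zero    = λ _ → 1ℚ
    survival (suc t) = Q (survival t)

    -- The expectation of `h` at time t, restricted to the event that k is avoided in the steps 1,
    -- ..., t.
    remaining : ℕ → Fin n → ℚ
    remaining zero    = λ j → h j k
    remaining (suc t) = Q (remaining t)

    firstPassage-survival : ∀ t j → firstPassage P (suc t) j k ≡ survival t j - survival (suc t) j
    firstPassage-survival zero    j = Q-one j
    firstPassage-survival (suc t) j = begin
      Q (λ i → firstPassage P (suc t) i k) j
        ≡⟨ Q-cong (λ i _ → trans (firstPassage-survival t i) (as-linear (survival t i) (survival (suc t) i))) j ⟩
      Q (λ i → 1ℚ * survival t i + - 1ℚ * survival (suc t) i) j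
        ≡⟨ Q-linear 1ℚ (- 1ℚ) (survival t) (survival (suc t)) j ⟩
      1ℚ * survival (suc t) j + - 1ℚ * survival (suc (suc t)) j
        ≡⟨ sym (as-linear (survival (suc t) j) (survival (suc (suc t)) j)) ⟩
      survival (suc t) j - survival (suc (suc t)) j ∎
      where
      open ≡-Reasoning
      as-linear = solve 2 (λ x y → x :- y := con 1ℚ :* x :+ :- con 1ℚ :* y) refl

    -- The step equation of `h`, pushed t times through `Q`. It holds only off k, and `Q` reads only
    -- values off k.
    remaining-step : ∀ t {j} → j ≢ k → remaining t j ≡ survival t j + remaining (suc t) j
    remaining-step zero    {j} j≢k =
      trans (h-step-≢ j≢k) (cong (_+_ 1ℚ) (sym (Q-vanishing (λ i → h i k) j (h-diag k))))
    remaining-step (suc t) {j} j≢k = begin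
      Q (remaining t) j
        ≡⟨ Q-cong (λ i i≢k → trans (remaining-step t i≢k) (as-linear (survival t i) (remaining (suc t) i))) j ⟩
      Q (λ i → 1ℚ * survival t i + 1ℚ * remaining (suc t) i) j
        ≡⟨ Q-linear 1ℚ 1ℚ (survival t) (remaining (suc t)) j ⟩
      1ℚ * survival (suc t) j + 1ℚ * remaining (suc (suc t)) j
        ≡⟨ sym (as-linear (survival (suc t) j) (remaining (suc (suc t)) j)) ⟩
      survival (suc t) j + remaining (suc (suc t)) j ∎
      where
      open ≡-Reasoning
      as-linear = solve 2 (λ x y → x :+ y := con 1ℚ :* x :+ con 1ℚ :* y) refl

    -- Summation by parts: Σ s · Pr(T = s) up to t equals the sum of the survival probabilities
    -- before t, minus `fromℕ t * survival t j`; the tail of that sum is `remaining t j`. Both error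
    -- terms have to tend to 0.
    partialMean-error : ∀ t {j} → j ≢ k →
      h j k ≡ partialMean P j k t + fromℕ t * survival t j + remaining t j
    partialMean-error zero    {j} j≢k = start (h j k)
      where
      start = solve 1 (λ x → x := con 0ℚ :+ con 0ℚ :* con 1ℚ :+ x) refl
    partialMean-error (suc t) {j} j≢k = begin
      h j k
        ≡⟨ partialMean-error t j≢k ⟩
      pm + fromℕ t * S + remaining t j
        ≡⟨ cong (_+_ (pm + fromℕ t * S)) (remaining-step t j≢k) ⟩
      pm + fromℕ t * S + (S + R′)
        ≡⟨ arrange pm (fromℕ t) S S′ R′ ⟩
      pm + (1ℚ + fromℕ t) * (S - S′) + (1ℚ + fromℕ t) * S′ + R′
        ≡⟨ cong₂ (λ x y → pm + x * y + x * S′ + R′) (sym (fromℕ-suc t)) (sym (firstPassage-survival t j)) ⟩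
      partialMean P j k (suc t) + fromℕ (suc t) * survival (suc t) j + remaining (suc t) j ∎
      where
      open ≡-Reasoning
      pm = partialMean P j k t
      S  = survival t j
      S′ = survival (suc t) j
      R′ = remaining (suc t) j
      arrange = solve 5 (λ p t S S′ R → p :+ t :* S :+ (S :+ R) := p :+ (con 1ℚ :+ t) :* (S :- S′) :+ (con 1ℚ :+ t) :* S′ :+ R) refl

    0≤survival : ∀ t j → 0ℚ ≤ survival t j
    0≤survival zero    j = ℚ.<⇒≤ 0<1
    0≤survival (suc t) j = subst (_≤ survival (suc t) j) (Q-zero j) (Q-mono (λ i _ → 0≤survival t i) j)

    survival≤remaining : ∀ t {j} → j ≢ k → survival t j ≤ remaining t j
    survival≤remaining zero    j≢k = 1≤h j≢k
    survival≤remaining (suc t) {j} j≢k = Q-mono (λ i i≢k → survival≤remaining t i≢k) j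

    bound : ℕ
    bound = proj₁ (bounded (λ j → h j k))

    B : ℚ
    B = fromℕ (suc bound)

    -- Together with `remaining-step` this gives B R(t + 1) ≤ (B - 1) R(t) for R = `remaining`. Of
    -- this geometric decay `quadratic-decay` keeps the rate 1/t², which beats the factor t in
    -- `partialMean-error` without any powers of 1 - 1/B.
    remaining≤survival : ∀ t j → remaining t j ≤ B * survival t j
    remaining≤survival zero    j = ℚ.≤-trans (proj₂ (bounded (λ j → h j k)) j) (ℚ.≤-reflexive (sym (ℚ.*-identityʳ B)))
    remaining≤survival (suc t) j = ℚ.≤-trans (Q-mono (λ i _ → remaining≤survival t i) j)
      (ℚ.≤-reflexive (trans (Q-cong (λ i _ → as-linear B (survival t i)) j)
        (trans (Q-linear B 0ℚ (survival t) (survival t) j)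
          (sym (as-linear B (survival (suc t) j))))))
      where
      as-linear = solve 2 (λ b x → b :* x := b :* x :+ con 0ℚ :* x) refl

    -- The shift by 2 B keeps y (y - 2 B) + B nonnegative for y = `x (suc t)`, from t = 0 on. That
    -- is the surplus in the step of `quadratic-decay`.
    x : ℕ → ℚ
    x t = fromℕ t + fromℕ 2 * B

    C : ℚ
    C = B * (x 0 * x 0)

    0<B : 0ℚ < B
    0<B = ℚ.<-≤-trans 0<1 (fromℕ-mono-≤ {1} {suc bound} (s≤s z≤n))

    -- The decay rate is at most 1 - 1/B, and B (y - 1)² - (B - 1) y² = y (y - 2B) + B.
    quadratic-decay : ∀ t {j} → j ≢ k → remaining t j * (x t * x t) ≤ C
    quadratic-decay zero    {j} j≢k = subst₂ _≤_ (ℚ.*-comm (x 0 * x 0) (h j k)) (ℚ.*-comm (x 0 * x 0) B)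
      (*-monoˡ-≤ (0≤-square (x 0)) (proj₂ (bounded (λ j → h j k)) j))
    quadratic-decay (suc t) {j} j≢k = *-cancelˡ-≤ 0<B (ℚ.≤-trans lossy (*-monoˡ-≤ (ℚ.<⇒≤ 0<B) (quadratic-decay t j≢k)))
      where
      R  = remaining t j
      R′ = remaining (suc t) j
      S  = survival t j
      τ′ = fromℕ t
      0≤R : 0ℚ ≤ R
      0≤R = ℚ.≤-trans (0≤survival t j) (survival≤remaining t j≢k)
      shape : ∀ B R S R′ t → R ≡ S + R′ → B * (R * ((t + fromℕ 2 * B) * (t + fromℕ 2 * B)))
                - B * (R′ * ((1ℚ + t + fromℕ 2 * B) * (1ℚ + t + fromℕ 2 * B)))
              ≡ (B * S - R) * ((1ℚ + t + fromℕ 2 * B) * (1ℚ + t + fromℕ 2 * B)) + R * ((1ℚ + t + fromℕ 2 * B) * (1ℚ + t) + B)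
      shape B .(S + R′) S R′ t refl = poly B S R′ t
        where
        poly = solve 4 (λ B S R′ t →
          B :* ((S :+ R′) :* ((t :+ # 2 :* B) :* (t :+ # 2 :* B))) :- B :* (R′ :* ((con 1ℚ :+ t :+ # 2 :* B) :* (con 1ℚ :+ t :+ # 2 :* B))) :=
          (B :* S :- (S :+ R′)) :* ((con 1ℚ :+ t :+ # 2 :* B) :* (con 1ℚ :+ t :+ # 2 :* B)) :+ (S :+ R′) :* ((con 1ℚ :+ t :+ # 2 :* B) :* (con 1ℚ :+ t) :+ B)) refl
      0≤B = ℚ.<⇒≤ 0<B
      0≤1+t : 0ℚ ≤ 1ℚ + τ′
      0≤1+t = 0≤-+ (ℚ.<⇒≤ 0<1) (0≤fromℕ t)
      lossy : B * (R′ * (x (suc t) * x (suc t))) ≤ B * (R * (x t * x t))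
      lossy = subst (λ y → B * (R′ * ((y + fromℕ 2 * B) * (y + fromℕ 2 * B))) ≤ B * (R * (x t * x t))) (sym (fromℕ-suc t))
        (≤-via (shape B R S R′ τ′ (remaining-step t j≢k))
          (0≤-+ (0≤-* (≤⇒0≤ (remaining≤survival t j)) (0≤-square (1ℚ + τ′ + fromℕ 2 * B)))
            (0≤-* 0≤R (0≤-+ (0≤-* (0≤-+ 0≤1+t (0≤-* (0≤fromℕ 2) 0≤B)) 0≤1+t) 0≤B))))

    passage-converges : ∀ {j} → j ≢ k → partialMean P j k ConvergesTo h j k
    passage-converges {j} j≢k η 0<η = N , near
      where
      -- The error is at most R x ≤ C / x, and C ≤ η M < η x for M ≥ C / η.
      N = proj₁ (archimedean (C * inv η))
      module _ (M : ℕ) (N≤M : N ℕ.≤ M) where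
        R = remaining M j
        S = survival M j
        m = fromℕ M
        0≤S = 0≤survival M j
        0≤R = ℚ.≤-trans 0≤S (survival≤remaining M j≢k)
        0≤m = 0≤fromℕ M
        0≤B = ℚ.<⇒≤ 0<B
        E = m * S + R
        1≤B : 1ℚ ≤ B
        1≤B = fromℕ-mono-≤ {1} {suc bound} (s≤s z≤n)
        0<x : 0ℚ < x M
        0<x = ℚ.<-≤-trans (0<-* {fromℕ 2} (ℚ.positive⁻¹ (fromℕ 2)) 0<B) (≤-via (drop m (fromℕ 2 * B)) 0≤m)
          where
          drop = solve 2 (λ m y → m :+ y :- y := m) refl
        E≤ : E ≤ R * x M
        E≤ = ≤-via (shape m S R B)
          (0≤-+ (0≤-* 0≤m (≤⇒0≤ (survival≤remaining M j≢k))) (0≤-* 0≤R (0≤-+ 0≤B (≤⇒0≤ 1≤B))))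
          where
          shape = solve 4 (λ m S R B → R :* (m :+ # 2 :* B) :- (m :* S :+ R) := m :* (R :- S) :+ R :* (B :+ (B :- con 1ℚ))) refl
        C≤ : C ≤ η * m
        C≤ = subst (_≤ η * m) (trans (swap η C (inv η)) (trans (cong (C *_) (*-inv (>⇒≢ 0<η))) (ℚ.*-identityʳ C)))
          (*-monoˡ-≤ (ℚ.<⇒≤ 0<η) (ℚ.≤-trans (proj₂ (archimedean (C * inv η))) (fromℕ-mono-≤ {N} {M} N≤M)))
          where
          swap = solve 3 (λ e c i → e :* (c :* i) := c :* (e :* i)) refl
        m<x : m < x M
        m<x = subst (_< x M) (ℚ.+-identityʳ m) (ℚ.+-monoʳ-< m (0<-* {fromℕ 2} (ℚ.positive⁻¹ (fromℕ 2)) 0<B))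
        open ℚ.≤-Reasoning
        xE<xη : x M * E < x M * η
        xE<xη = begin-strict
          x M * E            ≤⟨ *-monoˡ-≤ (ℚ.<⇒≤ 0<x) E≤ ⟩
          x M * (R * x M)    ≡⟨ swap (x M) R ⟩
          R * (x M * x M)    ≤⟨ quadratic-decay M j≢k ⟩
          C                  ≤⟨ C≤ ⟩
          η * m              <⟨ ℚ.*-monoʳ-<-pos η {{Data.Rational.positive 0<η}} m<x ⟩
          η * x M            ≡⟨ ℚ.*-comm η (x M) ⟩
          x M * η            ∎
          where
          swap = solve 2 (λ x R → x :* (R :* x) := R :* (x :* x)) refl
        E<η : E < η
        E<η = ℚ.*-cancelˡ-<-nonNeg (x M) {{Data.Rational.nonNegative (ℚ.<⇒≤ 0<x)}} xE<xη
        pm = partialMean P j k M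
        near : ∣ pm - h j k ∣ < η
        near = begin-strict
          ∣ pm - h j k ∣            ≡⟨ cong (λ y → ∣ pm - y ∣) (partialMean-error M j≢k) ⟩
          ∣ pm - (pm + m * S + R) ∣ ≡⟨ cong ∣_∣ (shape pm (m * S) R) ⟩
          ∣ - E ∣                   ≡⟨ ℚ.∣-p∣≡∣p∣ E ⟩
          ∣ E ∣                     ≡⟨ ℚ.0≤p⇒∣p∣≡p (0≤-+ (0≤-* 0≤m 0≤S) 0≤R) ⟩
          E                         <⟨ E<η ⟩
          η                         ∎
          where
          shape = solve 3 (λ p a b → p :- (p :+ a :+ b) := :- (a :+ b)) refl

  -- The two multiples of `D * s j` cancel, which is why the starting vertex drops out. The excluded
  -- term is 0 by `h-diag`.
  kemeny-sum : ∀ j → sumExcept j (λ k → h j k * (d k * inv D)) ≡ kemeny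
  kemeny-sum j = begin
    sumExcept j (λ k → h j k * (d k * inv D))
      ≡⟨ sum-cong-≗ (λ k → go k) ⟩
    sum (λ k → ½ * inv D * (D * (d k * r k j) + d k * s k - d k * s j))
      ≡⟨ sum-*ˡ (½ * inv D) (λ k → D * (d k * r k j) + d k * s k - d k * s j) ⟩
    ½ * inv D * sum (λ k → D * (d k * r k j) + d k * s k - d k * s j)
      ≡⟨ cong (½ * inv D *_) sums ⟩
    ½ * inv D * (D * s j + W - D * s j)
      ≡⟨ collect (inv D) (D * s j) W ⟩
    kemeny ∎
    where
    open ≡-Reasoning
    collect = solve 3 (λ i x W → con ½ :* i :* (x :+ W :- x) := con ½ :* W :* i) refl
    sums : sum (λ k → D * (d k * r k j) + d k * s k - d k * s j) ≡ D * s j + W - D * s j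
    sums = trans (sum-minus {n} (λ k → D * (d k * r k j) + d k * s k) (λ k → d k * s j))
      (cong₂ _-_ (trans (∑-distrib-+ {n} (λ k → D * (d k * r k j)) (λ k → d k * s k))
                        (cong (_+ W) (sum-*ˡ D (λ k → d k * r k j))))
                 (sum-*ʳ (s j) d))
    term = solve 6 (λ r D s s′ d i → con ½ :* (D :* r :+ s :- s′) :* (d :* i) := con ½ :* i :* (D :* (d :* r) :+ d :* s :- d :* s′)) refl
    go : ∀ k → (if does (k ≟ j) then 0ℚ else h j k * (d k * inv D))
             ≡ ½ * inv D * (D * (d k * r k j) + d k * s k - d k * s j)
    go k = trans (off k) (trans (term (r j k) D (s k) (s j) (d k) (inv D))
             (cong (λ y → ½ * inv D * (D * (d k * y) + d k * s k - d k * s j)) (r-sym j k)))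
      where
      off : ∀ k → (if does (k ≟ j) then 0ℚ else h j k * (d k * inv D)) ≡ h j k * (d k * inv D)
      off k with k ≟ j
      ... | yes refl = sym (trans (cong (_* (d k * inv D)) (h-diag k)) (ℚ.*-zeroˡ (d k * inv D)))
      ... | no _     = refl

  -- Averaging h-step over a stationary w leaves 0 = 1 - w k * D / d k.
  stationary-unique : ∀ {w} → IsStationary P w → ∀ k → w k ≡ d k * inv D
  stationary-unique {w} st k = begin
    w k                                    ≡⟨ sym (ℚ.*-identityʳ (w k)) ⟩
    w k * 1ℚ                               ≡⟨ cong (w k *_) (sym (cong₂ _*_ (*-inv (degree≢0 k)) (*-inv (>⇒≢ (0<D k))))) ⟩
    w k * (d k * inv (d k) * (D * inv D))  ≡⟨ regroup (w k) (d k) (inv (d k)) D (inv D) ⟩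
    D * inv (d k) * w k * (d k * inv D)    ≡⟨ cong (_* (d k * inv D)) return ⟩
    1ℚ * (d k * inv D)                     ≡⟨ ℚ.*-identityˡ _ ⟩
    d k * inv D                            ∎
    where
    open ≡-Reasoning
    open IsStationary st
    regroup = solve 5 (λ w d i D I → w :* (d :* i :* (D :* I)) := D :* i :* w :* (d :* I)) refl
    Σwh = sum λ j → w j * h j k
    averaged : Σwh + D * inv (d k) * w k ≡ 1ℚ + Σwh
    averaged = begin
      Σwh + D * inv (d k) * w k
        ≡⟨ cong (_+_ Σwh) (sym (sum-δ k (λ j → D * inv (d j) * w j))) ⟩
      Σwh + sum (λ j → δ j k * (D * inv (d j) * w j))
        ≡⟨ sym (∑-distrib-+ {n} (λ j → w j * h j k) (λ j → δ j k * (D * inv (d j) * w j))) ⟩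
      sum (λ j → w j * h j k + δ j k * (D * inv (d j) * w j))
        ≡⟨ sum-cong-≗ (λ j → trans (pull (w j) (h j k) (δ j k) (D * inv (d j)))
             (trans (cong (w j *_) (h-step j k)) (push (w j) (sum (λ i → P j i * h i k))))) ⟩
      sum (λ j → w j + w j * sum (λ i → P j i * h i k))
        ≡⟨ ∑-distrib-+ {n} w (λ j → w j * sum (λ i → P j i * h i k)) ⟩
      sum w + sum (λ j → w j * sum (λ i → P j i * h i k))
        ≡⟨ cong₂ _+_ total inner ⟩
      1ℚ + Σwh ∎
      where
      pull = solve 4 (λ w h e x → w :* h :+ e :* (x :* w) := w :* (h :+ x :* e)) refl
      push = solve 2 (λ w S → w :* (con 1ℚ :+ S) := w :+ w :* S) refl
      inner : sum (λ j → w j * sum (λ i → P j i * h i k)) ≡ Σwh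
      inner = begin
        sum (λ j → w j * sum (λ i → P j i * h i k))
          ≡⟨ sum-cong-≗ (λ j → trans (sym (sum-*ˡ (w j) (λ i → P j i * h i k)))
               (sum-cong-≗ λ i → sym (ℚ.*-assoc (w j) (P j i) (h i k)))) ⟩
        sum (λ j → sum λ i → w j * P j i * h i k)
          ≡⟨ ∑-comm (λ j i → w j * P j i * h i k) ⟩
        sum (λ i → sum λ j → w j * P j i * h i k)
          ≡⟨ sum-cong-≗ (λ i → trans (sum-*ʳ (h i k) (λ j → w j * P j i)) (cong (_* h i k) (invariant i))) ⟩
        Σwh ∎
    return : D * inv (d k) * w k ≡ 1ℚ
    return = trans (isolate Σwh _) (trans (cong (_- Σwh) averaged) (cancel Σwh))
      where
      isolate = solve 2 (λ x y → y := x :+ y :- x) refl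
      cancel = solve 1 (λ x → con 1ℚ :+ x :- x := con 1ℚ) refl

  degrees-stationary : Fin n → IsStationary P (λ k → d k * inv D)
  degrees-stationary o = record
    { nonneg    = λ k → 0≤-* (0≤d k) (0≤inv (0<D o))
    ; total     = trans (sum-*ʳ (inv D) d) (*-inv (>⇒≢ (0<D o)))
    ; invariant = λ k → begin
        sum (λ j → d j * inv D * P j k)
          ≡⟨ sum-cong-≗ (λ j → trans (regroup (d j) (inv D) (inv (d j)) (A j k))
               (trans (cong (λ e → e * (inv D * A j k)) (*-inv (degree≢0 j)))
                 (trans (ℚ.*-identityˡ _) (cong (inv D *_) (A-sym j k))))) ⟩
        sum (λ j → inv D * A k j)  ≡⟨ sum-*ˡ (inv D) (A k) ⟩
        inv D * d k                ≡⟨ ℚ.*-comm (inv D) (d k) ⟩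
        d k * inv D                ∎
    }
    where
    open ≡-Reasoning
    regroup = solve 4 (λ d I i a → d :* I :* (i :* a) := d :* i :* (I :* a)) refl

  isKemeny : Connected H → IsKemeny H kemeny
  isKemeny conn = record
    { connected  = conn
    ; w          = λ k → d k * inv D
    ; m          = h
    ; stationary = degrees-stationary (proj₁ conn)
    ; passage    = λ j k j≢k → Passage.passage-converges k j≢k
    ; value      = kemeny-sum
    }

  -- A witness of `IsKemeny` may come with any `w` and `m`. Uniqueness of the stationary
  -- distribution and of limits identifies them, off the diagonal in the case of `m`.
  kemeny-unique : ∀ {κ} → IsKemeny H κ → κ ≡ kemeny
  kemeny-unique {κ} K = trans (sym (value o)) (trans (sum-cong-≗ λ k → go k) (kemeny-sum o))
    where
    open IsKemeny K
    o = proj₁ connected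
    go : ∀ k → (if does (k ≟ o) then 0ℚ else m o k * w k)
             ≡ (if does (k ≟ o) then 0ℚ else h o k * (d k * inv D))
    go k with k ≟ o
    ... | yes _  = refl
    ... | no k≢o = cong₂ _*_
      (limit-unique {partialMean P o k} (passage o k (k≢o ∘ sym)) (Passage.passage-converges k (k≢o ∘ sym)))
      (stationary-unique stationary k)

-- Trees grown vertex by vertex

-- For the Laplacian of a partly grown tree, whose vertices form a list.
lsum : ∀ {n} → List (Fin n) → (Fin n → ℚ) → ℚ
lsum []      f = 0ℚ
lsum (x ∷ S) f = f x + lsum S f

lsum-cong : ∀ {n} (S : List (Fin n)) {f g : Fin n → ℚ} → (∀ {x} → x ∈ S → f x ≡ g x) → lsum S f ≡ lsum S g
lsum-cong []      e = refl
lsum-cong (x ∷ S) e = cong₂ _+_ (e (here refl)) (lsum-cong S (e ∘ there))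

lsum-zero : ∀ {n} (S : List (Fin n)) {f : Fin n → ℚ} → (∀ {x} → x ∈ S → f x ≡ 0ℚ) → lsum S f ≡ 0ℚ
lsum-zero []      e = refl
lsum-zero (x ∷ S) e = cong₂ _+_ (e (here refl)) (lsum-zero S (e ∘ there))

lsum-δ : ∀ {n} {S : List (Fin n)} {p} → Unique S → p ∈ S → (f : Fin n → ℚ) →
         lsum S (λ x → δ x p * f x) ≡ f p
lsum-δ {S = x ∷ S} (x∉ ∷ _) (here refl) f = trans
  (cong₂ _+_ (trans (cong (_* f x) (δ-refl x)) (ℚ.*-identityˡ (f x)))
    (lsum-zero S λ {y} y∈S → trans
      (cong (_* f y) (δ-≢ λ y≡x → All¬⇒¬Any x∉ (subst (_∈ S) y≡x y∈S)))
      (ℚ.*-zeroˡ (f y))))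
  (ℚ.+-identityʳ (f x))
lsum-δ {S = x ∷ S} {p} (x∉ ∷ uniq) (there p∈S) f = trans
  (cong₂ _+_ (trans (cong (_* f x) (δ-≢ λ x≡p → All¬⇒¬Any x∉ (subst (_∈ S) (sym x≡p) p∈S)))
                    (ℚ.*-zeroˡ (f x)))
             (lsum-δ uniq p∈S f))
  (ℚ.+-identityˡ (f p))

-- The coefficient of `f i` is the multiplicity of `i` in `S`, written in the form that `lsum-δ`
-- evaluates.
lsum-count : ∀ {n} (S : List (Fin n)) (f : Fin n → ℚ) → lsum S f ≡ sum λ i → lsum S (λ x → δ x i * 1ℚ) * f i
lsum-count     []      f = sym (sum-zero λ i → ℚ.*-zeroˡ (f i))
lsum-count {n} (x ∷ S) f = begin
  f x + lsum S f
    ≡⟨ cong₂ _+_ (sym (trans (sum-cong-≗ λ i → cong (_* f i) (δ-sym x i)) (sum-δ x f))) (lsum-count S f) ⟩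
  sum (λ i → δ x i * f i) + sum (λ i → lsum S (λ x → δ x i * 1ℚ) * f i)
    ≡⟨ sym (∑-distrib-+ {n} (λ i → δ x i * f i) (λ i → lsum S (λ x → δ x i * 1ℚ) * f i)) ⟩
  sum (λ i → δ x i * f i + lsum S (λ x → δ x i * 1ℚ) * f i)
    ≡⟨ sum-cong-≗ (λ i → distrib (δ x i) (lsum S (λ x → δ x i * 1ℚ)) (f i)) ⟩
  sum (λ i → lsum (x ∷ S) (λ x → δ x i * 1ℚ) * f i) ∎
  where
  open ≡-Reasoning
  distrib = solve 3 (λ a b y → a :* y :+ b :* y := (a :* con 1ℚ :+ b) :* y) refl

lsum-complete : ∀ {n} {S : List (Fin n)} → Unique S → (∀ i → i ∈ S) → ∀ f → lsum S f ≡ sum f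
lsum-complete {S = S} uniq all f = trans (lsum-count S f)
  (sum-cong-≗ λ i → trans (cong (_* f i) (lsum-δ uniq (all i) (λ _ → 1ℚ))) (ℚ.*-identityˡ (f i)))

lsum-length : ∀ {n} (S : List (Fin n)) → lsum S (λ _ → 1ℚ) ≡ fromℕ (length S)
lsum-length []      = refl
lsum-length (x ∷ S) = trans (cong (_+_ 1ℚ) (lsum-length S)) (sym (fromℕ-suc (length S)))

-- The multiplicities sum to the length, and each is at most 1. This ends the recursion in `extend`.
unique⇒length≤ : ∀ {n} {S : List (Fin n)} → Unique S → length S ℕ.≤ n
unique⇒length≤ {n} {S} uniq = fromℕ-cancel-≤ {length S} {n} (subst₂ _≤_
  (trans (sym (lsum-count S (λ _ → 1ℚ))) (lsum-length S)) (sum-const n)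
  (sum-mono λ i → ℚ.≤-trans (ℚ.≤-reflexive (ℚ.*-identityʳ _)) (count≤1 i)))
  where
  open DecMembership (_≟_ {n}) using (_∈?_)
  count≤1 : ∀ i → lsum S (λ x → δ x i * 1ℚ) ≤ 1ℚ
  count≤1 i with i ∈? S
  ... | yes i∈S = ℚ.≤-reflexive (lsum-δ uniq i∈S (λ _ → 1ℚ))
  ... | no  i∉S = ℚ.≤-trans (ℚ.≤-reflexive (lsum-zero S λ {x} x∈S →
          trans (cong (_* 1ℚ) (δ-≢ λ x≡i → i∉S (subst (_∈ S) x≡i x∈S))) (ℚ.*-zeroˡ 1ℚ))) (ℚ.<⇒≤ 0<1)

module Growth {n : ℕ} (G : Graph n) where
  open Laplacian G using (A; A-sym)

  Adj-sym : ∀ {a b} → Adj G a b → Adj G b a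
  Adj-sym {a} {b} = subst T (symm G a b)

  ¬Adj-refl : ∀ {a} → ¬ Adj G a a
  ¬Adj-refl {a} = subst T (irrefl G a)

  A-adj : ∀ {a b} → Adj G a b → A a b ≡ 1ℚ
  A-adj {a} {b} adj-ab with adj G a b
  ... | true = refl

  A-¬adj : ∀ {a b} → ¬ Adj G a b → A a b ≡ 0ℚ
  A-¬adj {a} {b} ¬adj with adj G a b
  ... | true  = contradiction tt ¬adj
  ... | false = refl

  -- An order in which the graph induced on the list grows by attaching leaves. The last premise of
  -- `grow` says that `z` has no other neighbour in `S`, so no cycle is closed.
  data Built : List (Fin n) → Set where
    root : ∀ x → Built (x ∷ [])
    grow : ∀ {S z p} → Built S → z ∉ S → p ∈ S → Adj G z p →
           (∀ {q} → q ∈ S → Adj G z q → q ≡ p) → Built (z ∷ S)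

  unique : ∀ {S} → Built S → Unique S
  unique (root x)           = [] ∷ []
  unique (grow {S} B z∉S _ _ _) = ¬Any⇒All¬ S z∉S ∷ unique B

  -- All paths from the new leaf `z` go through `p`. Vertices outside the list are treated like the
  -- root, so symmetry, the zero diagonal and the four-point condition hold without membership
  -- hypotheses.
  dist : ∀ {S} → Built S → Fin n → Fin n → ℕ
  dist (root x) a b = 0
  dist (grow {S} {z} {p} B _ _ _ _) a b with a ≟ z | b ≟ z
  ... | yes _ | yes _ = 0
  ... | yes _ | no _  = suc (dist B p b)
  ... | no _  | yes _ = suc (dist B a p)
  ... | no _  | no _  = dist B a b

  dist-sym : ∀ {S} (B : Built S) a b → dist B a b ≡ dist B b a
  dist-sym (root x) a b = refl
  dist-sym (grow {S} {z} {p} B _ _ _ _) a b with a ≟ z | b ≟ z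
  ... | yes _ | yes _ = refl
  ... | yes _ | no _  = cong suc (dist-sym B p b)
  ... | no _  | yes _ = cong suc (dist-sym B a p)
  ... | no _  | no _  = dist-sym B a b

  dist-diag : ∀ {S} (B : Built S) a → dist B a a ≡ 0
  dist-diag (root x) a = refl
  dist-diag (grow {S} {z} {p} B _ _ _ _) a with a ≟ z
  ... | yes _ = refl
  ... | no _  = dist-diag B a

  module Step {S z p} (B : Built S) (z∉S : z ∉ S) (p∈S : p ∈ S) (zp : Adj G z p)
              (only : ∀ {q} → q ∈ S → Adj G z q → q ≡ p) where

    B⁺ : Built (z ∷ S)
    B⁺ = grow B z∉S p∈S zp only

    ∈⇒≢ : ∀ {a} → a ∈ S → a ≢ z
    ∈⇒≢ a∈S refl = z∉S a∈S

    dist-new : ∀ {b} → b ≢ z → dist B⁺ z b ≡ suc (dist B p b)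
    dist-new {b} b≢z with z ≟ z | b ≟ z
    ... | yes _  | no _    = refl
    ... | yes _  | yes b≡z = contradiction b≡z b≢z
    ... | no z≢z | _       = contradiction refl z≢z

    dist-new′ : ∀ {a} → a ≢ z → dist B⁺ a z ≡ suc (dist B a p)
    dist-new′ {a} a≢z with z ≟ z | a ≟ z
    ... | yes _  | no _    = refl
    ... | yes _  | yes a≡z = contradiction a≡z a≢z
    ... | no z≢z | _       = contradiction refl z≢z

    dist-old : ∀ {a b} → a ≢ z → b ≢ z → dist B⁺ a b ≡ dist B a b
    dist-old {a} {b} a≢z b≢z with a ≟ z | b ≟ z
    ... | no _    | no _    = refl
    ... | yes a≡z | _       = contradiction a≡z a≢z
    ... | no _    | yes b≡z = contradiction b≡z b≢z

    A-new : ∀ {b} → b ∈ S → A z b ≡ δ b p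
    A-new {b} b∈S with b ≟ p
    ... | yes refl = A-adj zp
    ... | no b≢p   = A-¬adj (b≢p ∘ only b∈S)

    A-new′ : ∀ {a} → a ∈ S → A a z ≡ δ a p
    A-new′ {a} a∈S = trans (A-sym a z) (A-new a∈S)

  -- If the new leaf occurs once among the four vertices, replacing it by its neighbour lowers all
  -- three sums by 1. If one of a, b equals one of u, v, one alternative is an equality. If a = b or
  -- u = v is the new leaf, the triangle inequality is enough.
  fourPoint : ∀ {S} (B : Built S) a b u v →
    (dist B a b ℕ.+ dist B u v ℕ.≤ dist B a u ℕ.+ dist B b v) ⊎
    (dist B a b ℕ.+ dist B u v ℕ.≤ dist B a v ℕ.+ dist B b u)
  fourPoint (root x) a b u v = inj₁ z≤n
  fourPoint B₀@(grow {S} {z} {p} B z∉S p∈S zp only) a b u v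
    with a ≟ u | b ≟ v | a ≟ v | b ≟ u
  ... | yes refl | _ | _ | _ = inj₂ (ℕ.≤-reflexive
        (trans (ℕ.+-comm (dist B₀ a b) (dist B₀ a v)) (cong (dist B₀ a v ℕ.+_) (dist-sym B₀ a b))))
  ... | _ | yes refl | _ | _ = inj₂ (ℕ.≤-reflexive
        (trans (ℕ.+-comm (dist B₀ a b) (dist B₀ u b)) (trans (cong (ℕ._+ dist B₀ a b) (dist-sym B₀ u b))
          (ℕ.+-comm (dist B₀ b u) (dist B₀ a b)))))
  ... | _ | _ | yes refl | _ = inj₁ (ℕ.≤-reflexive
        (trans (ℕ.+-comm (dist B₀ a b) (dist B₀ u a)) (cong₂ ℕ._+_ (dist-sym B₀ u a) (dist-sym B₀ a b))))
  ... | _ | _ | _ | yes refl = inj₁ (ℕ.≤-refl)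
  ... | no a≢u | no b≢v | no a≢v | no b≢u = go
    where
    open Step B z∉S p∈S zp only
    lift : ∀ {x y x₁ y₁ x₂ y₂} c → x ≡ c ℕ.+ y → x₁ ≡ c ℕ.+ y₁ → x₂ ≡ c ℕ.+ y₂ →
           (y ℕ.≤ y₁) ⊎ (y ℕ.≤ y₂) → (x ℕ.≤ x₁) ⊎ (x ℕ.≤ x₂)
    lift c refl refl refl (inj₁ h) = inj₁ (ℕ.+-monoʳ-≤ c h)
    lift c refl refl refl (inj₂ h) = inj₂ (ℕ.+-monoʳ-≤ c h)
    left : ∀ {x y x′ y′} → x ≡ suc x′ → y ≡ y′ → x ℕ.+ y ≡ 1 ℕ.+ (x′ ℕ.+ y′)
    left refl refl = refl
    right : ∀ {x y x′ y′} → x ≡ x′ → y ≡ suc y′ → x ℕ.+ y ≡ 1 ℕ.+ (x′ ℕ.+ y′)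
    right {x} {y′ = y′} refl refl = ℕ.+-suc x y′
    -- The four-point condition with the middle vertex taken twice; both alternatives then say the
    -- same.
    triangle : ∀ {S} (B : Built S) a b c → dist B a c ℕ.≤ dist B a b ℕ.+ dist B b c
    triangle B a b c with fourPoint B a c b b
    ... | inj₁ h = subst₂ ℕ._≤_ (trans (cong (dist B a c ℕ.+_) (dist-diag B b)) (ℕ.+-identityʳ _))
                                (cong (dist B a b ℕ.+_) (dist-sym B c b)) h
    ... | inj₂ h = subst₂ ℕ._≤_ (trans (cong (dist B a c ℕ.+_) (dist-diag B b)) (ℕ.+-identityʳ _))
                                (cong (dist B a b ℕ.+_) (dist-sym B c b)) h
    both : ∀ {x y x₁ y₁} → x ≡ 0 → y ≡ dist B u v → x₁ ≡ suc (dist B p u) → y₁ ≡ suc (dist B p v) →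
           x ℕ.+ y ℕ.≤ x₁ ℕ.+ y₁
    both refl refl refl refl = ℕ.m≤n⇒m≤1+n (ℕ.≤-trans (triangle B u p v)
      (ℕ.+-mono-≤ (ℕ.≤-reflexive (dist-sym B u p)) (ℕ.n≤1+n _)))
    go : (dist B₀ a b ℕ.+ dist B₀ u v ℕ.≤ dist B₀ a u ℕ.+ dist B₀ b v) ⊎
         (dist B₀ a b ℕ.+ dist B₀ u v ℕ.≤ dist B₀ a v ℕ.+ dist B₀ b u)
    go = case ((a ≟ z) , (b ≟ z)) of λ where
      (yes refl , yes refl) → inj₁ (both (dist-diag B₀ z) (dist-old (a≢u ∘ sym) (a≢v ∘ sym))
                                     (dist-new (a≢u ∘ sym)) (dist-new (a≢v ∘ sym)))
      (yes refl , no b≢z) → lift 1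
          (left (dist-new b≢z) (dist-old (a≢u ∘ sym) (a≢v ∘ sym)))
          (left (dist-new (a≢u ∘ sym)) (dist-old b≢z (a≢v ∘ sym)))
          (left (dist-new (a≢v ∘ sym)) (dist-old b≢z (a≢u ∘ sym)))
          (fourPoint B p b u v)
      (no a≢z , yes refl) → lift 1
          (left (dist-new′ a≢z) (dist-old (b≢u ∘ sym) (b≢v ∘ sym)))
          (right (dist-old a≢z (b≢u ∘ sym)) (dist-new (b≢v ∘ sym)))
          (right (dist-old a≢z (b≢v ∘ sym)) (dist-new (b≢u ∘ sym)))
          (fourPoint B a p u v)
      (no a≢z , no b≢z) → case ((u ≟ z) , (v ≟ z)) of λ where
        (yes refl , yes refl) → inj₁ (subst₂ ℕ._≤_
            (sym (trans (cong₂ ℕ._+_ (dist-old a≢z b≢z) (dist-diag B₀ z)) (ℕ.+-identityʳ _)))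
            (sym (trans (left (dist-new′ a≢z) refl) (cong (λ y → 1 ℕ.+ (dist B a p ℕ.+ y)) (trans (dist-new′ b≢z) (cong suc (dist-sym B b p))))))
            (ℕ.m≤n⇒m≤1+n (ℕ.≤-trans (triangle B a p b) (ℕ.+-monoʳ-≤ (dist B a p) (ℕ.n≤1+n _)))))
        (yes refl , no v≢z) → lift 1
          (right (dist-old a≢z b≢z) (dist-new v≢z))
          (left (dist-new′ a≢z) (dist-old b≢z v≢z))
          (right (dist-old a≢z v≢z) (dist-new′ b≢z))
          (fourPoint B a b p v)
        (no u≢z , yes refl) → lift 1
          (right (dist-old a≢z b≢z) (dist-new′ u≢z))
          (right (dist-old a≢z u≢z) (dist-new′ b≢z))
          (left (dist-new′ a≢z) (dist-old b≢z u≢z))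
          (fourPoint B a b u p)
        (no u≢z , no v≢z) → lift 0
          (cong₂ ℕ._+_ (dist-old a≢z b≢z) (dist-old u≢z v≢z))
          (cong₂ ℕ._+_ (dist-old a≢z u≢z) (dist-old b≢z v≢z))
          (cong₂ ℕ._+_ (dist-old a≢z v≢z) (dist-old b≢z u≢z))
          (fourPoint B a b u v)

  dist-zero : ∀ {S} (B : Built S) {a b} → a ∈ S → b ∈ S → dist B a b ≡ 0 → a ≡ b
  dist-zero (root x) (here refl) (here refl) _ = refl
  dist-zero (grow {S} {z} B z∉S p∈S zp only) = go
    where
    open Step B z∉S p∈S zp only
    go : ∀ {a b} → a ∈ z ∷ S → b ∈ z ∷ S → dist B⁺ a b ≡ 0 → a ≡ b
    go (here refl) (here refl) _ = refl
    go (here refl) (there b∈S) e = contradiction (trans (sym (dist-new (∈⇒≢ b∈S))) e) λ ()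
    go (there a∈S) (here refl) e = contradiction (trans (sym (dist-new′ (∈⇒≢ a∈S))) e) λ ()
    go (there a∈S) (there b∈S) e = dist-zero B a∈S b∈S (trans (sym (dist-old (∈⇒≢ a∈S) (∈⇒≢ b∈S))) e)

  dist-one : ∀ {S} (B : Built S) {a b} → a ∈ S → b ∈ S → dist B a b ≡ 1 → Adj G a b
  dist-one (root x) (here refl) (here refl) ()
  dist-one (grow {S} {z} {p} B z∉S p∈S zp only) = go
    where
    open Step B z∉S p∈S zp only
    new : ∀ {b} → b ∈ S → dist B⁺ z b ≡ 1 → Adj G z b
    new b∈S e = subst (Adj G z)
      (dist-zero B p∈S b∈S (ℕ.suc-injective (trans (sym (dist-new (∈⇒≢ b∈S))) e))) zp
    go : ∀ {a b} → a ∈ z ∷ S → b ∈ z ∷ S → dist B⁺ a b ≡ 1 → Adj G a b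
    go (here refl) (here refl) e = contradiction (trans (sym (dist-diag B⁺ z)) e) λ ()
    go (here refl) (there b∈S) e = new b∈S e
    go (there a∈S) (here refl) e = Adj-sym (new a∈S (trans (dist-sym B⁺ z _) e))
    go (there a∈S) (there b∈S) e = dist-one B a∈S b∈S (trans (sym (dist-old (∈⇒≢ a∈S) (∈⇒≢ b∈S))) e)

  -- The difference is exactly 1, as trees are bipartite. This makes the squares in `r-edge` equal
  -- to 1 and gives the parity behind `Position`.
  dist-adj : ∀ {S} (B : Built S) {a b k} → a ∈ S → b ∈ S → k ∈ S → Adj G a b →
             dist B a k ≡ suc (dist B b k) ⊎ dist B b k ≡ suc (dist B a k)
  dist-adj (root x) (here refl) (here refl) _ ab = contradiction ab ¬Adj-refl
  dist-adj (grow {S} {z} {p} B z∉S p∈S zp only) {a} {b} {k} = go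
    where
    open Step B z∉S p∈S zp only
    new : ∀ {k} → k ∈ z ∷ S → dist B⁺ z k ≡ suc (dist B⁺ p k) ⊎ dist B⁺ p k ≡ suc (dist B⁺ z k)
    new (here refl) = inj₂ (trans (dist-new′ (∈⇒≢ p∈S))
      (cong suc (trans (dist-diag B p) (sym (dist-diag B⁺ z)))))
    new (there k∈S) = inj₁ (trans (dist-new (∈⇒≢ k∈S)) (cong suc (sym (dist-old (∈⇒≢ p∈S) (∈⇒≢ k∈S)))))
    swap : ∀ {P Q : Set} → P ⊎ Q → Q ⊎ P
    swap (inj₁ x) = inj₂ x
    swap (inj₂ y) = inj₁ y
    transport : ∀ {x y x′ y′} → x′ ≡ x → y′ ≡ y → x ≡ suc y ⊎ y ≡ suc x → x′ ≡ suc y′ ⊎ y′ ≡ suc x′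
    transport refl refl h = h
    go : a ∈ z ∷ S → b ∈ z ∷ S → k ∈ z ∷ S → Adj G a b →
         dist B⁺ a k ≡ suc (dist B⁺ b k) ⊎ dist B⁺ b k ≡ suc (dist B⁺ a k)
    go (here refl) (here refl) _ ab = contradiction ab ¬Adj-refl
    go (here refl) (there b∈S) k∈ ab with only b∈S ab
    ... | refl = new k∈
    go (there a∈S) (here refl) k∈ ab with only a∈S (Adj-sym ab)
    ... | refl = swap (new k∈)
    go (there a∈S) (there b∈S) (here refl) ab =
      transport (dist-new′ (∈⇒≢ a∈S)) (dist-new′ (∈⇒≢ b∈S))
        (map-suc (dist-adj B a∈S b∈S p∈S ab))
      where
      map-suc : ∀ {x y} → x ≡ suc y ⊎ y ≡ suc x → suc x ≡ suc (suc y) ⊎ suc y ≡ suc (suc x)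
      map-suc (inj₁ e) = inj₁ (cong suc e)
      map-suc (inj₂ e) = inj₂ (cong suc e)
    go (there a∈S) (there b∈S) (there k∈S) ab =
      transport (dist-old (∈⇒≢ a∈S) (∈⇒≢ k∈S)) (dist-old (∈⇒≢ b∈S) (∈⇒≢ k∈S)) (dist-adj B a∈S b∈S k∈S ab)

  lapOn : List (Fin n) → (Fin n → ℚ) → Fin n → ℚ
  lapOn S f a = lsum S λ b → A a b * (f a - f b)

  -- Of the neighbours of a vertex a other than k, one is nearer to k and all others are farther, so
  -- the differences sum to 1 - (deg a - 1). For a = k all neighbours are farther, which gives - deg
  -- a. The induction follows what a new leaf adds to these sums.
  dist-lap : ∀ {S} (B : Built S) {a k} → a ∈ S → k ∈ S →
             lapOn S (λ b → fromℕ (dist B b k)) a ≡ fromℕ 2 - lsum S (A a) - fromℕ 2 * δ a k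
  dist-lap (root x) (here refl) (here refl) = begin
    A x x * (0ℚ - 0ℚ) + 0ℚ               ≡⟨ cong (λ y → y * (0ℚ - 0ℚ) + 0ℚ) (A-¬adj ¬Adj-refl) ⟩
    0ℚ                                   ≡⟨⟩
    fromℕ 2 - (0ℚ + 0ℚ) - fromℕ 2 * 1ℚ   ≡⟨ cong₂ (λ y e → fromℕ 2 - (y + 0ℚ) - fromℕ 2 * e)
                                               (sym (A-¬adj ¬Adj-refl)) (sym (δ-refl x)) ⟩
    fromℕ 2 - (A x x + 0ℚ) - fromℕ 2 * δ x x ∎
    where open ≡-Reasoning
  dist-lap (grow {S} {z} {p} B z∉S p∈S zp only) {a} {k} = go
    where
    open ≡-Reasoning
    open Step B z∉S p∈S zp only
    uniq = unique B
    Δ⁺ = λ k b → fromℕ (dist B⁺ b k)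
    deg-z : lsum S (A z) ≡ 1ℚ
    deg-z = trans (lsum-cong S λ {b} b∈S → trans (A-new b∈S) (sym (ℚ.*-identityʳ (δ b p)))) (lsum-δ uniq p∈S (λ _ → 1ℚ))
    Azz : A z z ≡ 0ℚ
    Azz = A-¬adj ¬Adj-refl
    at-new : ∀ k → lapOn (z ∷ S) (Δ⁺ k) z ≡ Δ⁺ k z - Δ⁺ k p
    at-new k = begin
      A z z * (Δ⁺ k z - Δ⁺ k z) + lsum S (λ b → A z b * (Δ⁺ k z - Δ⁺ k b))
        ≡⟨ cong₂ _+_ (trans (cong (_* (Δ⁺ k z - Δ⁺ k z)) Azz) (ℚ.*-zeroˡ (Δ⁺ k z - Δ⁺ k z)))
             (trans (lsum-cong S λ {b} b∈S → cong (_* (Δ⁺ k z - Δ⁺ k b)) (A-new b∈S)) (lsum-δ uniq p∈S (λ b → Δ⁺ k z - Δ⁺ k b))) ⟩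
      0ℚ + (Δ⁺ k z - Δ⁺ k p)
        ≡⟨ ℚ.+-identityˡ (Δ⁺ k z - Δ⁺ k p) ⟩
      Δ⁺ k z - Δ⁺ k p ∎
    suc-diff : ∀ x → fromℕ (suc x) - fromℕ x ≡ 1ℚ
    suc-diff x = trans (cong (_- fromℕ x) (fromℕ-suc x)) (cancel (fromℕ x))
      where
      cancel = solve 1 (λ x → con 1ℚ :+ x :- x := con 1ℚ) refl
    diff-suc : ∀ x → fromℕ x - fromℕ (suc x) ≡ - 1ℚ
    diff-suc x = trans (cong (_-_ (fromℕ x)) (fromℕ-suc x)) (cancel (fromℕ x))
      where
      cancel = solve 1 (λ x → x :- (con 1ℚ :+ x) := :- con 1ℚ) refl
    suc-suc : ∀ x y → fromℕ (suc x) - fromℕ (suc y) ≡ fromℕ x - fromℕ y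
    suc-suc x y = trans (cong₂ _-_ (fromℕ-suc x) (fromℕ-suc y)) (cancel (fromℕ x) (fromℕ y))
      where
      cancel = solve 2 (λ x y → con 1ℚ :+ x :- (con 1ℚ :+ y) := x :- y) refl
    δ-weight : ∀ a (f : Fin n → ℚ) → δ a p * f a ≡ δ a p * f p
    δ-weight a f with a ≟ p
    ... | yes refl = refl
    ... | no _     = trans (ℚ.*-zeroˡ (f a)) (sym (ℚ.*-zeroˡ (f p)))
    go : a ∈ z ∷ S → k ∈ z ∷ S →
         lapOn (z ∷ S) (λ b → fromℕ (dist B⁺ b k)) a ≡ fromℕ 2 - lsum (z ∷ S) (A a) - fromℕ 2 * δ a k
    go (here refl) (here refl) = begin
      lapOn (z ∷ S) (Δ⁺ z) z               ≡⟨ at-new z ⟩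
      Δ⁺ z z - Δ⁺ z p                      ≡⟨ cong₂ (λ x y → fromℕ x - fromℕ y) (dist-diag B⁺ z)
                                                (trans (dist-new′ (∈⇒≢ p∈S)) (cong suc (dist-diag B p))) ⟩
      fromℕ 2 - (0ℚ + 1ℚ) - fromℕ 2 * 1ℚ   ≡⟨ cong₂ (λ x e → fromℕ 2 - x - fromℕ 2 * e)
                                                (cong₂ _+_ (sym Azz) (sym deg-z)) (sym (δ-refl z)) ⟩
      fromℕ 2 - lsum (z ∷ S) (A z) - fromℕ 2 * δ z z ∎
    go (here refl) (there k∈S) = begin
      lapOn (z ∷ S) (Δ⁺ k) z               ≡⟨ at-new k ⟩
      Δ⁺ k z - Δ⁺ k p                      ≡⟨ cong₂ (λ x y → fromℕ x - fromℕ y) (dist-new (∈⇒≢ k∈S)) (dist-old (∈⇒≢ p∈S) (∈⇒≢ k∈S)) ⟩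
      fromℕ (suc (dist B p k)) - fromℕ (dist B p k) ≡⟨ suc-diff (dist B p k) ⟩
      fromℕ 2 - (0ℚ + 1ℚ) - fromℕ 2 * 0ℚ   ≡⟨ cong₂ (λ x e → fromℕ 2 - x - fromℕ 2 * e)
                                                (cong₂ _+_ (sym Azz) (sym deg-z)) (sym (δ-≢ (∈⇒≢ k∈S ∘ sym))) ⟩
      fromℕ 2 - lsum (z ∷ S) (A z) - fromℕ 2 * δ z k ∎
    go (there a∈S) (here refl) = begin
      A a z * (Δ⁺ z a - Δ⁺ z z) + lapOn S (Δ⁺ z) a
        ≡⟨ cong₂ _+_
             (trans (cong₂ (λ e x → e * (x - fromℕ (dist B⁺ z z))) (A-new′ a∈S) (cong fromℕ (dist-new′ (∈⇒≢ a∈S))))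
               (trans (δ-weight a λ a → fromℕ (suc (dist B a p)) - fromℕ (dist B⁺ z z))
                 (cong₂ (λ x y → δ a p * (fromℕ (suc x) - fromℕ y)) (dist-diag B p) (dist-diag B⁺ z))))
             (trans (lsum-cong S λ {b} b∈S → cong (A a b *_) (trans
                (cong₂ (λ x y → fromℕ x - fromℕ y) (dist-new′ (∈⇒≢ a∈S)) (dist-new′ (∈⇒≢ b∈S)))
                (suc-suc (dist B a p) (dist B b p))))
               (dist-lap B a∈S p∈S)) ⟩
      δ a p * (1ℚ - 0ℚ) + (fromℕ 2 - lsum S (A a) - fromℕ 2 * δ a p)
        ≡⟨ arrange (δ a p) (lsum S (A a)) ⟩
      fromℕ 2 - (δ a p + lsum S (A a)) - fromℕ 2 * 0ℚ
        ≡⟨ cong₂ (λ x e → fromℕ 2 - (x + lsum S (A a)) - fromℕ 2 * e) (sym (A-new′ a∈S)) (sym (δ-≢ (∈⇒≢ a∈S))) ⟩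
      fromℕ 2 - lsum (z ∷ S) (A a) - fromℕ 2 * δ a z ∎
      where
      arrange = solve 2 (λ e s → e :* (con 1ℚ :- con 0ℚ) :+ (# 2 :- s :- # 2 :* e) := # 2 :- (e :+ s) :- # 2 :* con 0ℚ) refl
    go (there a∈S) (there k∈S) = begin
      A a z * (Δ⁺ k a - Δ⁺ k z) + lapOn S (Δ⁺ k) a
        ≡⟨ cong₂ _+_
             (trans (cong₂ (λ e x → e * x) (A-new′ a∈S)
                 (cong₂ (λ x y → fromℕ x - fromℕ y) (dist-old (∈⇒≢ a∈S) (∈⇒≢ k∈S)) (dist-new (∈⇒≢ k∈S))))
               (trans (δ-weight a λ a → fromℕ (dist B a k) - fromℕ (suc (dist B p k)))
                 (cong (δ a p *_) (diff-suc (dist B p k)))))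
             (trans (lsum-cong S λ {b} b∈S → cong (A a b *_)
                (cong₂ (λ x y → fromℕ x - fromℕ y) (dist-old (∈⇒≢ a∈S) (∈⇒≢ k∈S)) (dist-old (∈⇒≢ b∈S) (∈⇒≢ k∈S))))
               (dist-lap B a∈S k∈S)) ⟩
      δ a p * - 1ℚ + (fromℕ 2 - lsum S (A a) - fromℕ 2 * δ a k)
        ≡⟨ arrange (δ a p) (lsum S (A a)) (δ a k) ⟩
      fromℕ 2 - (δ a p + lsum S (A a)) - fromℕ 2 * δ a k
        ≡⟨ cong (λ x → fromℕ 2 - (x + lsum S (A a)) - fromℕ 2 * δ a k) (sym (A-new′ a∈S)) ⟩
      fromℕ 2 - lsum (z ∷ S) (A a) - fromℕ 2 * δ a k ∎
      where
      arrange = solve 3 (λ e s f → e :* :- con 1ℚ :+ (# 2 :- s :- # 2 :* f) := # 2 :- (e :+ s) :- # 2 :* f) refl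

-- Acyclic connected graphs and leaf-by-leaf construction

last-linked : ∀ {n} (G : Graph n) {e} x xs → Linked (Adj G) (x ∷ xs ++ e ∷ []) → ∃ λ l → l ∈ x ∷ xs × Adj G l e
last-linked G x []       (xe ∷ _) = x , here refl , xe
last-linked G x (y ∷ ys) (_ ∷ ls) with last-linked G y ys ls
... | l , l∈ , le = l , there l∈ , le

-- The second alternative is the case where z is the last vertex before the endpoint e.
inner-neighbours : ∀ {n} (G : Graph n) {e z} w ys → Linked (Adj G) (w ∷ ys ++ e ∷ []) → Unique (w ∷ ys) → z ∈ ys →
  ∃₂ λ a b → Adj G a z × Adj G z b × a ∈ w ∷ ys ×
    ((b ∈ ys × a ≢ b) ⊎ (b ≡ e × (a ∈ ys ⊎ ys ≡ z ∷ [])))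
inner-neighbours G w (y ∷ [])      (wy ∷ ye ∷ _)  _ (here refl) =
  w , _ , wy , ye , here refl , inj₂ (refl , inj₂ refl)
inner-neighbours G w (y ∷ y′ ∷ ys) (wy ∷ yy′ ∷ _) (w∉ ∷ _) (here refl) =
  w , y′ , wy , yy′ , here refl , inj₁ (there (here refl) , λ { refl → All¬⇒¬Any w∉ (there (here refl)) })
inner-neighbours G w (y ∷ ys)      (_ ∷ ls)       (_ ∷ uniq) (there z∈) with inner-neighbours G y ys ls uniq z∈
... | a , b , az , zb , a∈ , inj₁ (b∈ , a≢b) = a , b , az , zb , there a∈ , inj₁ (there b∈ , a≢b)
... | a , b , az , zb , a∈ , inj₂ (b≡e , _)  = a , b , az , zb , there a∈ , inj₂ (b≡e , inj₁ a∈)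

cycle-neighbours : ∀ {n} (G : Graph n) {x xs z} → IsCycle G x xs → z ∈ x ∷ xs →
  ∃₂ λ a b → a ∈ x ∷ xs × b ∈ x ∷ xs × a ≢ b × Adj G z a × Adj G z b
cycle-neighbours G {xs = _ ∷ []} (s≤s () , _) (here refl)
cycle-neighbours G {x} {y ∷ y′ ∷ ys} (_ , _ ∷ (y∉ ∷ _) , xy ∷ yy′ ∷ ls) (here refl)
  with last-linked G y′ ys ls
... | l , l∈ , lx = y , l , there (here refl) , there (there l∈) ,
      (λ { refl → All¬⇒¬Any y∉ l∈ }) , xy , Growth.Adj-sym G lx
cycle-neighbours G {x} {xs} (2≤ , uniq@(x∉ ∷ _) , ls) (there z∈) with inner-neighbours G x xs ls uniq z∈
... | a , b , az , zb , a∈ , inj₁ (b∈ , a≢b) = a , b , a∈ , there b∈ , a≢b , Growth.Adj-sym G az , zb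
... | a , b , az , zb , a∈ , inj₂ (refl , inj₁ a∈xs) =
      a , b , a∈ , here refl , (λ { refl → All¬⇒¬Any x∉ a∈xs }) , Growth.Adj-sym G az , zb
cycle-neighbours G (s≤s () , _) (there z∈) | a , b , az , zb , a∈ , inj₂ (refl , inj₂ refl)

module _ {n : ℕ} (G : Graph n) where
  open Growth G
  open DecMembership (_≟_ {n}) using (_∈?_)

  built-connected : ∀ {S} → Built S → ∀ {a b} → a ∈ S → b ∈ S → Star (Adj G) a b
  built-connected (root x) (here refl) (here refl) = ε
  built-connected (grow B z∉S p∈S zp only) = λ where
    (here refl) (here refl) → ε
    (here refl) (there b∈S) → zp ◅ built-connected B p∈S b∈S
    (there a∈S) (here refl) → built-connected B a∈S p∈S ◅◅ (Adj-sym zp ◅ ε)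
    (there a∈S) (there b∈S) → built-connected B a∈S b∈S

  -- The vertex of a cycle that was attached last would have two different neighbours on the cycle,
  -- both attached earlier, against the uniqueness in `grow`.
  built-acyclic : ∀ {S} → Built S → ∀ {x xs} → (∀ {q} → q ∈ x ∷ xs → q ∈ S) → ¬ IsCycle G x xs
  built-acyclic (root o) {x} {xs} sub cyc with cycle-neighbours G cyc (here refl)
  ... | a , b , a∈ , b∈ , a≢b , _ with sub a∈ | sub b∈
  ...   | here refl | here refl = a≢b refl
  built-acyclic (grow {S} {z} {p} B z∉S p∈S zp only) {x} {xs} sub cyc with z ∈? (x ∷ xs)
  ... | no z∉ = built-acyclic B old cyc
    where
    old : ∀ {q} → q ∈ x ∷ xs → q ∈ S
    old q∈ with sub q∈
    ... | here refl = contradiction q∈ z∉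
    ... | there q∈S = q∈S
  ... | yes z∈ with cycle-neighbours G cyc z∈
  ...   | a , b , a∈ , b∈ , a≢b , za , zb with sub a∈ | sub b∈
  ...     | here refl | _         = ¬Adj-refl za
  ...     | _         | here refl = ¬Adj-refl zb
  ...     | there a∈S | there b∈S = a≢b (trans (only a∈S za) (sym (only b∈S zb)))

  built-isTree : ∀ {S} → Fin n → Built S → (∀ i → i ∈ S) → IsTree G
  built-isTree o B all = (o , λ i j → built-connected B (all i) (all j)) , λ x xs → built-acyclic B (λ {q} _ → all q)

  -- The list holds the vertices after the start, so that prefixing a common neighbour of both ends
  -- produces the arguments of `IsCycle`.
  data Path : Fin n → Fin n → List (Fin n) → Set where
    stop : ∀ {x} → Path x x []
    step : ∀ {x w y ys} → Adj G x w → x ∉ w ∷ ys → Path w y ys → Path x y (w ∷ ys)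

  path-unique : ∀ {x y ys} → Path x y ys → Unique (x ∷ ys)
  path-unique stop            = [] ∷ []
  path-unique (step xw x∉ π) = ¬Any⇒All¬ _ x∉ ∷ path-unique π

  path-linked : ∀ {x y ys z} → Path x y ys → Adj G y z → Linked (Adj G) (x ∷ ys ++ z ∷ [])
  path-linked stop          yz = yz ∷ [-]
  path-linked (step xw _ π) yz = xw ∷ path-linked π yz

  path-snoc : ∀ {x y ys z} → Path x y ys → Adj G y z → z ∉ x ∷ ys → Path x z (ys ++ z ∷ [])
  path-snoc stop yz z∉ = step yz (λ { (here refl) → z∉ (here refl) ; (there ()) }) stop
  path-snoc {ys = w ∷ ys} (step xw x∉ π) yz z∉ = step xw (avoid x∉ (z∉ ∘ here ∘ sym)) (path-snoc π yz (z∉ ∘ there))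
    where
    avoid : ∀ {x z} {ys : List (Fin n)} → x ∉ ys → x ≢ z → x ∉ ys ++ z ∷ []
    avoid {ys = []}     x∉ x≢z (here x≡z)  = x≢z x≡z
    avoid {ys = _ ∷ ys} x∉ x≢z (here x≡y)  = x∉ (here x≡y)
    avoid {ys = _ ∷ ys} x∉ x≢z (there x∈) = avoid (x∉ ∘ there) x≢z x∈

  path-in : ∀ {S} → Built S → ∀ {a b} → a ∈ S → b ∈ S →
            ∃ λ ys → Path a b ys × (∀ {q} → q ∈ a ∷ ys → q ∈ S)
  path-in (root x) (here refl) (here refl) = [] , stop , id
  path-in (grow {S} {z} B z∉S p∈S zp only) (here refl) (here refl) =
    [] , stop , λ { (here refl) → here refl ; (there ()) }
  path-in (grow {S} {z} B z∉S p∈S zp only) (here refl) (there b∈S) with path-in B p∈S b∈S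
  ... | ys , π , sub = _ , step zp (z∉S ∘ sub) π , λ { (here refl) → here refl ; (there q∈) → there (sub q∈) }
  path-in (grow {S} {z} B z∉S p∈S zp only) (there a∈S) (here refl) with path-in B a∈S p∈S
  ... | ys , π , sub = _ , path-snoc π (Adj-sym zp) (z∉S ∘ sub) , into sub
    where
    into : ∀ {ys : List (Fin n)} → (∀ {q} → q ∈ ys → q ∈ S) → ∀ {q} → q ∈ ys ++ z ∷ [] → q ∈ z ∷ S
    into {[]}     sub (here refl) = here refl
    into {_ ∷ ys} sub (here refl) = there (sub (here refl))
    into {_ ∷ ys} sub (there q∈)  = into (sub ∘ there) q∈
  path-in (grow {S} {z} B z∉S p∈S zp only) (there a∈S) (there b∈S) with path-in B a∈S b∈S
  ... | ys , π , sub = ys , π , there ∘ sub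

  crossing : ∀ (S : List (Fin n)) {a b} → a ∈ S → b ∉ S → Star (Adj G) a b →
             ∃₂ λ p z → p ∈ S × z ∉ S × Adj G p z
  crossing S a∈S b∉S ε = contradiction a∈S b∉S
  crossing S {a} a∈S b∉S (_◅_ {j = c} ac rest) with c ∈? S
  ... | yes c∈S = crossing S c∈S b∉S rest
  ... | no  c∉S = a , c , a∈S , c∉S , ac

  -- Two neighbours of z inside a connected set would close a cycle through z.
  unique-neighbour : Acyclic G → ∀ {S z p q} → Built S → z ∉ S → p ∈ S → q ∈ S → Adj G z p → Adj G z q → q ≡ p
  unique-neighbour acyc {S} {z} {p} {q} B z∉S p∈S q∈S zp zq with path-in B p∈S q∈S
  ... | []     , stop , _ = refl
  ... | y ∷ ys , π , sub  = contradiction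
    (s≤s (s≤s z≤n) , ¬Any⇒All¬ _ (z∉S ∘ sub) ∷ path-unique π , zp ∷ path-linked π (Adj-sym zq))
    (acyc z (p ∷ y ∷ ys))

  -- The number `k` is fuel: every round adds a vertex, and a list without repetition has at most n
  -- entries. Connectedness provides an edge leaving `S`, acyclicity makes its outer end a leaf.
  extend : IsTree G → ∀ k {S o} → o ∈ S → Built S → n ℕ.< k ℕ.+ length S → ∃ λ S′ → Built S′ × (∀ i → i ∈ S′)
  extend tree zero    o∈S B n< = contradiction (unique⇒length≤ (unique B)) (ℕ.<⇒≱ n<)
  extend tree@((_ , star) , acyc) (suc k) {S} {o} o∈S B n< with Fin.all? (λ i → i ∈? S)
  ... | yes all = S , B , all
  ... | no ¬all with Fin.¬∀⟶∃¬ n (_∈ S) (_∈? S) ¬all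
  ...   | i , i∉S with crossing S o∈S i∉S (star o i)
  ...     | p , z , p∈S , z∉S , pz = extend tree k (there o∈S)
              (grow B z∉S p∈S (Adj-sym pz) (λ q∈S zq → unique-neighbour acyc B z∉S p∈S q∈S (Adj-sym pz) zq))
              (subst (n ℕ.<_) (sym (ℕ.+-suc k (length S))) n<)

  isTree-built : IsTree G → ∃ λ S → Built S × (∀ i → i ∈ S)
  isTree-built tree@((o , _) , _) = extend tree n {o ∷ []} (here refl) (root o)
    (subst (n ℕ.<_) (sym (ℕ.+-comm n 1)) ℕ.≤-refl)

-- Convex costs of positions on a path

-- The variance identity. It reduces double sums of squared differences to the moments of `f` under
-- `w`.
weighted-spread : ∀ {n} (w f : Fin n → ℚ) →
  sum (λ a → sum λ b → w a * w b * ((f a - f b) * (f a - f b))) ≡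
  fromℕ 2 * (sum w * sum (λ a → w a * (f a * f a)) - sum (λ a → w a * f a) * sum (λ a → w a * f a))
weighted-spread {n} w f = begin
  sum (λ a → sum λ b → w a * w b * ((f a - f b) * (f a - f b)))
    ≡⟨ sum-cong-≗ row ⟩
  sum (λ a → w a * (f a * f a) * w₀ + w a * w₂ - fromℕ 2 * (w a * f a * w₁))
    ≡⟨ sum-minus {n} (λ a → w a * (f a * f a) * w₀ + w a * w₂) (λ a → fromℕ 2 * (w a * f a * w₁)) ⟩
  sum (λ a → w a * (f a * f a) * w₀ + w a * w₂) - sum (λ a → fromℕ 2 * (w a * f a * w₁))
    ≡⟨ cong₂ _-_ (trans (∑-distrib-+ {n} (λ a → w a * (f a * f a) * w₀) (λ a → w a * w₂))
                   (cong₂ _+_ (sum-*ʳ w₀ (λ a → w a * (f a * f a))) (sum-*ʳ w₂ w)))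
                 (trans (sum-*ˡ (fromℕ 2) (λ a → w a * f a * w₁)) (cong (fromℕ 2 *_) (sum-*ʳ w₁ (λ a → w a * f a)))) ⟩
  w₂ * w₀ + w₀ * w₂ - fromℕ 2 * (w₁ * w₁)
    ≡⟨ arrange w₀ w₁ w₂ ⟩
  fromℕ 2 * (w₀ * w₂ - w₁ * w₁) ∎
  where
  open ≡-Reasoning
  w₀ = sum w
  w₁ = sum λ a → w a * f a
  w₂ = sum λ a → w a * (f a * f a)
  arrange = solve 3 (λ w₀ w₁ w₂ → w₂ :* w₀ :+ w₀ :* w₂ :- # 2 :* (w₁ :* w₁) := # 2 :* (w₀ :* w₂ :- w₁ :* w₁)) refl
  expand = solve 4 (λ u v x y →
    u :* v :* ((x :- y) :* (x :- y)) :=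
    u :* (x :* x) :* v :+ u :* (v :* (y :* y)) :- # 2 :* (u :* x :* (v :* y))) refl
  row : ∀ a → sum (λ b → w a * w b * ((f a - f b) * (f a - f b))) ≡
              w a * (f a * f a) * w₀ + w a * w₂ - fromℕ 2 * (w a * f a * w₁)
  row a = begin
    sum (λ b → w a * w b * ((f a - f b) * (f a - f b)))
      ≡⟨ sum-cong-≗ (λ b → expand (w a) (w b) (f a) (f b)) ⟩
    sum (λ b → w a * (f a * f a) * w b + w a * (w b * (f b * f b)) - fromℕ 2 * (w a * f a * (w b * f b)))
      ≡⟨ sum-minus {n} (λ b → w a * (f a * f a) * w b + w a * (w b * (f b * f b))) (λ b → fromℕ 2 * (w a * f a * (w b * f b))) ⟩
    sum (λ b → w a * (f a * f a) * w b + w a * (w b * (f b * f b))) - sum (λ b → fromℕ 2 * (w a * f a * (w b * f b)))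
      ≡⟨ cong₂ _-_ (trans (∑-distrib-+ {n} (λ b → w a * (f a * f a) * w b) (λ b → w a * (w b * (f b * f b))))
                     (cong₂ _+_ (sum-*ˡ (w a * (f a * f a)) w) (sum-*ˡ (w a) (λ b → w b * (f b * f b)))))
                   (trans (sum-*ˡ (fromℕ 2) (λ b → w a * f a * (w b * f b)))
                     (cong (fromℕ 2 *_) (sum-*ˡ (w a * f a) (λ b → w b * f b)))) ⟩
    w a * (f a * f a) * w₀ + w a * w₂ - fromℕ 2 * (w a * f a * w₁) ∎

gap : ℕ → ℕ → ℚ
gap i j = fromℕ ℕ.∣ i - j ∣

fromℕ-∸ : ∀ {i j} → i ℕ.≤ j → fromℕ (j ℕ.∸ i) ≡ fromℕ j - fromℕ i
fromℕ-∸ {i} {j} i≤j = trans (move (fromℕ (j ℕ.∸ i)) (fromℕ i))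
  (cong (_- fromℕ i) (trans (sym (fromℕ-+ (j ℕ.∸ i) i)) (cong fromℕ (ℕ.m∸n+n≡m i≤j))))
  where
  move = solve 2 (λ x y → x := x :+ y :- y) refl

gap-cases : ∀ i j → gap i j ≡ fromℕ i - fromℕ j ⊎ gap i j ≡ fromℕ j - fromℕ i
gap-cases i j = go (ℕ.≤-total i j)
  where
  go : i ℕ.≤ j ⊎ j ℕ.≤ i → gap i j ≡ fromℕ i - fromℕ j ⊎ gap i j ≡ fromℕ j - fromℕ i
  go (inj₁ i≤j) = inj₂ (trans (cong fromℕ (ℕ.m≤n⇒∣m-n∣≡n∸m i≤j)) (fromℕ-∸ i≤j))
  go (inj₂ j≤i) = inj₁ (trans (cong fromℕ (ℕ.m≤n⇒∣n-m∣≡n∸m j≤i)) (fromℕ-∸ j≤i))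

gap-square : ∀ i j → gap i j * gap i j ≡ (fromℕ i - fromℕ j) * (fromℕ i - fromℕ j)
gap-square i j = go (gap-cases i j)
  where
  flip = solve 2 (λ x y → (y :- x) :* (y :- x) := (x :- y) :* (x :- y)) refl
  go : gap i j ≡ fromℕ i - fromℕ j ⊎ gap i j ≡ fromℕ j - fromℕ i → gap i j * gap i j ≡ (fromℕ i - fromℕ j) * (fromℕ i - fromℕ j)
  go (inj₁ e) = cong₂ _*_ e e
  go (inj₂ e) = trans (cong₂ _*_ e e) (flip (fromℕ i) (fromℕ j))

0≤gap : ∀ i j → 0ℚ ≤ gap i j
0≤gap i j = 0≤fromℕ ℕ.∣ i - j ∣

gap-sym : ∀ i j → gap i j ≡ gap j i
gap-sym i j = cong fromℕ (ℕ.∣-∣-comm i j)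

gap≤ : ∀ {i j ℓ} → i ℕ.≤ ℓ → j ℕ.≤ ℓ → gap i j ≤ fromℕ ℓ
gap≤ {i} {j} {ℓ} i≤ j≤ = fromℕ-mono-≤ {ℕ.∣ i - j ∣} {ℓ}
  (ℕ.≤-trans (ℕ.∣m-n∣≤m⊔n i j) (ℕ.⊔-lub i≤ j≤))

-- The indicator of i ≤ t, by a recursion along which `gap-levels` computes.
χ : ℕ → ℕ → ℚ
χ t       zero    = 1ℚ
χ zero    (suc i) = 0ℚ
χ (suc t) (suc i) = χ t i

χ-idem : ∀ t i → χ t i * χ t i ≡ χ t i
χ-idem t       zero    = refl
χ-idem zero    (suc i) = refl
χ-idem (suc t) (suc i) = χ-idem t i

-- The cut decomposition of the line: |i - j| counts the thresholds t that separate i from j.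
-- Written with squares, each level falls under `weighted-spread`.
gap-levels : ∀ ℓ {i j} → i ℕ.≤ ℓ → j ℕ.≤ ℓ →
             gap i j ≡ sum {ℓ} λ t → (χ (toℕ t) i - χ (toℕ t) j) * (χ (toℕ t) i - χ (toℕ t) j)
gap-levels zero    z≤n z≤n = refl
gap-levels (suc ℓ) {zero} {zero} z≤n z≤n = sym (sum-zero {suc ℓ} {λ t → (1ℚ - 1ℚ) * (1ℚ - 1ℚ)} λ t → refl)
gap-levels (suc ℓ) {zero} {suc j} z≤n (s≤s j≤) =
  trans (fromℕ-suc j) (cong (_+_ 1ℚ) (gap-levels ℓ {zero} {j} z≤n j≤))
gap-levels (suc ℓ) {suc i} {zero} (s≤s i≤) z≤n =
  trans (fromℕ-suc i) (cong (_+_ 1ℚ) (trans (cong fromℕ (sym (ℕ.∣-∣-identityʳ i))) (gap-levels ℓ {i} {zero} i≤ z≤n)))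
gap-levels (suc ℓ) {suc i} {suc j} (s≤s i≤) (s≤s j≤) =
  trans (gap-levels ℓ {i} {j} i≤ j≤) (sym (ℚ.+-identityˡ _))

-- Weights are rational but have to remember integrality, which improves the bound X²/4 for odd X in
-- `quarter-bound`.
Integral : ℚ → Set
Integral x = ∃ λ z → x ≡ fromℤ z

integral-sum : ∀ {n} {f : Fin n → ℚ} → (∀ i → Integral (f i)) → Integral (sum f)
integral-sum {zero}  h = + 0 , refl
integral-sum {suc n} h with h zero | integral-sum {n} (h ∘ suc)
... | x , ex | y , ey = x ℤ.+ y , trans (cong₂ _+_ ex ey) (sym (fromℤ-+ x y))

integral-* : ∀ {x y} → Integral x → Integral y → Integral (x * y)
integral-* (x , ex) (y , ey) = x ℤ.* y , trans (cong₂ _*_ ex ey) (sym (fromℤ-* x y))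

integral-minus : ∀ {x y} → Integral x → Integral y → Integral (x - y)
integral-minus (x , ex) (y , ey) = x ℤ.- y ,
  trans (cong₂ _-_ ex ey) (sym (trans (fromℤ-+ x (ℤ.- y)) (cong (_+_ (fromℤ x)) (fromℤ-neg y))))

integral-χ : ∀ t i → Integral (χ t i)
integral-χ t       zero    = + 1 , refl
integral-χ zero    (suc i) = + 0 , refl
integral-χ (suc t) (suc i) = integral-χ t i

integral-δ : ∀ {n} (i j : Fin n) → Integral (δ i j)
integral-δ i j with i ≟ j
... | yes _ = + 1 , refl
... | no _  = + 0 , refl

sum-constant : ∀ n x → sum {n} (λ _ → x) ≡ fromℕ n * x
sum-constant n x = trans (sum-cong-≗ {n} λ _ → sym (ℚ.*-identityˡ x))
  (trans (sum-*ʳ {n} x (λ _ → 1ℚ)) (cong (_* x) (sum-const n)))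

sum-toℕ : ∀ n → sum {n} (λ i → fromℕ (toℕ i)) ≡ ½ * (fromℕ n * (fromℕ n - 1ℚ))
sum-toℕ zero    = refl
sum-toℕ (suc n) = begin
  0ℚ + sum {n} (λ i → fromℕ (suc (toℕ i)))           ≡⟨ ℚ.+-identityˡ _ ⟩
  sum {n} (λ i → fromℕ (suc (toℕ i)))                ≡⟨ sum-cong-≗ {n} (λ i → fromℕ-suc (toℕ i)) ⟩
  sum {n} (λ i → 1ℚ + fromℕ (toℕ i))                 ≡⟨ ∑-distrib-+ {n} (λ _ → 1ℚ) (fromℕ ∘ toℕ) ⟩
  sum {n} (λ _ → 1ℚ) + sum {n} (fromℕ ∘ toℕ)         ≡⟨ cong₂ _+_ (sum-const n) (sum-toℕ n) ⟩
  fromℕ n + ½ * (fromℕ n * (fromℕ n - 1ℚ))           ≡⟨ arrange (fromℕ n) ⟩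
  ½ * ((1ℚ + fromℕ n) * (1ℚ + fromℕ n - 1ℚ))         ≡⟨ cong (λ x → ½ * (x * (x - 1ℚ))) (sym (fromℕ-suc n)) ⟩
  ½ * (fromℕ (suc n) * (fromℕ (suc n) - 1ℚ))         ∎
  where
  open ≡-Reasoning
  arrange = solve 1 (λ n → n :+ con ½ :* (n :* (n :- con 1ℚ)) := con ½ :* ((con 1ℚ :+ n) :* (con 1ℚ :+ n :- con 1ℚ))) refl

sum-toℕ² : ∀ n → fromℕ 6 * sum {n} (λ i → fromℕ (toℕ i) * fromℕ (toℕ i)) ≡ fromℕ n * (fromℕ n - 1ℚ) * (fromℕ 2 * fromℕ n - 1ℚ)
sum-toℕ² zero    = refl
sum-toℕ² (suc n) = begin
  fromℕ 6 * (0ℚ * 0ℚ + sum {n} (λ i → fromℕ (suc (toℕ i)) * fromℕ (suc (toℕ i))))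
    ≡⟨ cong (λ x → fromℕ 6 * (0ℚ * 0ℚ + x)) (trans (sum-cong-≗ {n} λ i → trans (cong (λ x → x * x) (fromℕ-suc (toℕ i))) (square (fromℕ (toℕ i))))
         (trans (∑-distrib-+ {n} (λ i → 1ℚ + fromℕ 2 * fromℕ (toℕ i)) (λ i → fromℕ (toℕ i) * fromℕ (toℕ i)))
           (cong (_+ S₂) (trans (∑-distrib-+ {n} (λ _ → 1ℚ) (λ i → fromℕ 2 * fromℕ (toℕ i)))
             (cong₂ _+_ (sum-const n) (trans (sum-*ˡ {n} (fromℕ 2) (fromℕ ∘ toℕ)) (cong (fromℕ 2 *_) (sum-toℕ n)))))))) ⟩
  fromℕ 6 * (0ℚ * 0ℚ + (fromℕ n + fromℕ 2 * (½ * (fromℕ n * (fromℕ n - 1ℚ))) + S₂))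
    ≡⟨ pull (fromℕ n) S₂ ⟩
  fromℕ 6 * (fromℕ n * fromℕ n) + fromℕ 6 * S₂
    ≡⟨ cong (_+_ (fromℕ 6 * (fromℕ n * fromℕ n))) (sum-toℕ² n) ⟩
  fromℕ 6 * (fromℕ n * fromℕ n) + fromℕ n * (fromℕ n - 1ℚ) * (fromℕ 2 * fromℕ n - 1ℚ)
    ≡⟨ arrange (fromℕ n) ⟩
  (1ℚ + fromℕ n) * (1ℚ + fromℕ n - 1ℚ) * (fromℕ 2 * (1ℚ + fromℕ n) - 1ℚ)
    ≡⟨ cong (λ x → x * (x - 1ℚ) * (fromℕ 2 * x - 1ℚ)) (sym (fromℕ-suc n)) ⟩
  fromℕ (suc n) * (fromℕ (suc n) - 1ℚ) * (fromℕ 2 * fromℕ (suc n) - 1ℚ) ∎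
  where
  open ≡-Reasoning
  S₂ = sum {n} λ i → fromℕ (toℕ i) * fromℕ (toℕ i)
  square = solve 1 (λ x → (con 1ℚ :+ x) :* (con 1ℚ :+ x) := con 1ℚ :+ # 2 :* x :+ x :* x) refl
  pull = solve 2 (λ n S →
    # 6 :* (con 0ℚ :* con 0ℚ :+ (n :+ # 2 :* (con ½ :* (n :* (n :- con 1ℚ))) :+ S)) :=
    # 6 :* (n :* n) :+ # 6 :* S) refl
  arrange = solve 1 (λ n →
    # 6 :* (n :* n) :+ n :* (n :- con 1ℚ) :* (# 2 :* n :- con 1ℚ) :=
    (con 1ℚ :+ n) :* (con 1ℚ :+ n :- con 1ℚ) :* (# 2 :* (con 1ℚ :+ n) :- con 1ℚ)) refl

sum-gap : ∀ n → fromℕ 3 * sum {n} (λ i → sum {n} λ j → gap (toℕ i) (toℕ j)) ≡ fromℕ n * (fromℕ n * fromℕ n - 1ℚ)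
sum-gap zero    = refl
sum-gap (suc n) = begin
  fromℕ 3 * (0ℚ + up + sum {n} (λ i → gap (suc (toℕ i)) 0 + sum {n} λ j → gap (toℕ i) (toℕ j)))
    ≡⟨ cong (λ x → fromℕ 3 * (0ℚ + up + x)) (∑-distrib-+ {n} (λ i → gap (suc (toℕ i)) 0) (λ i → sum {n} λ j → gap (toℕ i) (toℕ j))) ⟩
  fromℕ 3 * (0ℚ + up + (up + Sg))
    ≡⟨ cong (λ x → fromℕ 3 * (0ℚ + x + (x + Sg))) (trans (sum-cong-≗ {n} λ i → fromℕ-suc (toℕ i))
         (trans (∑-distrib-+ {n} (λ _ → 1ℚ) (fromℕ ∘ toℕ)) (cong₂ _+_ (sum-const n) (sum-toℕ n)))) ⟩
  fromℕ 3 * (0ℚ + (fromℕ n + ½ * (fromℕ n * (fromℕ n - 1ℚ))) + ((fromℕ n + ½ * (fromℕ n * (fromℕ n - 1ℚ))) + Sg))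
    ≡⟨ pull (fromℕ n) Sg ⟩
  fromℕ 3 * (fromℕ n * (fromℕ n + 1ℚ)) + fromℕ 3 * Sg
    ≡⟨ cong (_+_ (fromℕ 3 * (fromℕ n * (fromℕ n + 1ℚ)))) (sum-gap n) ⟩
  fromℕ 3 * (fromℕ n * (fromℕ n + 1ℚ)) + fromℕ n * (fromℕ n * fromℕ n - 1ℚ)
    ≡⟨ arrange (fromℕ n) ⟩
  (1ℚ + fromℕ n) * ((1ℚ + fromℕ n) * (1ℚ + fromℕ n) - 1ℚ)
    ≡⟨ cong (λ x → x * (x * x - 1ℚ)) (sym (fromℕ-suc n)) ⟩
  fromℕ (suc n) * (fromℕ (suc n) * fromℕ (suc n) - 1ℚ) ∎
  where
  open ≡-Reasoning
  up = sum {n} λ i → fromℕ (suc (toℕ i))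
  Sg = sum {n} λ i → sum {n} λ j → gap (toℕ i) (toℕ j)
  pull = solve 2 (λ n S →
    # 3 :* (con 0ℚ :+ (n :+ con ½ :* (n :* (n :- con 1ℚ))) :+ ((n :+ con ½ :* (n :* (n :- con 1ℚ))) :+ S)) :=
    # 3 :* (n :* (n :+ con 1ℚ)) :+ # 3 :* S) refl
  arrange = solve 1 (λ n →
    # 3 :* (n :* (n :+ con 1ℚ)) :+ n :* (n :* n :- con 1ℚ) :=
    (con 1ℚ :+ n) :* ((con 1ℚ :+ n) :* (con 1ℚ :+ n) :- con 1ℚ)) refl

pushforward : ∀ {n c} (pos : Fin n → Fin c) (F : Fin c → ℚ) →
              sum (λ a → F (pos a)) ≡ sum λ i → sum (λ a → δ (pos a) i) * F i
pushforward {n} {c} pos F = begin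
  sum (λ a → F (pos a))
    ≡⟨ sum-cong-≗ (λ a → trans (sym (sum-δ (pos a) F)) (sum-cong-≗ λ i → cong (_* F i) (δ-sym i (pos a)))) ⟩
  sum (λ a → sum λ i → δ (pos a) i * F i)
    ≡⟨ ∑-comm (λ a i → δ (pos a) i * F i) ⟩
  sum (λ i → sum λ a → δ (pos a) i * F i)
    ≡⟨ sum-cong-≗ (λ i → sum-*ʳ (F i) (λ a → δ (pos a) i)) ⟩
  sum (λ i → sum (λ a → δ (pos a) i) * F i) ∎
  where open ≡-Reasoning

pushforward₂ : ∀ {n c} (pos : Fin n → Fin c) (F : Fin c → Fin c → ℚ) → let k = λ i → sum λ a → δ (pos a) i in
  sum (λ a → sum λ b → F (pos a) (pos b)) ≡ sum λ i → sum λ j → k i * k j * F i j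
pushforward₂ {n} {c} pos F = begin
  sum (λ a → sum λ b → F (pos a) (pos b))
    ≡⟨ pushforward pos (λ i → sum λ b → F i (pos b)) ⟩
  sum (λ i → k i * sum (λ b → F i (pos b)))
    ≡⟨ sum-cong-≗ (λ i → trans (cong (k i *_) (pushforward pos (F i))) (trans (sym (sum-*ˡ (k i) (λ j → k j * F i j)))
         (sum-cong-≗ λ j → sym (ℚ.*-assoc (k i) (k j) (F i j))))) ⟩
  sum (λ i → sum λ j → k i * k j * F i j) ∎
  where
  open ≡-Reasoning
  k = λ i → sum λ a → δ (pos a) i

-- The positions 0, …, ℓ carry weights 1 + e i; gap + (m / c) gap² is the convex cost, multiplied by c = ℓ + 1.
module Cost (C ℓ : ℕ) (C≡1+ℓ : C ≡ suc ℓ) (m : ℚ) where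

  L c : ℚ
  L = fromℕ ℓ
  c = 1ℚ + L

  c≡ : fromℕ C ≡ c
  c≡ = trans (cong fromℕ C≡1+ℓ) (fromℕ-suc ℓ)

  cost : Fin C → Fin C → ℚ
  cost i j = c * gap (toℕ i) (toℕ j) + m * (gap (toℕ i) (toℕ j) * gap (toℕ i) (toℕ j))

  cost-sym : ∀ i j → cost i j ≡ cost j i
  cost-sym i j = cong (λ x → c * x + m * (x * x)) (gap-sym (toℕ i) (toℕ j))

  S₁ S₂ : ℚ
  S₁ = sum {C} λ j → fromℕ (toℕ j)
  S₂ = sum {C} λ j → fromℕ (toℕ j) * fromℕ (toℕ j)

  2S₁ : fromℕ 2 * S₁ ≡ c * L
  2S₁ = trans (cong (fromℕ 2 *_) (trans (sum-toℕ C) (cong (λ x → ½ * (x * (x - 1ℚ))) c≡))) (simp L)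
    where
    simp = solve 1 (λ L → # 2 :* (con ½ :* ((con 1ℚ :+ L) :* (con 1ℚ :+ L :- con 1ℚ))) := (con 1ℚ :+ L) :* L) refl

  6S₂ : fromℕ 6 * S₂ ≡ c * L * (fromℕ 2 * L + 1ℚ)
  6S₂ = trans (sum-toℕ² C) (trans (cong (λ x → x * (x - 1ℚ) * (fromℕ 2 * x - 1ℚ)) c≡) (simp L))
    where
    simp = solve 1 (λ L →
      (con 1ℚ :+ L) :* (con 1ℚ :+ L :- con 1ℚ) :* (# 2 :* (con 1ℚ :+ L) :- con 1ℚ) :=
      (con 1ℚ :+ L) :* L :* (# 2 :* L :+ con 1ℚ)) refl

  -- The cost of an end position against all positions, see `row-o` and `row-z`; by `row≤` the
  -- largest row sum.
  endCost : ℚ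
  endCost = c * S₁ + m * S₂

  pathCost : ℚ
  pathCost = sum λ i → sum λ j → cost i j

  -- The unit weights are the vertices of the path itself, `e` those hanging off it. The three terms
  -- are path against path, extra against path in both orders, and extra against extra.
  weights-expand : ∀ (e : Fin C → ℚ) → sum (λ i → sum λ j → (1ℚ + e i) * (1ℚ + e j) * cost i j) ≡
    pathCost + fromℕ 2 * sum (λ i → e i * sum (cost i)) + sum (λ i → sum λ j → e i * e j * cost i j)
  weights-expand e = begin
    sum (λ i → sum λ j → (1ℚ + e i) * (1ℚ + e j) * cost i j)
      ≡⟨ sum-cong-≗ (λ i → trans (sum-cong-≗ λ j → expand (e i) (e j) (cost i j))
           (trans (∑-distrib-+ {C} (λ j → cost i j + e i * cost i j) (λ j → e j * cost i j + e i * e j * cost i j))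
             (cong₂ _+_ (∑-distrib-+ {C} (cost i) (λ j → e i * cost i j))
                        (∑-distrib-+ {C} (λ j → e j * cost i j) (λ j → e i * e j * cost i j))))) ⟩
    sum (λ i → sum (cost i) + sum (λ j → e i * cost i j) + (sum (λ j → e j * cost i j) + sum (λ j → e i * e j * cost i j)))
      ≡⟨ trans (∑-distrib-+ {C} (λ i → sum (cost i) + sum (λ j → e i * cost i j)) (λ i → sum (λ j → e j * cost i j) + sum (λ j → e i * e j * cost i j)))
           (cong₂ _+_ (∑-distrib-+ {C} (λ i → sum (cost i)) (λ i → sum (λ j → e i * cost i j)))
                      (∑-distrib-+ {C} (λ i → sum (λ j → e j * cost i j)) (λ i → sum (λ j → e i * e j * cost i j)))) ⟩
    pathCost + sum (λ i → sum (λ j → e i * cost i j)) + (sum (λ i → sum (λ j → e j * cost i j)) + Q)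
      ≡⟨ cong₂ (λ x y → pathCost + x + (y + Q)) rows (trans (∑-comm (λ i j → e j * cost i j))
           (trans (sum-cong-≗ λ j → sum-cong-≗ λ i → cong (e j *_) (cost-sym i j)) rows)) ⟩
    pathCost + R + (R + Q)
      ≡⟨ arrange pathCost R Q ⟩
    pathCost + fromℕ 2 * R + Q ∎
    where
    open ≡-Reasoning
    R = sum λ i → e i * sum (cost i)
    Q = sum λ i → sum λ j → e i * e j * cost i j
    expand = solve 3 (λ x y g → (con 1ℚ :+ x) :* (con 1ℚ :+ y) :* g := g :+ x :* g :+ (y :* g :+ x :* y :* g)) refl
    arrange = solve 3 (λ p r q → p :+ r :+ (r :+ q) := p :+ # 2 :* r :+ q) refl
    rows : sum (λ i → sum λ j → e i * cost i j) ≡ R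
    rows = sum-cong-≗ λ i → sum-*ˡ (e i) (cost i)

  row-split : ∀ i → sum (cost i) ≡ c * sum {C} (λ j → gap (toℕ i) (toℕ j)) + m * sum {C} (λ j → gap (toℕ i) (toℕ j) * gap (toℕ i) (toℕ j))
  row-split i = trans (∑-distrib-+ {C} (λ j → c * gap (toℕ i) (toℕ j)) (λ j → m * (gap (toℕ i) (toℕ j) * gap (toℕ i) (toℕ j))))
    (cong₂ _+_ (sum-*ˡ {C} c (λ j → gap (toℕ i) (toℕ j))) (sum-*ˡ {C} m (λ j → gap (toℕ i) (toℕ j) * gap (toℕ i) (toℕ j))))

  0≤L : 0ℚ ≤ L
  0≤L = 0≤fromℕ ℓ

  0≤c : 0ℚ ≤ c
  0≤c = 0≤-+ (ℚ.<⇒≤ 0<1) 0≤L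

  6pathCost : fromℕ 6 * pathCost ≡ c * (fromℕ 2 * (c * (c * c - 1ℚ))) + m * (c * c * (c * c - 1ℚ))
  6pathCost = begin
    fromℕ 6 * pathCost
      ≡⟨ cong (fromℕ 6 *_) (trans (sum-cong-≗ {C} {λ i → sum (cost i)} {λ i → c * g₁ i + m * g₂ i} row-split)
           (trans (∑-distrib-+ {C} (λ i → c * g₁ i) (λ i → m * g₂ i)) (cong₂ _+_ (sum-*ˡ {C} c g₁) (sum-*ˡ {C} m g₂)))) ⟩
    fromℕ 6 * (c * sum g₁ + m * sum g₂)
      ≡⟨ cong (λ x → fromℕ 6 * (c * sum g₁ + m * x)) spread ⟩
    fromℕ 6 * (c * sum g₁ + m * (fromℕ 2 * (c * S₂ - S₁ * S₁)))
      ≡⟨ regroup c m (sum g₁) S₂ S₁ ⟩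
    c * (fromℕ 2 * (fromℕ 3 * sum g₁)) + m * (fromℕ 2 * (c * (fromℕ 6 * S₂)) - fromℕ 3 * (fromℕ 2 * S₁ * (fromℕ 2 * S₁)))
      ≡⟨ cong₂ (λ x y → c * (fromℕ 2 * x) + m * (fromℕ 2 * (c * y) - fromℕ 3 * (fromℕ 2 * S₁ * (fromℕ 2 * S₁))))
           (trans (sum-gap C) (cong (λ x → x * (x * x - 1ℚ)) c≡)) 6S₂ ⟩
    c * (fromℕ 2 * (c * (c * c - 1ℚ))) + m * (fromℕ 2 * (c * (c * L * (fromℕ 2 * L + 1ℚ))) - fromℕ 3 * (fromℕ 2 * S₁ * (fromℕ 2 * S₁)))
      ≡⟨ cong (λ x → c * (fromℕ 2 * (c * (c * c - 1ℚ))) + m * (fromℕ 2 * (c * (c * L * (fromℕ 2 * L + 1ℚ))) - fromℕ 3 * (x * x))) 2S₁ ⟩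
    c * (fromℕ 2 * (c * (c * c - 1ℚ))) + m * (fromℕ 2 * (c * (c * L * (fromℕ 2 * L + 1ℚ))) - fromℕ 3 * (c * L * (c * L)))
      ≡⟨ final L m ⟩
    c * (fromℕ 2 * (c * (c * c - 1ℚ))) + m * (c * c * (c * c - 1ℚ)) ∎
    where
    open ≡-Reasoning
    g₁ g₂ : Fin C → ℚ
    g₁ i = sum {C} λ j → gap (toℕ i) (toℕ j)
    g₂ i = sum {C} λ j → gap (toℕ i) (toℕ j) * gap (toℕ i) (toℕ j)
    spread : sum g₂ ≡ fromℕ 2 * (c * S₂ - S₁ * S₁)
    spread = begin
      sum g₂
        ≡⟨ sum-cong-≗ {C} (λ i → sum-cong-≗ {C} λ j → trans (gap-square (toℕ i) (toℕ j)) (one ((fromℕ (toℕ i) - fromℕ (toℕ j)) * (fromℕ (toℕ i) - fromℕ (toℕ j))))) ⟩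
      sum {C} (λ i → sum {C} λ j → 1ℚ * 1ℚ * ((fromℕ (toℕ i) - fromℕ (toℕ j)) * (fromℕ (toℕ i) - fromℕ (toℕ j))))
        ≡⟨ weighted-spread {C} (λ _ → 1ℚ) (λ i → fromℕ (toℕ i)) ⟩
      fromℕ 2 * (sum {C} (λ _ → 1ℚ) * sum {C} (λ i → 1ℚ * (fromℕ (toℕ i) * fromℕ (toℕ i))) - sum {C} (λ i → 1ℚ * fromℕ (toℕ i)) * sum {C} (λ i → 1ℚ * fromℕ (toℕ i)))
        ≡⟨ cong₂ (λ x y → fromℕ 2 * (x - y * y))
             (cong₂ _*_ (trans (sum-const C) c≡) (sum-cong-≗ {C} λ i → ℚ.*-identityˡ (fromℕ (toℕ i) * fromℕ (toℕ i))))
             (sum-cong-≗ {C} λ i → ℚ.*-identityˡ (fromℕ (toℕ i))) ⟩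
      fromℕ 2 * (c * S₂ - S₁ * S₁) ∎
      where
      one = solve 1 (λ x → x := con 1ℚ :* con 1ℚ :* x) refl
    regroup = solve 5 (λ c m g S₂ S₁ →
      # 6 :* (c :* g :+ m :* (# 2 :* (c :* S₂ :- S₁ :* S₁))) :=
      c :* (# 2 :* (# 3 :* g)) :+ m :* (# 2 :* (c :* (# 6 :* S₂)) :- # 3 :* (# 2 :* S₁ :* (# 2 :* S₁)))) refl
    final = solve 2 (λ L m →
      (con 1ℚ :+ L) :* (# 2 :* ((con 1ℚ :+ L) :* ((con 1ℚ :+ L) :* (con 1ℚ :+ L) :- con 1ℚ))) :+ m :* (# 2 :* ((con 1ℚ :+ L) :* ((con 1ℚ :+ L) :* L :* (# 2 :* L :+ con 1ℚ))) :- # 3 :* ((con 1ℚ :+ L) :* L :* ((con 1ℚ :+ L) :* L))) :=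
      (con 1ℚ :+ L) :* (# 2 :* ((con 1ℚ :+ L) :* ((con 1ℚ :+ L) :* (con 1ℚ :+ L) :- con 1ℚ))) :+ m :* ((con 1ℚ :+ L) :* (con 1ℚ :+ L) :* ((con 1ℚ :+ L) :* (con 1ℚ :+ L) :- con 1ℚ))) refl

  toℕ≤ℓ : ∀ (i : Fin C) → toℕ i ℕ.≤ ℓ
  toℕ≤ℓ i = ℕ.≤-pred (subst (suc (toℕ i) ℕ.≤_) C≡1+ℓ (Fin.toℕ<n i))

  sum-const-c : ∀ x → sum {C} (λ _ → x) ≡ c * x
  sum-const-c x = trans (sum-constant C x) (cong (_* x) c≡)

  -- Convexity: L · |i − j| lies below the chord (L − i) j + i (L − j).
  row-gap≤ : ∀ i → sum {C} (λ j → gap (toℕ i) (toℕ j)) ≤ S₁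
  row-gap≤ i = go (L ℚ.≟ 0ℚ)
    where
    open ℚ.≤-Reasoning
    x = fromℕ (toℕ i)
    swap = solve 4 (λ c x L S → c :* (x :* L) :+ (L :- # 2 :* x) :* S := x :* (c :* L) :+ (L :- # 2 :* x) :* S) refl
    collect = solve 3 (λ x L S → x :* (# 2 :* S) :+ (L :- # 2 :* x) :* S := L :* S) refl
    chord : ∀ j → L * gap (toℕ i) (toℕ j) ≤ x * L + (L - fromℕ 2 * x) * fromℕ (toℕ j)
    chord j = below (gap-cases (toℕ i) (toℕ j))
      where
      y : ℚ
      y = fromℕ (toℕ j)
      shape₁ = solve 3 (λ x y L → x :* L :+ (L :- # 2 :* x) :* y :- L :* (x :- y) := # 2 :* (y :* (L :- x))) refl
      shape₂ = solve 3 (λ x y L → x :* L :+ (L :- # 2 :* x) :* y :- L :* (y :- x) := # 2 :* (x :* (L :- y))) refl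
      below : ∀ {g} → g ≡ x - y ⊎ g ≡ y - x → L * g ≤ x * L + (L - fromℕ 2 * x) * y
      below (inj₁ refl) = ≤-via (shape₁ x y L)
        (0≤-* (0≤fromℕ 2) (0≤-* (0≤fromℕ (toℕ j)) (≤⇒0≤ (fromℕ-mono-≤ {toℕ i} {ℓ} (toℕ≤ℓ i)))))
      below (inj₂ refl) = ≤-via (shape₂ x y L)
        (0≤-* (0≤fromℕ 2) (0≤-* (0≤fromℕ (toℕ i)) (≤⇒0≤ (fromℕ-mono-≤ {toℕ j} {ℓ} (toℕ≤ℓ j)))))
    go : Dec (L ≡ 0ℚ) → sum {C} (λ j → gap (toℕ i) (toℕ j)) ≤ S₁
    -- A single position: all gaps vanish, and there is no positive factor to cancel.
    go (yes L≡0) = sum-mono {C} λ j → ℚ.≤-trans (gap≤ {toℕ i} {toℕ j} {ℓ} (toℕ≤ℓ i) (toℕ≤ℓ j))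
      (ℚ.≤-trans (ℚ.≤-reflexive L≡0) (0≤fromℕ (toℕ j)))
    go (no L≢0) = *-cancelˡ-≤ (≤∧≢⇒< 0≤L L≢0) (begin
      L * sum {C} (λ j → gap (toℕ i) (toℕ j))    ≡⟨ sym (sum-*ˡ {C} L (λ j → gap (toℕ i) (toℕ j))) ⟩
      sum {C} (λ j → L * gap (toℕ i) (toℕ j))    ≤⟨ sum-mono {C} chord ⟩
      sum {C} (λ j → x * L + (L - fromℕ 2 * x) * fromℕ (toℕ j))
        ≡⟨ trans (∑-distrib-+ {C} (λ _ → x * L) (λ j → (L - fromℕ 2 * x) * fromℕ (toℕ j)))
             (cong₂ _+_ (sum-const-c (x * L)) (sum-*ˡ {C} (L - fromℕ 2 * x) (λ j → fromℕ (toℕ j)))) ⟩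
      c * (x * L) + (L - fromℕ 2 * x) * S₁       ≡⟨ swap c x L S₁ ⟩
      x * (c * L) + (L - fromℕ 2 * x) * S₁       ≡⟨ cong (λ y → x * y + (L - fromℕ 2 * x) * S₁) (sym 2S₁) ⟩
      x * (fromℕ 2 * S₁) + (L - fromℕ 2 * x) * S₁ ≡⟨ collect x L S₁ ⟩
      L * S₁                                     ∎)

  -- By 2 S₁ = c L the deficit is exactly c x (L - x).
  row-gap²≤ : ∀ i → sum {C} (λ j → gap (toℕ i) (toℕ j) * gap (toℕ i) (toℕ j)) ≤ S₂
  row-gap²≤ i = ≤-via (trans (cong (_-_ S₂) total) (shape x L S₂))
    (0≤-* 0≤c (0≤-* (0≤fromℕ (toℕ i)) (≤⇒0≤ (fromℕ-mono-≤ {toℕ i} {ℓ} (toℕ≤ℓ i)))))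
    where
    open ≡-Reasoning
    x = fromℕ (toℕ i)
    shape = solve 3 (λ x L S₂ →
      S₂ :- ((con 1ℚ :+ L) :* (x :* x) :- x :* ((con 1ℚ :+ L) :* L) :+ S₂) :=
      (con 1ℚ :+ L) :* (x :* (L :- x))) refl
    square = solve 2 (λ x y → (x :- y) :* (x :- y) := x :* x :- # 2 :* x :* y :+ y :* y) refl
    regroup = solve 2 (λ x S → # 2 :* x :* S := x :* (# 2 :* S)) refl
    total : sum {C} (λ j → gap (toℕ i) (toℕ j) * gap (toℕ i) (toℕ j)) ≡ c * (x * x) - x * (c * L) + S₂
    total = begin
      sum {C} (λ j → gap (toℕ i) (toℕ j) * gap (toℕ i) (toℕ j))
        ≡⟨ sum-cong-≗ {C} (λ j → trans (gap-square (toℕ i) (toℕ j)) (square x (fromℕ (toℕ j)))) ⟩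
      sum {C} (λ j → x * x - fromℕ 2 * x * fromℕ (toℕ j) + fromℕ (toℕ j) * fromℕ (toℕ j))
        ≡⟨ ∑-distrib-+ {C} (λ j → x * x - fromℕ 2 * x * fromℕ (toℕ j)) (λ j → fromℕ (toℕ j) * fromℕ (toℕ j)) ⟩
      sum {C} (λ j → x * x - fromℕ 2 * x * fromℕ (toℕ j)) + S₂
        ≡⟨ cong (_+ S₂) (trans (sum-minus {C} (λ _ → x * x) (λ j → fromℕ 2 * x * fromℕ (toℕ j)))
             (cong₂ _-_ (sum-const-c (x * x)) (trans (sum-*ˡ {C} (fromℕ 2 * x) (λ j → fromℕ (toℕ j)))
               (trans (regroup x S₁) (cong (x *_) 2S₁))))) ⟩
      c * (x * x) - x * (c * L) + S₂ ∎

  module _ (0≤m : 0ℚ ≤ m) where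

    row≤ : ∀ i → sum (cost i) ≤ endCost
    row≤ i = ℚ.≤-trans (ℚ.≤-reflexive (row-split i))
      (ℚ.+-mono-≤ (*-monoˡ-≤ 0≤c (row-gap≤ i)) (*-monoˡ-≤ 0≤m (row-gap²≤ i)))

    -- The chord of the square on [0, L]. It is exact for the gaps 0 and L, the only ones between
    -- ends.
    cost≤ : ∀ i j → cost i j ≤ (c + m * L) * gap (toℕ i) (toℕ j)
    cost≤ i j = ≤-via (shape c m L (gap (toℕ i) (toℕ j)))
      (0≤-* 0≤m (0≤-* (0≤gap (toℕ i) (toℕ j)) (≤⇒0≤ (gap≤ {toℕ i} {toℕ j} {ℓ} (toℕ≤ℓ i) (toℕ≤ℓ j)))))
      where
      shape = solve 4 (λ c m L g → (c :+ m :* L) :* g :- (c :* g :+ m :* (g :* g)) := m :* (g :* (L :- g))) refl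

    -- By levels, Σ e i e j |i − j| = 2 Σ_t E (X − E) with E the weight of the positions ≤ t.
    module _ (e : Fin C → ℚ) (0≤e : ∀ i → 0ℚ ≤ e i) (integral : ∀ i → Integral (e i)) (q : ℚ)
             (quarter : ∀ {E} → Integral E → E * (sum e - E) ≤ q) where

      X : ℚ
      X = sum e

      extra-gap≤ : sum (λ i → sum λ j → e i * e j * gap (toℕ i) (toℕ j)) ≤ L * (fromℕ 2 * q)
      extra-gap≤ = begin
        sum (λ i → sum λ j → e i * e j * gap (toℕ i) (toℕ j))
          ≡⟨ sum-cong-≗ (λ i → sum-cong-≗ λ j → trans (cong (e i * e j *_) (gap-levels ℓ (toℕ≤ℓ i) (toℕ≤ℓ j)))
               (sym (sum-*ˡ (e i * e j) (λ t → lev t i j)))) ⟩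
        sum (λ i → sum λ j → sum {ℓ} λ t → e i * e j * lev t i j)
          ≡⟨ sum-cong-≗ (λ i → ∑-comm (λ j t → e i * e j * lev t i j)) ⟩
        sum (λ i → sum {ℓ} λ t → sum λ j → e i * e j * lev t i j)
          ≡⟨ ∑-comm (λ i t → sum λ j → e i * e j * lev t i j) ⟩
        sum {ℓ} (λ t → sum λ i → sum λ j → e i * e j * lev t i j)
          ≤⟨ sum-mono {ℓ} level ⟩
        sum {ℓ} (λ t → fromℕ 2 * q)
          ≡⟨ sum-constant ℓ (fromℕ 2 * q) ⟩
        L * (fromℕ 2 * q) ∎
        where
        open ℚ.≤-Reasoning
        lev : Fin ℓ → Fin C → Fin C → ℚ
        lev t i j = (χ (toℕ t) (toℕ i) - χ (toℕ t) (toℕ j)) * (χ (toℕ t) (toℕ i) - χ (toℕ t) (toℕ j))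
        level : ∀ t → sum (λ i → sum λ j → e i * e j * lev t i j) ≤ fromℕ 2 * q
        level t = begin
          sum (λ i → sum λ j → e i * e j * lev t i j)
            ≡⟨ weighted-spread e (λ i → χ (toℕ t) (toℕ i)) ⟩
          fromℕ 2 * (X * sum (λ i → e i * (χ (toℕ t) (toℕ i) * χ (toℕ t) (toℕ i))) - E * E)
            ≡⟨ cong (λ y → fromℕ 2 * (X * y - E * E)) (sum-cong-≗ λ i → cong (e i *_) (χ-idem (toℕ t) (toℕ i))) ⟩
          fromℕ 2 * (X * E - E * E)
            ≡⟨ cong (fromℕ 2 *_) (factor X E) ⟩
          fromℕ 2 * (E * (X - E))
            ≤⟨ *-monoˡ-≤ (0≤fromℕ 2) (quarter (integral-sum λ i → integral-* (integral i) (integral-χ (toℕ t) (toℕ i)))) ⟩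
          fromℕ 2 * q ∎
          where
          E = sum λ i → e i * χ (toℕ t) (toℕ i)
          factor = solve 2 (λ X E → X :* E :- E :* E := E :* (X :- E)) refl

      -- The extra weight meets the path through `row≤` and itself through `cost≤` and the level
      -- bound. All these bounds are exact for weights at the two ends with product `q`; compare
      -- `ends-cost`.
      weighted-cost≤ : sum (λ i → sum λ j → (1ℚ + e i) * (1ℚ + e j) * cost i j) ≤
                       pathCost + fromℕ 2 * (X * endCost) + (c + m * L) * (L * (fromℕ 2 * q))
      weighted-cost≤ = begin
        sum (λ i → sum λ j → (1ℚ + e i) * (1ℚ + e j) * cost i j)
          ≡⟨ weights-expand e ⟩
        pathCost + fromℕ 2 * sum (λ i → e i * sum (cost i)) + sum (λ i → sum λ j → e i * e j * cost i j)
          ≤⟨ ℚ.+-mono-≤ (ℚ.+-monoʳ-≤ pathCost (*-monoˡ-≤ (0≤fromℕ 2) linear)) quadratic ⟩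
        pathCost + fromℕ 2 * (X * endCost) + (c + m * L) * (L * (fromℕ 2 * q)) ∎
        where
        open ℚ.≤-Reasoning
        linear : sum (λ i → e i * sum (cost i)) ≤ X * endCost
        linear = ℚ.≤-trans (sum-mono λ i → *-monoˡ-≤ (0≤e i) (row≤ i)) (ℚ.≤-reflexive (sum-*ʳ endCost e))
        quadratic : sum (λ i → sum λ j → e i * e j * cost i j) ≤ (c + m * L) * (L * (fromℕ 2 * q))
        quadratic = begin
          sum (λ i → sum λ j → e i * e j * cost i j)
            ≤⟨ sum-mono (λ i → sum-mono λ j → *-monoˡ-≤ (0≤-* (0≤e i) (0≤e j)) (cost≤ i j)) ⟩
          sum (λ i → sum λ j → e i * e j * (κ * gap (toℕ i) (toℕ j)))
            ≡⟨ sum-cong-≗ (λ i → trans (sum-cong-≗ λ j → swap (e i * e j) κ (gap (toℕ i) (toℕ j)))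
                 (sum-*ˡ κ (λ j → e i * e j * gap (toℕ i) (toℕ j)))) ⟩
          sum (λ i → κ * sum (λ j → e i * e j * gap (toℕ i) (toℕ j)))
            ≡⟨ sum-*ˡ κ (λ i → sum (λ j → e i * e j * gap (toℕ i) (toℕ j))) ⟩
          κ * sum (λ i → sum (λ j → e i * e j * gap (toℕ i) (toℕ j)))
            ≤⟨ *-monoˡ-≤ (0≤-+ 0≤c (0≤-* 0≤m 0≤L)) extra-gap≤ ⟩
          κ * (L * (fromℕ 2 * q)) ∎
          where
          κ = c + m * L
          swap = solve 3 (λ x k g → x :* (k :* g) := k :* (x :* g)) refl

  -- Equality case: the extra weight sits at the two ends.
  module _ (o z : Fin C) (o≡0 : toℕ o ≡ 0) (z≡ℓ : toℕ z ≡ ℓ) (x y : ℚ) where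

    ends : Fin C → ℚ
    ends i = x * δ i o + y * δ i z

    sum-ends : ∀ (F : Fin C → ℚ) → sum (λ i → ends i * F i) ≡ x * F o + y * F z
    sum-ends F = begin
      sum (λ i → ends i * F i)
        ≡⟨ sum-cong-≗ (λ i → distrib x (δ i o) y (δ i z) (F i)) ⟩
      sum (λ i → x * (δ i o * F i) + y * (δ i z * F i))
        ≡⟨ trans (∑-distrib-+ (λ i → x * (δ i o * F i)) (λ i → y * (δ i z * F i)))
             (cong₂ _+_ (trans (sum-*ˡ x (λ i → δ i o * F i)) (cong (x *_) (sum-δ o F)))
                        (trans (sum-*ˡ y (λ i → δ i z * F i)) (cong (y *_) (sum-δ z F)))) ⟩
      x * F o + y * F z ∎
      where
      open ≡-Reasoning
      distrib = solve 5 (λ x d y e f → (x :* d :+ y :* e) :* f := x :* (d :* f) :+ y :* (e :* f)) refl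

    cost-oo : cost o o ≡ 0ℚ
    cost-oo = trans (cong (λ g → c * g + m * (g * g)) (cong fromℕ (ℕ.∣n-n∣≡0 (toℕ o)))) (vanish c m)
      where
      vanish = solve 2 (λ c m → c :* con 0ℚ :+ m :* (con 0ℚ :* con 0ℚ) := con 0ℚ) refl

    cost-zz : cost z z ≡ 0ℚ
    cost-zz = trans (cong (λ g → c * g + m * (g * g)) (cong fromℕ (ℕ.∣n-n∣≡0 (toℕ z)))) (vanish c m)
      where
      vanish = solve 2 (λ c m → c :* con 0ℚ :+ m :* (con 0ℚ :* con 0ℚ) := con 0ℚ) refl

    cost-oz : cost o z ≡ c * L + m * (L * L)
    cost-oz = cong (λ g → c * g + m * (g * g)) (cong₂ gap o≡0 z≡ℓ)

    row-o : sum (cost o) ≡ endCost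
    row-o = trans (row-split o) (cong (λ t → c * sum {C} (λ j → gap t (toℕ j)) + m * sum {C} (λ j → gap t (toℕ j) * gap t (toℕ j))) o≡0)

    from-end : ∀ j → gap (toℕ z) (toℕ j) ≡ L - fromℕ (toℕ j)
    from-end j = trans (cong (λ t → gap t (toℕ j)) z≡ℓ)
      (trans (cong fromℕ (ℕ.m≤n⇒∣n-m∣≡n∸m (toℕ≤ℓ j))) (fromℕ-∸ (toℕ≤ℓ j)))

    row-z : sum (cost z) ≡ endCost
    row-z = begin
      sum (cost z)
        ≡⟨ row-split z ⟩
      c * sum {C} (λ j → gap (toℕ z) (toℕ j)) + m * sum {C} (λ j → gap (toℕ z) (toℕ j) * gap (toℕ z) (toℕ j))
        ≡⟨ cong₂ (λ a b → c * a + m * b) first second ⟩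
      c * (c * L - S₁) + m * (c * (L * L) - L * (fromℕ 2 * S₁) + S₂)
        ≡⟨ cong₂ (λ a b → c * (a - S₁) + m * (c * (L * L) - L * b + S₂)) (sym 2S₁) 2S₁ ⟩
      c * (fromℕ 2 * S₁ - S₁) + m * (c * (L * L) - L * (c * L) + S₂)
        ≡⟨ simp c m S₁ S₂ L ⟩
      endCost ∎
      where
      open ≡-Reasoning
      simp = solve 5 (λ c m S₁ S₂ L → c :* (# 2 :* S₁ :- S₁) :+ m :* (c :* (L :* L) :- L :* (c :* L) :+ S₂) := c :* S₁ :+ m :* S₂) refl
      square = solve 2 (λ L y → (L :- y) :* (L :- y) := L :* L :- L :* (# 2 :* y) :+ y :* y) refl
      first : sum {C} (λ j → gap (toℕ z) (toℕ j)) ≡ c * L - S₁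
      first = trans (sum-cong-≗ {C} from-end) (trans (sum-minus {C} (λ _ → L) (λ j → fromℕ (toℕ j))) (cong (_- S₁) (sum-const-c L)))
      second : sum {C} (λ j → gap (toℕ z) (toℕ j) * gap (toℕ z) (toℕ j)) ≡ c * (L * L) - L * (fromℕ 2 * S₁) + S₂
      second = trans (sum-cong-≗ {C} λ j → trans (cong (λ g → g * g) (from-end j)) (square L (fromℕ (toℕ j))))
        (trans (∑-distrib-+ {C} (λ j → L * L - L * (fromℕ 2 * fromℕ (toℕ j))) (λ j → fromℕ (toℕ j) * fromℕ (toℕ j)))
          (cong (_+ S₂) (trans (sum-minus {C} (λ _ → L * L) (λ j → L * (fromℕ 2 * fromℕ (toℕ j))))
            (cong₂ _-_ (sum-const-c (L * L)) (trans (sum-*ˡ {C} L (λ j → fromℕ 2 * fromℕ (toℕ j)))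
              (cong (L *_) (sum-*ˡ {C} (fromℕ 2) (λ j → fromℕ (toℕ j)))))))))

    ends-cost : sum (λ i → sum λ j → (1ℚ + ends i) * (1ℚ + ends j) * cost i j) ≡
                pathCost + fromℕ 2 * ((x + y) * endCost) + (c + m * L) * (L * (fromℕ 2 * (x * y)))
    ends-cost = begin
      sum (λ i → sum λ j → (1ℚ + ends i) * (1ℚ + ends j) * cost i j)
        ≡⟨ weights-expand ends ⟩
      pathCost + fromℕ 2 * sum (λ i → ends i * sum (cost i)) + sum (λ i → sum λ j → ends i * ends j * cost i j)
        ≡⟨ cong₂ (λ a b → pathCost + fromℕ 2 * a + b) (trans (sum-ends (λ i → sum (cost i))) (cong₂ (λ a b → x * a + y * b) row-o row-z)) quadratic ⟩
      pathCost + fromℕ 2 * (x * endCost + y * endCost) + (x * (x * 0ℚ + y * (c * L + m * (L * L))) + y * (x * (c * L + m * (L * L)) + y * 0ℚ))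
        ≡⟨ arrange pathCost x y endCost c m L ⟩
      pathCost + fromℕ 2 * ((x + y) * endCost) + (c + m * L) * (L * (fromℕ 2 * (x * y))) ∎
      where
      open ≡-Reasoning
      arrange = solve 7 (λ p x y E c m L →
        p :+ # 2 :* (x :* E :+ y :* E) :+ (x :* (x :* con 0ℚ :+ y :* (c :* L :+ m :* (L :* L))) :+ y :* (x :* (c :* L :+ m :* (L :* L)) :+ y :* con 0ℚ)) :=
        p :+ # 2 :* ((x :+ y) :* E) :+ (c :+ m :* L) :* (L :* (# 2 :* (x :* y)))) refl
      quadratic : sum (λ i → sum λ j → ends i * ends j * cost i j) ≡
                  x * (x * 0ℚ + y * (c * L + m * (L * L))) + y * (x * (c * L + m * (L * L)) + y * 0ℚ)
      quadratic = begin
        sum (λ i → sum λ j → ends i * ends j * cost i j)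
          ≡⟨ sum-cong-≗ (λ i → trans (sum-cong-≗ λ j → ℚ.*-assoc (ends i) (ends j) (cost i j))
               (trans (sum-*ˡ (ends i) (λ j → ends j * cost i j)) (cong (ends i *_) (sum-ends (cost i))))) ⟩
        sum (λ i → ends i * (x * cost i o + y * cost i z))
          ≡⟨ sum-ends (λ i → x * cost i o + y * cost i z) ⟩
        x * (x * cost o o + y * cost o z) + y * (x * cost z o + y * cost z z)
          ≡⟨ cong₂ (λ a b → x * a + y * b)
               (cong₂ (λ a b → x * a + y * b) cost-oo cost-oz)
               (cong₂ (λ a b → x * a + y * b) (trans (cost-sym z o) cost-oz) cost-zz) ⟩
        x * (x * 0ℚ + y * (c * L + m * (L * L))) + y * (x * (c * L + m * (L * L)) + y * 0ℚ) ∎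

-- The polynomials c · fₑ(c) and c · fₒ(c)

parityTerm : ℕ → ℚ
parityTerm K = fromℕ (K % 2)

-- The difference K² - 4 E (K - E) is (K - 2 E)², the square of an integer with the parity of K.
quarter-bound : ∀ K {E} → Integral E → fromℕ 4 * (E * (fromℕ K - E)) ≤ fromℕ K * fromℕ K - parityTerm K
quarter-bound K {E} (z , refl) = ≤-via (trans (shape (fromℕ K) (fromℤ z) (parityTerm K))
    (cong (λ y → y * y - parityTerm K) (sym y≡))) (≤⇒0≤ (odd-square (K % 2) refl (ℕ.m%n<n K 2)))
  where
  y : ℤ
  y = + K ℤ.- + 2 ℤ.* z
  y≡ : fromℤ y ≡ fromℕ K - fromℕ 2 * fromℤ z
  y≡ = trans (fromℤ-+ (+ K) (ℤ.- (+ 2 ℤ.* z))) (cong (_+_ (fromℕ K)) (trans (fromℤ-neg (+ 2 ℤ.* z)) (cong -_ (fromℤ-* (+ 2) z))))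
  shape = solve 3 (λ K z t → K :* K :- t :- # 4 :* (z :* (K :- z)) := (K :- # 2 :* z) :* (K :- # 2 :* z) :- t) refl
  nonzero-square : ∀ x → x ≢ + 0 → + 1 ℤ.≤ x ℤ.* x
  nonzero-square (+ zero)  x≢0 = contradiction refl x≢0
  nonzero-square (+ suc k) _   = ℤ.+≤+ (s≤s z≤n)
  nonzero-square -[1+ k ] _    = ℤ.+≤+ (s≤s z≤n)
  even : y ≡ + 0 → K % 2 ≡ 0
  even y≡0 = trans (cong (_% 2) K≡) (ℕ.m*n%n≡0 ℤ.∣ z ∣ 2)
    where
    K≡ : K ≡ ℤ.∣ z ∣ ℕ.* 2
    K≡ = trans (cong ℤ.∣_∣ (ℤ.i-j≡0⇒i≡j (+ K) (+ 2 ℤ.* z) y≡0)) (trans (ℤ.∣i*j∣≡∣i∣*∣j∣ (+ 2) z) (ℕ.*-comm 2 ℤ.∣ z ∣))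
  odd-square : ∀ s → K % 2 ≡ s → s ℕ.< 2 → parityTerm K ≤ fromℤ y * fromℤ y
  odd-square zero          e _ = ℚ.≤-trans (ℚ.≤-reflexive (cong fromℕ e)) (0≤-square (fromℤ y))
  odd-square (suc zero)    e _ = subst₂ _≤_ (cong fromℕ (sym e)) (fromℤ-* y y)
    (fromℤ-mono-≤ {+ 1} {y ℤ.* y} (nonzero-square y λ y≡0 → contradiction (trans (sym e) (even y≡0)) λ ()))
  odd-square (suc (suc s)) e (s≤s (s≤s ()))

-- c · f, with θ = 0 for fₑ and θ = 1 for fₒ.
quartic : ℚ → ℚ → ℚ → ℚ
quartic N c θ = c * c * c * c + (fromℕ 2 * (N * N) - fromℕ 2 * N - fromℕ 3) * (c * c * c)
  + (fromℕ 3 * N - fromℕ 3 * (N * N * N) - 1ℚ + θ * (fromℕ 3 * N)) * (c * c)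
  + (fromℕ 6 * (N * N * N) - fromℕ 5 * (N * N) + fromℕ 2 * N + θ * (fromℕ 3 - fromℕ 6 * N)) * c
  + (fromℕ 3 * (N * N) - fromℕ 3 * (N * N * N) + θ * (fromℕ 3 * N - fromℕ 3))

:quartic : ∀ {n} → Polynomial n → Polynomial n → Polynomial n → Polynomial n
:quartic N c θ = c :* c :* c :* c :+ (# 2 :* (N :* N) :- # 2 :* N :- # 3) :* (c :* c :* c)
  :+ (# 3 :* N :- # 3 :* (N :* N :* N) :- con 1ℚ :+ θ :* (# 3 :* N)) :* (c :* c)
  :+ (# 6 :* (N :* N :* N) :- # 5 :* (N :* N) :+ # 2 :* N :+ θ :* (# 3 :- # 6 :* N)) :* c
  :+ (# 3 :* (N :* N) :- # 3 :* (N :* N :* N) :+ θ :* (# 3 :* N :- # 3))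

fₑ-quartic : ∀ n z → fromℤ z ≢ 0ℚ → fromℤ z * fₑ n z ≡ quartic (fromℕ n) (fromℤ z) 0ℚ
fₑ-quartic n z z≢0 = begin
  c * fₑ n z                    ≡⟨ expand N c (inv c) ⟩
  quartic N c 0ℚ + e * (c * inv c - 1ℚ)  ≡⟨ cong (λ x → quartic N c 0ℚ + e * (x - 1ℚ)) (*-inv z≢0) ⟩
  quartic N c 0ℚ + e * (1ℚ - 1ℚ)  ≡⟨ drop (quartic N c 0ℚ) e ⟩
  quartic N c 0ℚ                  ∎
  where
  open ≡-Reasoning
  N c e : ℚ
  N = fromℕ n
  c = fromℤ z
  -- The coefficient of `inv c`, with powers written as `_^_` unfolds.
  e = - (fromℕ 3 * (N * (N * (N * 1ℚ)))) + fromℕ 3 * (N * (N * 1ℚ))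
  drop = solve 2 (λ x e → x :+ e :* (con 1ℚ :- con 1ℚ) := x) refl
  expand = solve 3 (λ N c i →
    let N² = N :* (N :* con 1ℚ)
        N³ = N :* N²
        e  = :- (# 3 :* N³) :+ # 3 :* N²
    in c :* (c :* (c :* (c :* con 1ℚ)) :+ (# 2 :* N² :- # 2 :* N :- # 3) :* (c :* (c :* con 1ℚ)) :+ (:- (# 3 :* N³) :+ # 3 :* N :- con 1ℚ) :* c
         :+ (# 6 :* N³ :- # 5 :* N² :+ # 2 :* N) :+ e :* i)
       := :quartic N c (con 0ℚ) :+ e :* (c :* i :- con 1ℚ)) refl

fₒ-quartic : ∀ n z → fromℤ z ≢ 0ℚ → fromℤ z * fₒ n z ≡ quartic (fromℕ n) (fromℤ z) 1ℚ
fₒ-quartic n z z≢0 = begin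
  c * fₒ n z                    ≡⟨ expand N c (inv c) ⟩
  quartic N c 1ℚ + e * (c * inv c - 1ℚ)  ≡⟨ cong (λ x → quartic N c 1ℚ + e * (x - 1ℚ)) (*-inv z≢0) ⟩
  quartic N c 1ℚ + e * (1ℚ - 1ℚ)  ≡⟨ drop (quartic N c 1ℚ) e ⟩
  quartic N c 1ℚ                  ∎
  where
  open ≡-Reasoning
  N c e : ℚ
  N = fromℕ n
  c = fromℤ z
  e = - (fromℕ 3 * (N * (N * (N * 1ℚ)))) + fromℕ 3 * (N * (N * 1ℚ)) + fromℕ 3 * N - fromℕ 3
  drop = solve 2 (λ x e → x :+ e :* (con 1ℚ :- con 1ℚ) := x) refl
  expand = solve 3 (λ N c i →
    let N² = N :* (N :* con 1ℚ)
        N³ = N :* N²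
        e  = :- (# 3 :* N³) :+ # 3 :* N² :+ # 3 :* N :- # 3
    in c :* (c :* (c :* (c :* con 1ℚ)) :+ (# 2 :* N² :- # 2 :* N :- # 3) :* (c :* (c :* con 1ℚ)) :+ (:- (# 3 :* N³) :+ # 6 :* N :- con 1ℚ) :* c
         :+ (# 6 :* N³ :- # 5 :* N² :- # 4 :* N :+ # 3) :+ e :* i)
       := :quartic N c (con 1ℚ) :+ e :* (c :* i :- con 1ℚ)) refl

-- With y = c + 1, t = N - 1 and s = 3 t - 4 y the difference (c + 2) Q(c) - c Q(c + 2) is a sum of nonnegative terms.
quartic-down : ∀ N c θ → 0ℚ ≤ c - fromℕ 3 → 0ℚ ≤ fromℕ 3 * N - fromℕ 4 * c - fromℕ 7 → 0ℚ ≤ θ → 0ℚ ≤ 1ℚ - θ →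
               c * quartic N (c + fromℕ 2) θ ≤ (c + fromℕ 2) * quartic N c θ
quartic-down N c θ 0≤z 0≤s 0≤θ 0≤1-θ = ≤-via (difference N c θ)
  (0≤-* (0≤fromℕ 2) (0≤-+ (0≤-+ (0≤-* 0≤w 0≤U) (0≤-* (0≤-* 0≤N 0≤t) 0≤Z))
    (0≤-+ (0≤-* 0≤1-θ (0≤-* (0≤-* (0≤fromℕ 3) 0≤N) 0≤w)) (0≤-* (0≤-* (0≤fromℕ 3) 0≤θ) 0≤t))))
  where
  difference = solve 3 (λ N c θ →
    let z = c :- # 3
        y = c :+ con 1ℚ
        t = N :- con 1ℚ
        s = # 3 :* N :- # 4 :* c :- # 7
        w = # 15 :+ # 8 :* z :+ z :* z
    in (c :+ # 2) :* :quartic N c θ :- c :* :quartic N (c :+ # 2) θ :=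
       # 2 :* (w :* (con (+ 5 / 9) :* (y :* y) :+ con (+ 2 / 9) :* (s :* s) :+ con (+ 16 / 9) :* (z :* s) :+ con (+ 61 / 9) :* s
                     :+ con (+ 14 / 3) :* z :+ con (+ 47 / 3))
         :+ N :* t :* (s :* (# 14 :+ # 8 :* z :+ z :* z) :+ (# 41 :+ # 28 :* z :+ # 4 :* (z :* z)))
         :+ ((con 1ℚ :- θ) :* (# 3 :* N :* w) :+ # 3 :* θ :* t))) refl
  0≤zz = 0≤-square (c - fromℕ 3)
  0≤w = 0≤-+ (0≤-+ (0≤fromℕ 15) (0≤-* (0≤fromℕ 8) 0≤z)) 0≤zz
  0≤t : 0ℚ ≤ N - 1ℚ
  0≤t = subst (0ℚ ≤_) (sym (shape N c)) (0≤-* {+ 1 / 3} (ℚ.<⇒≤ (ℚ.positive⁻¹ (+ 1 / 3))) (0≤-+ (0≤-+ (0≤fromℕ 16) (0≤-* (0≤fromℕ 4) 0≤z)) 0≤s))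
    where
    shape = solve 2 (λ N c → N :- con 1ℚ := con (+ 1 / 3) :* (# 16 :+ # 4 :* (c :- # 3) :+ (# 3 :* N :- # 4 :* c :- # 7))) refl
  0≤N : 0ℚ ≤ N
  0≤N = subst (0ℚ ≤_) (shape N) (0≤-+ 0≤t (ℚ.<⇒≤ 0<1))
    where
    shape = solve 1 (λ N → N :- con 1ℚ :+ con 1ℚ := N) refl
  const : ∀ q .{{_ : Data.Rational.Positive q}} → 0ℚ ≤ q
  const q = ℚ.<⇒≤ (ℚ.positive⁻¹ q)
  0≤U = 0≤-+ (0≤-+ (0≤-+ (0≤-+ (0≤-+ (0≤-* (const (+ 5 / 9)) (0≤-square (c + 1ℚ))) (0≤-* (const (+ 2 / 9)) (0≤-square (fromℕ 3 * N - fromℕ 4 * c - fromℕ 7))))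
    (0≤-* (const (+ 16 / 9)) (0≤-* 0≤z 0≤s))) (0≤-* (const (+ 61 / 9)) 0≤s)) (0≤-* (const (+ 14 / 3)) 0≤z)) (const (+ 47 / 3))
  0≤Z = 0≤-+ (0≤-* 0≤s (0≤-+ (0≤-+ (0≤fromℕ 14) (0≤-* (0≤fromℕ 8) 0≤z)) 0≤zz))
             (0≤-+ (0≤-+ (0≤fromℕ 41) (0≤-* (0≤fromℕ 28) 0≤z)) (0≤-* (0≤fromℕ 4) 0≤zz))

-- An expansion of c Q(c + 2) - (c + 2) Q(c) into nonnegative terms, as in `quartic-down`. Within
-- the factor of c (c + 2), the coefficient of s and the part free of s and θ are expanded about N =
-- 23, where all coefficients are positive.
quartic-up : ∀ N c θ → 0ℚ ≤ N - fromℕ 23 → 0ℚ ≤ c → 0ℚ ≤ fromℕ 4 * c - fromℕ 3 * N - fromℕ 2 → 0ℚ ≤ θ → 0ℚ ≤ 1ℚ - θ →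
             (c + fromℕ 2) * quartic N c θ ≤ c * quartic N (c + fromℕ 2) θ
quartic-up N c θ 0≤t 0≤c 0≤s 0≤θ 0≤1-θ = ≤-via (difference N c θ)
  (0≤-* (0≤fromℕ 2) (0≤-+ (0≤-* (0≤-* 0≤c (0≤-+ 0≤c (0≤fromℕ 2))) 0≤V)
    (0≤-* (0≤-* (0≤fromℕ 3) 0≤N-1) (0≤-+ (0≤-* 0≤N-1 (0≤-+ 0≤N (ℚ.<⇒≤ 0<1))) 0≤1-θ))))
  where
  difference = solve 3 (λ N c θ →
    let t = N :- # 23
        s = # 4 :* c :- # 3 :* N :- # 2
    in c :* :quartic N (c :+ # 2) θ :- (c :+ # 2) :* :quartic N c θ :=
       # 2 :* (c :* (c :+ # 2) :* (# 3 :* (c :* c) :+ # 6 :* c :+ # 4 :+ (t :* t :+ # 45 :* t :+ con (+ 1009 / 2)) :* s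
                     :+ (# 3 :* (t :* t) :+ con (+ 261 / 2) :* t :+ con (+ 2809 / 2)) :+ # 3 :* N :* θ)
         :+ # 3 :* (N :- con 1ℚ) :* ((N :- con 1ℚ) :* (N :+ con 1ℚ) :+ (con 1ℚ :- θ)))) refl
  const : ∀ q .{{_ : Data.Rational.Positive q}} → 0ℚ ≤ q
  const q = ℚ.<⇒≤ (ℚ.positive⁻¹ q)
  0≤N-1 : 0ℚ ≤ N - 1ℚ
  0≤N-1 = subst (0ℚ ≤_) (shape N) (0≤-+ 0≤t (0≤fromℕ 22))
    where
    shape = solve 1 (λ N → N :- # 23 :+ # 22 := N :- con 1ℚ) refl
  0≤N : 0ℚ ≤ N
  0≤N = subst (0ℚ ≤_) (shape N) (0≤-+ 0≤t (0≤fromℕ 23))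
    where
    shape = solve 1 (λ N → N :- # 23 :+ # 23 := N) refl
  0≤V = 0≤-+ (0≤-+ (0≤-+ (0≤-+ (0≤-+ (0≤-* (0≤fromℕ 3) (0≤-square c)) (0≤-* (0≤fromℕ 6) 0≤c)) (0≤fromℕ 4))
      (0≤-* (0≤-+ (0≤-+ (0≤-square (N - fromℕ 23)) (0≤-* (0≤fromℕ 45) 0≤t)) (const (+ 1009 / 2))) 0≤s))
      (0≤-+ (0≤-+ (0≤-* (0≤fromℕ 3) (0≤-square (N - fromℕ 23))) (0≤-* (const (+ 261 / 2)) 0≤t)) (const (+ 2809 / 2))))
    (0≤-* (0≤-* (0≤fromℕ 3) 0≤N) 0≤θ)

-- Floors, ceilings and parity

floor-unique : ∀ p z → fromℤ z ≤ p → p < fromℤ (ℤ.suc z) → floor p ≡ z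
floor-unique p@(mkℚ a d-1 _) z z≤p p<1+z = ℤ.≤-antisym
  (below (ℤ.*-cancelʳ-<-nonNeg D (ℤ.≤-<-trans (ℤ.[n/d]*d≤n a D) (subst (ℤ._< ℤ.suc z ℤ.* D) (ℤ.*-identityʳ a)
    (ℚ.drop-*<* (subst (p <_) (fromℤ-mkℚ (ℤ.suc z)) p<1+z))))))
  (below (ℤ.*-cancelʳ-<-nonNeg D (ℤ.≤-<-trans (subst (z ℤ.* D ℤ.≤_) (ℤ.*-identityʳ a)
    (ℚ.drop-*≤* (subst (_≤ p) (fromℤ-mkℚ z) z≤p)))
    (subst (λ q → a ℤ.< ℤ.suc q ℤ.* D) (sym (ℤ.div-pos-is-/ℕ a (suc d-1))) (ℤ.n<s[n/ℕd]*d a (suc d-1))))))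
  where
  D : ℤ
  D = + suc d-1
  below : ∀ {x y} → x ℤ.< ℤ.suc y → x ℤ.≤ y
  below {x} {y} x<1+y = subst (x ℤ.≤_) (ℤ.pred-suc y) (ℤ.i<j⇒i≤pred[j] x<1+y)

ceiling-floor : ∀ p → ceiling p ≡ ℤ.- floor (- p)
ceiling-floor p@(mkℚ _ _ _) = refl

ceiling-unique : ∀ p z → fromℤ z - 1ℚ < p → p ≤ fromℤ z → ceiling p ≡ z
ceiling-unique p z z-1<p p≤z = trans (ceiling-floor p) (trans (cong ℤ.-_ (floor-unique (- p) (ℤ.- z)
    (subst (_≤ - p) (sym (fromℤ-neg z)) (ℚ.neg-antimono-≤ p≤z))
    (subst (- p <_) shift (ℚ.neg-antimono-< z-1<p)))) (ℤ.neg-involutive z))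
  where
  flip = solve 1 (λ x → :- (x :- con 1ℚ) := con 1ℚ :+ :- x) refl
  shift : - (fromℤ z - 1ℚ) ≡ fromℤ (ℤ.suc (ℤ.- z))
  shift = trans (flip (fromℤ z)) (sym (trans (fromℤ-+ (+ 1) (ℤ.- z)) (cong (_+_ 1ℚ) (fromℤ-neg z))))

-- The second argument stands for the number n - c of vertices off the cycle. Recursion in steps of
-- 2 makes `fParity` insensitive to even shifts by computation.
fParity : ℕ → ℕ → ℤ → ℚ
fParity n zero          = fₑ n
fParity n (suc zero)    = fₒ n
fParity n (suc (suc K)) = fParity n K

-- The value of `parityTerm` again, but recursive in steps of 2 like `fParity`.
θParity : ℕ → ℚ
θParity zero          = 0ℚ
θParity (suc zero)    = 1ℚ
θParity (suc (suc K)) = θParity K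

parityTerm≡θ : ∀ K → parityTerm K ≡ θParity K
parityTerm≡θ zero          = refl
parityTerm≡θ (suc zero)    = refl
parityTerm≡θ (suc (suc K)) = trans
  (cong fromℕ (trans (cong (_% 2) (ℕ.+-comm 2 K)) (ℕ.[m+n]%n≡m%n K 2))) (parityTerm≡θ K)

fParity-quartic : ∀ n K z → fromℤ z ≢ 0ℚ → fromℤ z * fParity n K z ≡ quartic (fromℕ n) (fromℤ z) (θParity K)
fParity-quartic n zero          = fₑ-quartic n
fParity-quartic n (suc zero)    = fₒ-quartic n
fParity-quartic n (suc (suc K)) = fParity-quartic n K

0≤θ : ∀ K → 0ℚ ≤ θParity K
0≤θ zero          = ℚ.≤-refl
0≤θ (suc zero)    = ℚ.<⇒≤ 0<1
0≤θ (suc (suc K)) = 0≤θ K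

0≤1-θ : ∀ K → 0ℚ ≤ 1ℚ - θParity K
0≤1-θ zero          = ℚ.<⇒≤ 0<1
0≤1-θ (suc zero)    = ℚ.≤-refl
0≤1-θ (suc (suc K)) = 0≤1-θ K

0<fromℕ-suc : ∀ k → 0ℚ < fromℕ (suc k)
0<fromℕ-suc k = ℚ.<-≤-trans 0<1 (fromℕ-mono-≤ {1} {suc k} (s≤s z≤n))

-- Passes between the denominator-free estimates on `quartic` and the values in the theorem. The
-- factors match as 3 · 4 N (N - 1) · z = 2 z · 6 N (N - 1). The cycle length is `suc c`, so `z` is
-- positive.
module Prefactor (n : ℕ) (0<N : 0ℚ < fromℕ n) (0<N-1 : 0ℚ < fromℕ n - 1ℚ) (K c : ℕ) (Δ : ℚ) where

  private
    N m z f p : ℚ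
    N = fromℕ n
    m = N - 1ℚ
    z = fromℕ (suc c)
    f = fParity n K (+ suc c)
    p = prefactor n

    0<z : 0ℚ < z
    0<z = 0<fromℕ-suc c

    0<6Nm : 0ℚ < fromℕ 6 * N * m
    0<6Nm = 0<-* {fromℕ 6 * N} (0<-* {fromℕ 6} (0<fromℕ-suc 5) 0<N) 0<N-1

    0<2z : 0ℚ < fromℕ 2 * z
    0<2z = 0<-* {fromℕ 2} (0<fromℕ-suc 1) 0<z

    left : fromℕ 2 * quartic N z (θParity K) ≡ fromℕ 2 * z * f
    left = trans (cong (fromℕ 2 *_) (sym (fParity-quartic n K (+ suc c) (>⇒≢ 0<z)))) (sym (ℚ.*-assoc (fromℕ 2) z f))

    right : fromℕ 3 * (fromℕ 4 * (N * m) * (z * Δ)) ≡ fromℕ 2 * z * (fromℕ 6 * N * m * Δ)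
    right = shape N m z Δ
      where
      shape = solve 4 (λ N m z D → # 3 :* (# 4 :* (N :* m) :* (z :* D)) := # 2 :* z :* (# 6 :* N :* m :* D)) refl

    cancel : p * (fromℕ 6 * N * m * Δ) ≡ Δ
    cancel = trans (swap p (fromℕ 6 * N * m) Δ) (trans (cong (_* Δ) (*-inv (>⇒≢ 0<6Nm))) (ℚ.*-identityˡ Δ))
      where
      swap = solve 3 (λ p x D → p :* (x :* D) := x :* p :* D) refl

  prefactor-≤ : fromℕ 2 * quartic N z (θParity K) ≤ fromℕ 3 * (fromℕ 4 * (N * m) * (z * Δ)) → p * f ≤ Δ
  prefactor-≤ h = subst (p * f ≤_) cancel (*-monoˡ-≤ {f} {fromℕ 6 * N * m * Δ} (0≤inv 0<6Nm)
    (*-cancelˡ-≤ {f} {fromℕ 6 * N * m * Δ} 0<2z (subst₂ _≤_ left right h)))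

  prefactor-≡ : fromℕ 3 * (fromℕ 4 * (N * m) * (z * Δ)) ≡ fromℕ 2 * quartic N z (θParity K) → p * f ≡ Δ
  prefactor-≡ h = trans (cong (p *_) (*-cancelˡ-≡ {f} {fromℕ 6 * N * m * Δ} 0<2z (trans (sym left) (trans (sym h) right)))) cancel

-- Adding an edge to a tree

-- The interface to distances in the tree; from here on the construction order is forgotten.
record TreeMetric {n : ℕ} (G : Graph n) : Set where
  open Laplacian G
  field
    ρ         : Fin n → Fin n → ℕ
    ρ-sym     : ∀ a b → ρ a b ≡ ρ b a
    ρ-diag    : ∀ a → ρ a a ≡ 0
    ρ-zero    : ∀ {a b} → ρ a b ≡ 0 → a ≡ b
    ρ-one     : ∀ {a b} → ρ a b ≡ 1 → Adj G a b
    ρ-adj     : ∀ {a b} k → Adj G a b → ρ a k ≡ suc (ρ b k) ⊎ ρ b k ≡ suc (ρ a k)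
    ρ-lap     : ∀ a k → lap (λ b → fromℕ (ρ b k)) a ≡ fromℕ 2 - d a - fromℕ 2 * δ a k
    fourPoint : ∀ a b u v → (ρ a b ℕ.+ ρ u v ℕ.≤ ρ a u ℕ.+ ρ b v) ⊎
                            (ρ a b ℕ.+ ρ u v ℕ.≤ ρ a v ℕ.+ ρ b u)

module _ {n : ℕ} (G : Graph n) where
  open Growth G
  open Laplacian G using (A; d; lap)

  treeMetric : ∀ {S} → Built S → (∀ i → i ∈ S) → TreeMetric G
  treeMetric {S} B all = record
    { ρ         = dist B
    ; ρ-sym     = dist-sym B
    ; ρ-diag    = dist-diag B
    ; ρ-zero    = dist-zero B (all _) (all _)
    ; ρ-one     = dist-one B (all _) (all _)
    ; ρ-adj     = λ k → dist-adj B (all _) (all _) (all k)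
    ; ρ-lap     = λ a k → begin
        lap (λ b → fromℕ (dist B b k)) a             ≡⟨ sym (lsum-complete (unique B) all _) ⟩
        lapOn S (λ b → fromℕ (dist B b k)) a         ≡⟨ dist-lap B (all a) (all k) ⟩
        fromℕ 2 - lsum S (A a) - fromℕ 2 * δ a k     ≡⟨ cong (λ x → fromℕ 2 - x - fromℕ 2 * δ a k)
                                                          (lsum-complete (unique B) all (A a)) ⟩
        fromℕ 2 - d a - fromℕ 2 * δ a k              ∎
    ; fourPoint = fourPoint B
    }
    where open ≡-Reasoning

module Green {n : ℕ} (G : Graph n) where
  open Laplacian G

  energy : (Fin n → ℚ) → (Fin n → ℚ) → ℚ
  energy f g = sum λ a → sum λ b → A a b * ((f a - f b) * (g a - g b))

  -- Discrete Green's identity. The factor 2 appears because `energy` counts every edge in both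
  -- directions.
  green : ∀ f g → fromℕ 2 * sum (λ a → g a * lap f a) ≡ energy f g
  green f g = begin
    fromℕ 2 * half                      ≡⟨ double half ⟩
    half + half                         ≡⟨ cong₂ _+_ left (trans left (∑-comm (λ a b → A a b * (g a * (f a - f b))))) ⟩
    sum (λ a → sum λ b → A a b * (g a * (f a - f b))) + sum (λ b → sum λ a → A a b * (g a * (f a - f b)))
      ≡⟨ sym (∑-distrib-+ {n} (λ a → sum λ b → A a b * (g a * (f a - f b))) (λ b → sum λ a → A a b * (g a * (f a - f b)))) ⟩
    sum (λ a → sum (λ b → A a b * (g a * (f a - f b))) + sum (λ b → A b a * (g b * (f b - f a))))
      ≡⟨ sum-cong-≗ (λ a → trans (sym (∑-distrib-+ {n} (λ b → A a b * (g a * (f a - f b))) (λ b → A b a * (g b * (f b - f a)))))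
           (sum-cong-≗ λ b → trans (cong (λ e → A a b * (g a * (f a - f b)) + e * (g b * (f b - f a))) (A-sym b a))
             (combine (A a b) (f a) (f b) (g a) (g b)))) ⟩
    energy f g ∎
    where
    open ≡-Reasoning
    half = sum λ a → g a * lap f a
    double = solve 1 (λ x → # 2 :* x := x :+ x) refl
    left : half ≡ sum (λ a → sum λ b → A a b * (g a * (f a - f b)))
    left = sum-cong-≗ λ a → trans (sym (sum-*ˡ (g a) (λ b → A a b * (f a - f b))))
      (sum-cong-≗ λ b → swap (g a) (A a b) (f a - f b))
      where
      swap = solve 3 (λ g e x → g :* (e :* x) := e :* (g :* x)) refl
    combine = solve 5 (λ e fa fb ga gb → e :* (ga :* (fa :- fb)) :+ e :* (gb :* (fb :- fa)) := e :* ((fa :- fb) :* (ga :- gb))) refl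

  edge-sum-cong : ∀ {X Y : Fin n → Fin n → ℚ} → (∀ a b → Adj G a b → X a b ≡ Y a b) →
                  sum (λ a → sum λ b → A a b * X a b) ≡ sum (λ a → sum λ b → A a b * Y a b)
  edge-sum-cong {X} {Y} e = sum-cong-≗ λ a → sum-cong-≗ λ b → go a b
    where
    go : ∀ a b → A a b * X a b ≡ A a b * Y a b
    go a b with adj G a b in eq
    ... | true  = cong (1ℚ *_) (e a b (subst T (sym eq) tt))
    ... | false = trans (ℚ.*-zeroˡ (X a b)) (sym (ℚ.*-zeroˡ (Y a b)))

  energy-zero : ∀ f g → (∀ a b → Adj G a b → (f a - f b) * (g a - g b) ≡ 0ℚ) → energy f g ≡ 0ℚ
  energy-zero f g e = trans (edge-sum-cong e)
    (sum-zero λ a → sum-zero λ b → ℚ.*-zeroʳ (A a b))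

  energy-one : ∀ f → (∀ a b → Adj G a b → (f a - f b) * (f a - f b) ≡ 1ℚ) → energy f f ≡ sum d
  energy-one f e = trans (edge-sum-cong e) (sum-cong-≗ λ a → sum-cong-≗ λ b → ℚ.*-identityʳ (A a b))

module Change {n : ℕ} (G : Graph n) (M : TreeMetric G) (u v : Fin n) (u≢v : u ≢ v) (nonadj : ¬ Adj G u v) where
  open TreeMetric M
  open Laplacian G
  open Green G

  r : Fin n → Fin n → ℚ
  r a b = fromℕ (ρ a b)

  r-sym : ∀ a b → r a b ≡ r b a
  r-sym a b = cong fromℕ (ρ-sym a b)

  r-diag : ∀ a → r a a ≡ 0ℚ
  r-diag a = cong fromℕ (ρ-diag a)

  r-edge : ∀ {a b} k → Adj G a b → (r a k - r b k) * (r a k - r b k) ≡ 1ℚ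
  r-edge {a} {b} k ab with ρ-adj k ab
  ... | inj₁ e = trans (cong (λ x → (x - r b k) * (x - r b k)) (trans (cong fromℕ e) (fromℕ-suc (ρ b k)))) (up (r b k))
    where
    up = solve 1 (λ x → (con 1ℚ :+ x :- x) :* (con 1ℚ :+ x :- x) := con 1ℚ) refl
  ... | inj₂ e = trans (cong (λ x → (r a k - x) * (r a k - x)) (trans (cong fromℕ e) (fromℕ-suc (ρ a k)))) (down (r a k))
    where
    down = solve 1 (λ x → (x :- (con 1ℚ :+ x)) :* (x :- (con 1ℚ :+ x)) := con 1ℚ) refl

  -- At a vertex of degree 0 every Laplacian vanishes, whereas `ρ-lap` would give 2 there.
  isolated : ∀ {j k} → j ≢ k → d j ≢ 0ℚ
  isolated {j} {k} j≢k dj≡0 = contradiction (begin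
    0ℚ                                ≡⟨ sym (sum-zero λ i → trans (cong (_* (r j k - r i k))
                                           (ℚ.≤-antisym (ℚ.≤-trans (term≤sum (0≤A j) i) (ℚ.≤-reflexive dj≡0)) (0≤A j i)))
                                           (ℚ.*-zeroˡ (r j k - r i k))) ⟩
    lap (λ b → r b k) j               ≡⟨ ρ-lap j k ⟩
    fromℕ 2 - d j - fromℕ 2 * δ j k   ≡⟨ cong₂ (λ x e → fromℕ 2 - x - fromℕ 2 * e) dj≡0 (δ-≢ j≢k) ⟩
    fromℕ 2                           ∎) λ ()
    where open ≡-Reasoning

  degree≢0 : ∀ j → d j ≢ 0ℚ
  degree≢0 j with u ≟ j
  ... | no u≢j   = isolated (u≢j ∘ sym)
  ... | yes refl = isolated u≢v

  treeResistance : Resistance G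
  treeResistance = record
    { r = r ; r-sym = r-sym ; r-diag = r-diag ; τ = λ j → fromℕ 2 - d j ; laplace = ρ-lap ; degree≢0 = degree≢0 }

  N ℓ c : ℚ
  N = fromℕ n
  ℓ = r u v
  c = 1ℚ + ℓ

  sᵀ : Fin n → ℚ
  sᵀ = Hitting.s treeResistance

  Wᵀ 𝒦ᵀ : ℚ
  Wᵀ = Hitting.W treeResistance
  𝒦ᵀ = Hitting.kemeny treeResistance

  D : Fin n → ℚ
  D k = sum λ a → r a k

  -- No edges are counted: the values of a Laplacian sum to 0, by `green` against a constant, and
  -- `ρ-lap` evaluates this sum.
  sum-d : sum d ≡ fromℕ 2 * N - fromℕ 2
  sum-d = rearranged (begin
      fromℕ 2 * N - sum d - fromℕ 2
        ≡⟨ sym lap-total ⟩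
      sum (λ a → 1ℚ * lap (λ b → r b u) a)
        ≡⟨ halve (sum (λ a → 1ℚ * lap (λ b → r b u) a)) ⟩
      ½ * (fromℕ 2 * sum (λ a → 1ℚ * lap (λ b → r b u) a))
        ≡⟨ cong (½ *_) (trans (green (λ b → r b u) (λ _ → 1ℚ)) (energy-zero (λ b → r b u) (λ _ → 1ℚ) λ a b _ → flat (r a u - r b u))) ⟩
      0ℚ ∎)
    where
    open ≡-Reasoning
    rearranged : fromℕ 2 * N - sum d - fromℕ 2 ≡ 0ℚ → sum d ≡ fromℕ 2 * N - fromℕ 2
    rearranged e = trans (move (sum d) (fromℕ 2 * N)) (trans (cong (λ x → fromℕ 2 * N - fromℕ 2 - x) e) (ℚ.+-identityʳ _))
      where
      move = solve 2 (λ s m → s := m :- # 2 :- (m :- s :- # 2)) refl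
    halve = solve 1 (λ x → x := con ½ :* (# 2 :* x)) refl
    flat = solve 1 (λ x → x :* (con 1ℚ :- con 1ℚ) := con 0ℚ) refl
    lap-total : sum (λ a → 1ℚ * lap (λ b → r b u) a) ≡ fromℕ 2 * N - sum d - fromℕ 2
    lap-total = begin
      sum (λ a → 1ℚ * lap (λ b → r b u) a)
        ≡⟨ sum-cong-≗ (λ a → trans (cong (1ℚ *_) (ρ-lap a u)) (shape (d a) (δ a u))) ⟩
      sum (λ a → fromℕ 2 * 1ℚ - d a - δ a u * fromℕ 2)
        ≡⟨ sum-minus {n} (λ a → fromℕ 2 * 1ℚ - d a) (λ a → δ a u * fromℕ 2) ⟩
      sum (λ a → fromℕ 2 * 1ℚ - d a) - sum (λ a → δ a u * fromℕ 2)
        ≡⟨ cong₂ _-_ (trans (sum-minus {n} (λ a → fromℕ 2 * 1ℚ) d)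
             (cong (_- sum d) (trans (sum-*ˡ {n} (fromℕ 2) (λ _ → 1ℚ)) (cong (fromℕ 2 *_) (sum-const n)))))
             (sum-δ u (λ _ → fromℕ 2)) ⟩
      fromℕ 2 * N - sum d - fromℕ 2 ∎
      where
      shape = solve 2 (λ d e → con 1ℚ :* (# 2 :- d :- # 2 :* e) := # 2 :* con 1ℚ :- d :- e :* # 2) refl

  sum-lap : ∀ k f → sum (λ a → f a * lap (λ b → r b k) a) ≡ fromℕ 2 * sum f - sum (λ a → d a * f a) - fromℕ 2 * f k
  sum-lap k f = begin
    sum (λ a → f a * lap (λ b → r b k) a)
      ≡⟨ sum-cong-≗ (λ a → trans (cong (f a *_) (ρ-lap a k)) (shape (f a) (d a) (δ a k))) ⟩
    sum (λ a → fromℕ 2 * f a - d a * f a - δ a k * (fromℕ 2 * f a))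
      ≡⟨ sum-minus {n} (λ a → fromℕ 2 * f a - d a * f a) (λ a → δ a k * (fromℕ 2 * f a)) ⟩
    sum (λ a → fromℕ 2 * f a - d a * f a) - sum (λ a → δ a k * (fromℕ 2 * f a))
      ≡⟨ cong₂ _-_ (trans (sum-minus {n} (λ a → fromℕ 2 * f a) (λ a → d a * f a))
                     (cong (_- sum (λ a → d a * f a)) (sum-*ˡ (fromℕ 2) f)))
                   (sum-δ k (λ a → fromℕ 2 * f a)) ⟩
    fromℕ 2 * sum f - sum (λ a → d a * f a) - fromℕ 2 * f k ∎
    where
    open ≡-Reasoning
    shape = solve 3 (λ f d e → f :* (# 2 :- d :- # 2 :* e) := # 2 :* f :- d :* f :- e :* (# 2 :* f)) refl

  -- `green` with f = g = r(·,k): every ordered pair of neighbours contributes 1 to the energy by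
  -- `r-edge`, so the energy is the degree sum.
  s-tree : ∀ k → sᵀ k ≡ fromℕ 2 * D k - (N - 1ℚ)
  s-tree k = begin
    sᵀ k
      ≡⟨ move (sᵀ k) (D k) (r k k) ⟩
    fromℕ 2 * D k - ½ * (fromℕ 2 * (fromℕ 2 * D k - sᵀ k - fromℕ 2 * r k k)) - fromℕ 2 * r k k
      ≡⟨ cong₂ (λ x y → fromℕ 2 * D k - ½ * x - fromℕ 2 * y)
           (trans (cong (fromℕ 2 *_) (sym (sum-lap k (λ a → r a k))))
             (trans (green (λ a → r a k) (λ a → r a k)) (trans (energy-one (λ a → r a k) λ a b → r-edge k) sum-d)))
           (r-diag k) ⟩
    fromℕ 2 * D k - ½ * (fromℕ 2 * N - fromℕ 2) - fromℕ 2 * 0ℚ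
      ≡⟨ simp (D k) N ⟩
    fromℕ 2 * D k - (N - 1ℚ) ∎
    where
    open ≡-Reasoning
    move = solve 3 (λ s D r → s := # 2 :* D :- con ½ :* (# 2 :* (# 2 :* D :- s :- # 2 :* r)) :- # 2 :* r) refl
    simp = solve 2 (λ D N → # 2 :* D :- con ½ :* (# 2 :* N :- # 2) :- # 2 :* con 0ℚ := # 2 :* D :- (N :- con 1ℚ)) refl

  -- Twice the Wiener index, since pairs are ordered.
  Ω : ℚ
  Ω = sum D

  -- The relation between the Gutman index and the Wiener index of a tree. It applies `s-tree`
  -- twice, once on each side of the symmetric double sum.
  W-tree : Wᵀ ≡ fromℕ 4 * Ω - fromℕ 2 * (N * (N - 1ℚ)) - fromℕ 2 * ((N - 1ℚ) * (N - 1ℚ))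
  W-tree = begin
    sum (λ k → d k * sᵀ k)
      ≡⟨ sum-cong-≗ (λ k → trans (cong (d k *_) (s-tree k)) (shape (d k) (D k) (N - 1ℚ))) ⟩
    sum (λ k → fromℕ 2 * (d k * D k) - d k * (N - 1ℚ))
      ≡⟨ sum-minus {n} (λ k → fromℕ 2 * (d k * D k)) (λ k → d k * (N - 1ℚ)) ⟩
    sum (λ k → fromℕ 2 * (d k * D k)) - sum (λ k → d k * (N - 1ℚ))
      ≡⟨ cong₂ _-_ (trans (sum-*ˡ (fromℕ 2) (λ k → d k * D k)) (cong (fromℕ 2 *_) swapped)) (trans (sum-*ʳ (N - 1ℚ) d) (cong (_* (N - 1ℚ)) sum-d)) ⟩
    fromℕ 2 * (fromℕ 2 * Ω - N * (N - 1ℚ)) - (fromℕ 2 * N - fromℕ 2) * (N - 1ℚ)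
      ≡⟨ arrange Ω N ⟩
    fromℕ 4 * Ω - fromℕ 2 * (N * (N - 1ℚ)) - fromℕ 2 * ((N - 1ℚ) * (N - 1ℚ)) ∎
    where
    open ≡-Reasoning
    shape = solve 3 (λ d D m → d :* (# 2 :* D :- m) := # 2 :* (d :* D) :- d :* m) refl
    arrange = solve 2 (λ Ω N →
      # 2 :* (# 2 :* Ω :- N :* (N :- con 1ℚ)) :- (# 2 :* N :- # 2) :* (N :- con 1ℚ) :=
      # 4 :* Ω :- # 2 :* (N :* (N :- con 1ℚ)) :- # 2 :* ((N :- con 1ℚ) :* (N :- con 1ℚ))) refl
    swapped : sum (λ k → d k * D k) ≡ fromℕ 2 * Ω - N * (N - 1ℚ)
    swapped = begin
      sum (λ k → d k * D k)
        ≡⟨ sum-cong-≗ (λ k → sym (sum-*ˡ (d k) (λ a → r a k))) ⟩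
      sum (λ k → sum λ a → d k * r a k)
        ≡⟨ ∑-comm (λ k a → d k * r a k) ⟩
      sum (λ a → sum λ k → d k * r a k)
        ≡⟨ sum-cong-≗ (λ a → trans (sum-cong-≗ λ k → cong (d k *_) (r-sym a k)) (s-tree a)) ⟩
      sum (λ a → fromℕ 2 * D a - (N - 1ℚ))
        ≡⟨ sum-minus {n} (λ a → fromℕ 2 * D a) (λ a → N - 1ℚ) ⟩
      sum (λ a → fromℕ 2 * D a) - sum {n} (λ a → N - 1ℚ)
        ≡⟨ cong₂ _-_ (sum-*ˡ (fromℕ 2) D) (trans (sum-cong-≗ {n} λ _ → sym (ℚ.*-identityˡ (N - 1ℚ)))
              (trans (sum-*ʳ {n} (N - 1ℚ) (λ _ → 1ℚ)) (cong (_* (N - 1ℚ)) (sum-const n)))) ⟩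
      fromℕ 2 * Ω - N * (N - 1ℚ) ∎

  G⁺ : Graph n
  G⁺ = addEdge G u v u≢v

  module L⁺ = Laplacian G⁺

  -- The potential of a unit current from u to v in the tree, see `lap-φ`: it falls by 1 per edge
  -- along the u-v path, from ℓ/2 to -ℓ/2, and is constant on the branches.
  φ : Fin n → ℚ
  φ a = ½ * (r a v - r a u)

  φ-u : φ u ≡ ½ * ℓ
  φ-u = trans (cong (λ x → ½ * (r u v - x)) (r-diag u)) (cong (½ *_) (ℚ.+-identityʳ ℓ))

  φ-v : φ v ≡ - ½ * ℓ
  φ-v = trans (cong₂ (λ x y → ½ * (x - y)) (r-diag v) (r-sym v u)) (neg ℓ)
    where
    neg = solve 1 (λ x → con ½ :* (con 0ℚ :- x) := :- con ½ :* x) refl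

  -- The disjunction in `addEdge` becomes a sum because u and v were not adjacent before and are
  -- distinct.
  A⁺ : ∀ i j → adjacency G⁺ i j ≡ A i j + (δ i u * δ j v + δ i v * δ j u)
  A⁺ i j with i ≟ u | j ≟ v | j ≟ u | i ≟ v
  ... | yes refl | yes refl | yes v≡u  | _        = contradiction (sym v≡u) u≢v
  ... | yes refl | yes refl | _        | yes u≡v  = contradiction u≡v u≢v
  ... | yes refl | _        | _        | yes u≡v  = contradiction u≡v u≢v
  ... | _        | yes refl | yes v≡u  | _        = contradiction (sym v≡u) u≢v
  ... | yes refl | yes refl | no _     | no _     with adj G u v
  ...   | true  = contradiction tt nonadj
  ...   | false = refl
  A⁺ i j | yes refl | no _     | yes refl | no _  with adj G u u
  ...   | true  = refl
  ...   | false = refl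
  A⁺ i j | yes refl | no _     | no _     | no _  with adj G u j
  ...   | true  = refl
  ...   | false = refl
  A⁺ i j | no _     | yes refl | no _     | yes refl with adj G v v
  ...   | true  = refl
  ...   | false = refl
  A⁺ i j | no _     | yes refl | no _     | no _  with adj G i v
  ...   | true  = refl
  ...   | false = refl
  A⁺ i j | no _     | no _     | yes refl | yes refl with adj G v u in eq
  ...   | true  = contradiction (subst T (sym (trans (symm G u v) eq)) tt) nonadj
  ...   | false = refl
  A⁺ i j | no _     | no _     | yes refl | no _  with adj G i u
  ...   | true  = refl
  ...   | false = refl
  A⁺ i j | no _     | no _     | no _     | yes refl with adj G v j
  ...   | true  = refl
  ...   | false = refl
  A⁺ i j | no _     | no _     | no _     | no _  with adj G i j
  ...   | true  = refl
  ...   | false = refl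

  sum-A⁺ : ∀ i (f : Fin n → ℚ) → sum (λ j → adjacency G⁺ i j * f j) ≡ sum (λ j → A i j * f j) + (δ i u * f v + δ i v * f u)
  sum-A⁺ i f = begin
    sum (λ j → adjacency G⁺ i j * f j)
      ≡⟨ sum-cong-≗ (λ j → trans (cong (_* f j) (A⁺ i j)) (distrib (A i j) (δ i u) (δ j v) (δ i v) (δ j u) (f j))) ⟩
    sum (λ j → A i j * f j + (δ i u * (δ j v * f j) + δ i v * (δ j u * f j)))
      ≡⟨ ∑-distrib-+ {n} (λ j → A i j * f j) (λ j → δ i u * (δ j v * f j) + δ i v * (δ j u * f j)) ⟩
    sum (λ j → A i j * f j) + sum (λ j → δ i u * (δ j v * f j) + δ i v * (δ j u * f j))
      ≡⟨ cong (_+_ (sum (λ j → A i j * f j))) (trans (∑-distrib-+ {n} (λ j → δ i u * (δ j v * f j)) (λ j → δ i v * (δ j u * f j)))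
           (cong₂ _+_ (trans (sum-*ˡ (δ i u) (λ j → δ j v * f j)) (cong (δ i u *_) (sum-δ v f)))
                      (trans (sum-*ˡ (δ i v) (λ j → δ j u * f j)) (cong (δ i v *_) (sum-δ u f))))) ⟩
    sum (λ j → A i j * f j) + (δ i u * f v + δ i v * f u) ∎
    where
    open ≡-Reasoning
    distrib = solve 6 (λ a x y z w f → (a :+ (x :* y :+ z :* w)) :* f := a :* f :+ (x :* (y :* f) :+ z :* (w :* f))) refl

  d⁺ : ∀ i → L⁺.d i ≡ d i + (δ i u + δ i v)
  d⁺ i = trans (sum-cong-≗ λ j → sym (ℚ.*-identityʳ (adjacency G⁺ i j)))
    (trans (sum-A⁺ i (λ _ → 1ℚ))
      (cong₂ _+_ (sum-cong-≗ λ j → ℚ.*-identityʳ (A i j))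
        (cong₂ _+_ (ℚ.*-identityʳ (δ i u)) (ℚ.*-identityʳ (δ i v)))))

  lap⁺ : ∀ f i → L⁺.lap f i ≡ lap f i + (δ i u - δ i v) * (f u - f v)
  lap⁺ f i = trans (sum-A⁺ i (λ j → f i - f j)) (cong (_+_ (lap f i)) (trans
    (cong₂ _+_ (at u (λ x → x - f v)) (at v (λ x → x - f u)))
    (collect (δ i u) (δ i v) (f u) (f v))))
    where
    collect = solve 4 (λ x y fu fv → x :* (fu :- fv) :+ y :* (fv :- fu) := (x :- y) :* (fu :- fv)) refl
    at : ∀ k (g : ℚ → ℚ) → δ i k * g (f i) ≡ δ i k * g (f k)
    at k g with i ≟ k
    ... | yes refl = refl
    ... | no _     = trans (ℚ.*-zeroˡ (g (f i))) (sym (ℚ.*-zeroˡ (g (f k))))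

  0<c : 0ℚ < c
  0<c = ℚ.<-≤-trans 0<1 (≤-via (drop ℓ) (0≤fromℕ (ρ u v)))
    where
    drop = solve 1 (λ x → con 1ℚ :+ x :- con 1ℚ := x) refl

  c-inv : c * inv c ≡ 1ℚ
  c-inv = *-inv (>⇒≢ 0<c)

  lap-φ : ∀ j → lap φ j ≡ δ j u - δ j v
  lap-φ j = begin
    lap φ j
      ≡⟨ sum-cong-≗ (λ i → shape (A j i) (r j v) (r j u) (r i v) (r i u)) ⟩
    lap (λ i → ½ * r i v + - ½ * r i u) j
      ≡⟨ lap-linear ½ (- ½) (λ i → r i v) (λ i → r i u) j ⟩
    ½ * lap (λ i → r i v) j + - ½ * lap (λ i → r i u) j
      ≡⟨ cong₂ (λ x y → ½ * x + - ½ * y) (ρ-lap j v) (ρ-lap j u) ⟩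
    ½ * (fromℕ 2 - d j - fromℕ 2 * δ j v) + - ½ * (fromℕ 2 - d j - fromℕ 2 * δ j u)
      ≡⟨ final (d j) (δ j u) (δ j v) ⟩
    δ j u - δ j v ∎
    where
    open ≡-Reasoning
    shape = solve 5 (λ a x y x′ y′ →
      a :* (con ½ :* (x :- y) :- con ½ :* (x′ :- y′)) :=
      a :* (con ½ :* x :+ :- con ½ :* y :- (con ½ :* x′ :+ :- con ½ :* y′))) refl
    final = solve 3 (λ d e f → con ½ :* (# 2 :- d :- # 2 :* f) :+ :- con ½ :* (# 2 :- d :- # 2 :* e) := e :- f) refl

  -- Sherman–Morrison: the new edge is a rank-one perturbation of the Laplacian.
  r⁺ : Fin n → Fin n → ℚ
  r⁺ a b = r a b - inv c * ((φ a - φ b) * (φ a - φ b))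

  τ⁺ : Fin n → ℚ
  τ⁺ j = fromℕ 2 - d j - inv c * lap (λ i → φ i * φ i) j

  -- The new edge and the correction to r each contribute multiples of `φ k * ∂`. They cancel
  -- because the correction is scaled by the inverse of c = 1 + ℓ; the term with φ² is absorbed into
  -- `τ⁺`.
  laplace⁺ : ∀ j k → L⁺.lap (λ i → r⁺ i k) j ≡ τ⁺ j - fromℕ 2 * δ j k
  laplace⁺ j k = begin
    L⁺.lap (λ i → r⁺ i k) j
      ≡⟨ lap⁺ (λ i → r⁺ i k) j ⟩
    lap (λ i → r⁺ i k) j + ∂ * (r⁺ u k - r⁺ v k)
      ≡⟨ cong₂ (λ x y → x + ∂ * y) old jump ⟩
    (fromℕ 2 - d j - fromℕ 2 * δ j k + - ι * (Λ + - (fromℕ 2 * φ k) * ∂)) + ∂ * (- (fromℕ 2 * φ k) * (1ℚ - ι * ℓ))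
      ≡⟨ arrange (d j) (δ j k) ι Λ (φ k) ∂ ℓ ⟩
    τ⁺ j - fromℕ 2 * δ j k + fromℕ 2 * φ k * ∂ * (c * ι - 1ℚ)
      ≡⟨ cong (λ x → τ⁺ j - fromℕ 2 * δ j k + fromℕ 2 * φ k * ∂ * (x - 1ℚ)) c-inv ⟩
    τ⁺ j - fromℕ 2 * δ j k + fromℕ 2 * φ k * ∂ * (1ℚ - 1ℚ)
      ≡⟨ vanish (τ⁺ j - fromℕ 2 * δ j k) (fromℕ 2 * φ k * ∂) ⟩
    τ⁺ j - fromℕ 2 * δ j k ∎
    where
    open ≡-Reasoning
    ι = inv c
    ∂ = δ j u - δ j v
    Λ = lap (λ i → φ i * φ i) j
    vanish = solve 2 (λ x y → x :+ y :* (con 1ℚ :- con 1ℚ) := x) refl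
    arrange = solve 7 (λ d e ι Λ p ∂ ℓ →
      (# 2 :- d :- # 2 :* e :+ :- ι :* (Λ :+ :- (# 2 :* p) :* ∂)) :+ ∂ :* (:- (# 2 :* p) :* (con 1ℚ :- ι :* ℓ)) :=
      # 2 :- d :- ι :* Λ :- # 2 :* e :+ # 2 :* p :* ∂ :* ((con 1ℚ :+ ℓ) :* ι :- con 1ℚ)) refl
    old : lap (λ i → r⁺ i k) j ≡ fromℕ 2 - d j - fromℕ 2 * δ j k + - ι * (Λ + - (fromℕ 2 * φ k) * ∂)
    old = begin
      lap (λ i → r⁺ i k) j
        ≡⟨ sum-cong-≗ (λ i → shape (A j i) (r j k) (r i k) ι (φ j) (φ i) (φ k)) ⟩
      lap (λ i → 1ℚ * r i k + - ι * (1ℚ * (φ i * φ i) + - (fromℕ 2 * φ k) * φ i)) j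
        ≡⟨ lap-linear 1ℚ (- ι) (λ i → r i k) (λ i → 1ℚ * (φ i * φ i) + - (fromℕ 2 * φ k) * φ i) j ⟩
      1ℚ * lap (λ i → r i k) j + - ι * lap (λ i → 1ℚ * (φ i * φ i) + - (fromℕ 2 * φ k) * φ i) j
        ≡⟨ cong₂ (λ x y → x + - ι * y) (trans (ℚ.*-identityˡ _) (ρ-lap j k))
             (trans (lap-linear 1ℚ (- (fromℕ 2 * φ k)) (λ i → φ i * φ i) φ j)
               (cong₂ (λ x y → x + - (fromℕ 2 * φ k) * y) (ℚ.*-identityˡ Λ) (lap-φ j))) ⟩
      fromℕ 2 - d j - fromℕ 2 * δ j k + - ι * (Λ + - (fromℕ 2 * φ k) * ∂) ∎
      where
      shape = solve 7 (λ a x x′ ι p q w →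
        a :* (x :- ι :* ((p :- w) :* (p :- w)) :- (x′ :- ι :* ((q :- w) :* (q :- w)))) :=
        a :* (con 1ℚ :* x :+ :- ι :* (con 1ℚ :* (p :* p) :+ :- (# 2 :* w) :* p) :- (con 1ℚ :* x′ :+ :- ι :* (con 1ℚ :* (q :* q) :+ :- (# 2 :* w) :* q)))) refl
    jump : r⁺ u k - r⁺ v k ≡ - (fromℕ 2 * φ k) * (1ℚ - ι * ℓ)
    jump = trans (cong₂ (λ x y → r u k - ι * ((x - φ k) * (x - φ k)) - (r v k - ι * ((y - φ k) * (y - φ k)))) φ-u φ-v)
      (trans (shape (r u k) (r v k) ι ℓ (φ k)) (trans
        (cong (λ x → x + - (fromℕ 2 * φ k) * (- (ι * ℓ))) (trans (cong₂ _-_ (r-sym u k) (r-sym v k)) (flip (r k u) (r k v))))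
        (collect (φ k) (ι * ℓ))))
      where
      shape = solve 5 (λ x y ι ℓ p →
        x :- ι :* ((con ½ :* ℓ :- p) :* (con ½ :* ℓ :- p)) :- (y :- ι :* ((:- con ½ :* ℓ :- p) :* (:- con ½ :* ℓ :- p))) :=
        x :- y :+ :- (# 2 :* p) :* (:- (ι :* ℓ))) refl
      flip = solve 2 (λ x y → x :- y := :- (# 2 :* (con ½ :* (y :- x)))) refl
      collect = solve 2 (λ p y → :- (# 2 :* p) :+ :- (# 2 :* p) :* (:- y) := :- (# 2 :* p) :* (con 1ℚ :- y)) refl

  cycleResistance : Resistance G⁺
  cycleResistance = record
    { r = r⁺
    ; r-sym = λ a b → cong₂ (λ x y → x - inv c * y) (r-sym a b) (sq (φ a) (φ b))
    ; r-diag = λ a → trans (cong (λ x → x - inv c * ((φ a - φ a) * (φ a - φ a))) (r-diag a)) (zero-form (inv c) (φ a))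
    ; τ = τ⁺
    ; laplace = laplace⁺
    ; degree≢0 = λ j e → degree≢0 j (ℚ.≤-antisym
        (ℚ.≤-trans (≤-via (drop (d j) (δ j u + δ j v)) (0≤-+ (0≤δ j u) (0≤δ j v)))
          (ℚ.≤-reflexive (trans (sym (d⁺ j)) e)))
        (0≤d j))
    }
    where
    sq = solve 2 (λ x y → (x :- y) :* (x :- y) := (y :- x) :* (y :- x)) refl
    zero-form = solve 2 (λ i x → con 0ℚ :- i :* ((x :- x) :* (x :- x)) := con 0ℚ) refl
    drop = solve 2 (λ x y → x :+ y :- x := y) refl

  s⁺ : Fin n → ℚ
  s⁺ = Hitting.s cycleResistance

  W⁺ 𝒦⁺ : ℚ
  W⁺ = Hitting.W cycleResistance
  𝒦⁺ = Hitting.kemeny cycleResistance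

  sum-d⁺ : ∀ f → sum (λ a → L⁺.d a * f a) ≡ sum (λ a → d a * f a) + (f u + f v)
  sum-d⁺ f = begin
    sum (λ a → L⁺.d a * f a)
      ≡⟨ sum-cong-≗ (λ a → trans (cong (_* f a) (d⁺ a)) (distrib (d a) (δ a u) (δ a v) (f a))) ⟩
    sum (λ a → d a * f a + (δ a u * f a + δ a v * f a))
      ≡⟨ ∑-distrib-+ {n} (λ a → d a * f a) (λ a → δ a u * f a + δ a v * f a) ⟩
    sum (λ a → d a * f a) + sum (λ a → δ a u * f a + δ a v * f a)
      ≡⟨ cong (_+_ (sum (λ a → d a * f a))) (trans (∑-distrib-+ {n} (λ a → δ a u * f a) (λ a → δ a v * f a))
           (cong₂ _+_ (sum-δ u f) (sum-δ v f))) ⟩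
    sum (λ a → d a * f a) + (f u + f v) ∎
    where
    open ≡-Reasoning
    distrib = solve 4 (λ d x y f → (d :+ (x :+ y)) :* f := d :* f :+ (x :* f :+ y :* f)) refl

  sum-d⁺-one : sum L⁺.d ≡ fromℕ 2 * N
  sum-d⁺-one = begin
    sum L⁺.d                          ≡⟨ sum-cong-≗ (λ a → sym (ℚ.*-identityʳ (L⁺.d a))) ⟩
    sum (λ a → L⁺.d a * 1ℚ)           ≡⟨ sum-d⁺ (λ _ → 1ℚ) ⟩
    sum (λ a → d a * 1ℚ) + fromℕ 2    ≡⟨ cong (_+ fromℕ 2) (trans (sum-cong-≗ λ a → ℚ.*-identityʳ (d a)) sum-d) ⟩
    fromℕ 2 * N - fromℕ 2 + fromℕ 2   ≡⟨ back (fromℕ 2 * N) (fromℕ 2) ⟩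
    fromℕ 2 * N                       ∎
    where
    open ≡-Reasoning
    back = solve 2 (λ x y → x :- y :+ y := x) refl

  -- If f varies only along the u–v path then Σ f L(r(·,u) + r(·,v)) vanishes,
  -- since r(·,u) + r(·,v) is constant there.
  sum-d⁺-path : ∀ f → (∀ a b → Adj G a b → (r a u + r a v - (r b u + r b v)) * (f a - f b) ≡ 0ℚ) →
                sum (λ a → L⁺.d a * f a) ≡ fromℕ 2 * sum f
  sum-d⁺-path f flat = begin
    sum (λ a → L⁺.d a * f a)
      ≡⟨ sum-d⁺ f ⟩
    S + (f u + f v)
      ≡⟨ move S (f u) (f v) (sum f) ⟩
    fromℕ 2 * sum f - ½ * ((fromℕ 2 * sum f - S - fromℕ 2 * f u) + (fromℕ 2 * sum f - S - fromℕ 2 * f v))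
      ≡⟨ cong (λ x → fromℕ 2 * sum f - ½ * x) both ⟩
    fromℕ 2 * sum f - ½ * 0ℚ
      ≡⟨ simp (sum f) ⟩
    fromℕ 2 * sum f ∎
    where
    open ≡-Reasoning
    S = sum λ a → d a * f a
    Lu = λ a → lap (λ b → r b u) a
    Lv = λ a → lap (λ b → r b v) a
    move = solve 4 (λ S fu fv F →
      S :+ (fu :+ fv) :=
      # 2 :* F :- con ½ :* ((# 2 :* F :- S :- # 2 :* fu) :+ (# 2 :* F :- S :- # 2 :* fv))) refl
    simp = solve 1 (λ F → # 2 :* F :- con ½ :* con 0ℚ := # 2 :* F) refl
    both : (fromℕ 2 * sum f - S - fromℕ 2 * f u) + (fromℕ 2 * sum f - S - fromℕ 2 * f v) ≡ 0ℚ
    both = begin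
      (fromℕ 2 * sum f - S - fromℕ 2 * f u) + (fromℕ 2 * sum f - S - fromℕ 2 * f v)
        ≡⟨ cong₂ _+_ (sym (sum-lap u f)) (sym (sum-lap v f)) ⟩
      sum (λ a → f a * Lu a) + sum (λ a → f a * Lv a)
        ≡⟨ sym (∑-distrib-+ {n} (λ a → f a * Lu a) (λ a → f a * Lv a)) ⟩
      sum (λ a → f a * Lu a + f a * Lv a)
        ≡⟨ sum-cong-≗ (λ a → trans (factor (f a) (Lu a) (Lv a)) (cong (f a *_) (trans
             (sym (lap-linear 1ℚ 1ℚ (λ b → r b u) (λ b → r b v) a))
             (sum-cong-≗ λ b → unit (A a b) (r a u) (r a v) (r b u) (r b v))))) ⟩
      sum (λ a → f a * lap (λ b → r b u + r b v) a)
        ≡⟨ halve (sum (λ a → f a * lap (λ b → r b u + r b v) a)) ⟩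
      ½ * (fromℕ 2 * sum (λ a → f a * lap (λ b → r b u + r b v) a))
        ≡⟨ cong (½ *_) (trans (green (λ b → r b u + r b v) f) (energy-zero (λ b → r b u + r b v) f flat)) ⟩
      0ℚ ∎
      where
      factor = solve 3 (λ f x y → f :* x :+ f :* y := f :* (con 1ℚ :* x :+ con 1ℚ :* y)) refl
      unit = solve 5 (λ a x y z w → a :* (con 1ℚ :* x :+ con 1ℚ :* y :- (con 1ℚ :* z :+ con 1ℚ :* w)) := a :* (x :+ y :- (z :+ w))) refl
      halve = solve 1 (λ x → x := con ½ :* (# 2 :* x)) refl

  -- An edge changes either r(·,u) + r(·,v) or `φ`, never both: the product is half the difference
  -- of two squares that both equal 1.
  φ-flat : ∀ a b → Adj G a b → (r a u + r a v - (r b u + r b v)) * (φ a - φ b) ≡ 0ℚ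
  φ-flat a b ab = trans (shape (r a u) (r a v) (r b u) (r b v))
    (cong₂ (λ x y → ½ * (x - y)) (r-edge v ab) (r-edge u ab))
    where
    shape = solve 4 (λ x y z w →
      (x :+ y :- (z :+ w)) :* (con ½ :* (y :- x) :- con ½ :* (w :- z)) :=
      con ½ :* ((y :- w) :* (y :- w) :- (x :- z) :* (x :- z))) refl

  φ²-flat : ∀ a b → Adj G a b → (r a u + r a v - (r b u + r b v)) * (φ a * φ a - φ b * φ b) ≡ 0ℚ
  φ²-flat a b ab = trans (shape (r a u + r a v - (r b u + r b v)) (φ a) (φ b))
    (trans (cong (_* (φ a + φ b)) (φ-flat a b ab)) (ℚ.*-zeroˡ (φ a + φ b)))
    where
    shape = solve 3 (λ y p q → y :* (p :* p :- q :* q) := y :* (p :- q) :* (p :+ q)) refl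

  Φ : ℚ
  Φ = sum λ a → sum λ b → (φ a - φ b) * (φ a - φ b)

  -- Passing from unit weights to the new degrees doubles all three moments in `weighted-spread`:
  -- the total, that of `φ` and that of `φ`².
  Φ⁺ : sum (λ a → sum λ b → L⁺.d a * L⁺.d b * ((φ a - φ b) * (φ a - φ b))) ≡ fromℕ 4 * Φ
  Φ⁺ = begin
    sum (λ a → sum λ b → L⁺.d a * L⁺.d b * ((φ a - φ b) * (φ a - φ b)))
      ≡⟨ weighted-spread L⁺.d φ ⟩
    fromℕ 2 * (sum L⁺.d * sum (λ a → L⁺.d a * (φ a * φ a)) - sum (λ a → L⁺.d a * φ a) * sum (λ a → L⁺.d a * φ a))
      ≡⟨ cong₂ (λ x y → fromℕ 2 * (x - y * y))
           (cong₂ _*_ sum-d⁺-one (sum-d⁺-path (λ a → φ a * φ a) φ²-flat)) (sum-d⁺-path φ φ-flat) ⟩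
    fromℕ 2 * (fromℕ 2 * N * (fromℕ 2 * s₂) - fromℕ 2 * s₁ * (fromℕ 2 * s₁))
      ≡⟨ arrange N s₁ s₂ ⟩
    fromℕ 4 * (fromℕ 2 * (N * s₂ - s₁ * s₁))
      ≡⟨ cong (fromℕ 4 *_) (sym plain) ⟩
    fromℕ 4 * Φ ∎
    where
    open ≡-Reasoning
    s₁ = sum φ
    s₂ = sum λ a → φ a * φ a
    arrange = solve 3 (λ N s₁ s₂ →
      # 2 :* (# 2 :* N :* (# 2 :* s₂) :- # 2 :* s₁ :* (# 2 :* s₁)) :=
      # 4 :* (# 2 :* (N :* s₂ :- s₁ :* s₁))) refl
    plain : Φ ≡ fromℕ 2 * (N * s₂ - s₁ * s₁)
    plain = begin
      Φ
        ≡⟨ sum-cong-≗ (λ a → sum-cong-≗ λ b → sym (ones ((φ a - φ b) * (φ a - φ b)))) ⟩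
      sum (λ a → sum λ b → 1ℚ * 1ℚ * ((φ a - φ b) * (φ a - φ b)))
        ≡⟨ weighted-spread {n} (λ _ → 1ℚ) φ ⟩
      fromℕ 2 * (sum {n} (λ _ → 1ℚ) * sum (λ a → 1ℚ * (φ a * φ a)) - sum (λ a → 1ℚ * φ a) * sum (λ a → 1ℚ * φ a))
        ≡⟨ cong₂ (λ x y → fromℕ 2 * (x - y * y))
             (cong₂ _*_ (sum-const n) (sum-cong-≗ λ a → ℚ.*-identityˡ (φ a * φ a))) (sum-cong-≗ λ a → ℚ.*-identityˡ (φ a)) ⟩
      fromℕ 2 * (N * s₂ - s₁ * s₁) ∎
      where
      ones = solve 1 (λ x → con 1ℚ :* con 1ℚ :* x := x) refl

  Y : ℚ
  Y = sum λ a → r a u + r a v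

  -- Degrees grow by 1 at u and at v only, which produces the terms in `Y`, N and `ℓ`. The rank-one
  -- term of `r⁺` is evaluated by `Φ⁺`.
  W-cycle : W⁺ ≡ Wᵀ + (fromℕ 4 * Y - fromℕ 4 * (N - 1ℚ) + fromℕ 2 * ℓ) - fromℕ 4 * (inv c * Φ)
  W-cycle = begin
    sum (λ k → L⁺.d k * s⁺ k)
      ≡⟨ sum-cong-≗ (λ k → trans (cong (L⁺.d k *_) (split k)) (distrib (L⁺.d k) (σ k) (inv c) (q k))) ⟩
    sum (λ k → L⁺.d k * σ k - inv c * (L⁺.d k * q k))
      ≡⟨ sum-minus {n} (λ k → L⁺.d k * σ k) (λ k → inv c * (L⁺.d k * q k)) ⟩
    sum (λ k → L⁺.d k * σ k) - sum (λ k → inv c * (L⁺.d k * q k))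
      ≡⟨ cong₂ _-_ first second ⟩
    (Wᵀ + (sᵀ u + sᵀ v) + (σ u + σ v)) - inv c * (fromℕ 4 * Φ)
      ≡⟨ cong₂ (λ x y → Wᵀ + (sᵀ u + sᵀ v) + (x + y) - inv c * (fromℕ 4 * Φ))
           (cong₂ (λ x y → sᵀ u + (x + y)) (r-diag u) (r-sym v u)) (cong (λ x → sᵀ v + (ℓ + x)) (r-diag v)) ⟩
    (Wᵀ + (sᵀ u + sᵀ v) + (sᵀ u + (0ℚ + ℓ) + (sᵀ v + (ℓ + 0ℚ)))) - inv c * (fromℕ 4 * Φ)
      ≡⟨ cong₂ (λ x y → (Wᵀ + (x + y) + (x + (0ℚ + ℓ) + (y + (ℓ + 0ℚ)))) - inv c * (fromℕ 4 * Φ)) (s-tree u) (s-tree v) ⟩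
    (Wᵀ + (fromℕ 2 * D u - (N - 1ℚ) + (fromℕ 2 * D v - (N - 1ℚ))) + (fromℕ 2 * D u - (N - 1ℚ) + (0ℚ + ℓ) + (fromℕ 2 * D v - (N - 1ℚ) + (ℓ + 0ℚ)))) - inv c * (fromℕ 4 * Φ)
      ≡⟨ arrange Wᵀ (D u) (D v) (N - 1ℚ) ℓ (inv c) Φ ⟩
    Wᵀ + (fromℕ 4 * (D u + D v) - fromℕ 4 * (N - 1ℚ) + fromℕ 2 * ℓ) - fromℕ 4 * (inv c * Φ)
      ≡⟨ cong (λ y → Wᵀ + (fromℕ 4 * y - fromℕ 4 * (N - 1ℚ) + fromℕ 2 * ℓ) - fromℕ 4 * (inv c * Φ))
           (sym (∑-distrib-+ {n} (λ a → r a u) (λ a → r a v))) ⟩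
    Wᵀ + (fromℕ 4 * Y - fromℕ 4 * (N - 1ℚ) + fromℕ 2 * ℓ) - fromℕ 4 * (inv c * Φ) ∎
    where
    open ≡-Reasoning
    σ q : Fin n → ℚ
    σ k = sᵀ k + (r u k + r v k)
    q k = sum λ z → L⁺.d z * ((φ z - φ k) * (φ z - φ k))
    distrib = solve 4 (λ d s i q → d :* (s :- i :* q) := d :* s :- i :* (d :* q)) refl
    arrange = solve 7 (λ W Du Dv m ℓ i Φ →
      (W :+ (# 2 :* Du :- m :+ (# 2 :* Dv :- m)) :+ (# 2 :* Du :- m :+ (con 0ℚ :+ ℓ) :+ (# 2 :* Dv :- m :+ (ℓ :+ con 0ℚ)))) :- i :* (# 4 :* Φ) :=
      W :+ (# 4 :* (Du :+ Dv) :- # 4 :* m :+ # 2 :* ℓ) :- # 4 :* (i :* Φ)) refl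
    split : ∀ k → s⁺ k ≡ σ k - inv c * q k
    split k = begin
      sum (λ z → L⁺.d z * r⁺ z k)
        ≡⟨ sum-cong-≗ (λ z → distrib (L⁺.d z) (r z k) (inv c) ((φ z - φ k) * (φ z - φ k))) ⟩
      sum (λ z → L⁺.d z * r z k - inv c * (L⁺.d z * ((φ z - φ k) * (φ z - φ k))))
        ≡⟨ sum-minus {n} (λ z → L⁺.d z * r z k) (λ z → inv c * (L⁺.d z * ((φ z - φ k) * (φ z - φ k)))) ⟩
      sum (λ z → L⁺.d z * r z k) - sum (λ z → inv c * (L⁺.d z * ((φ z - φ k) * (φ z - φ k))))
        ≡⟨ cong₂ _-_ (sum-d⁺ (λ z → r z k)) (sum-*ˡ (inv c) (λ z → L⁺.d z * ((φ z - φ k) * (φ z - φ k)))) ⟩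
      σ k - inv c * q k ∎
    first : sum (λ k → L⁺.d k * σ k) ≡ Wᵀ + (sᵀ u + sᵀ v) + (σ u + σ v)
    first = trans (sum-d⁺ σ) (cong (_+ (σ u + σ v)) (begin
      sum (λ k → d k * σ k)
        ≡⟨ sum-cong-≗ (λ k → distrib′ (d k) (sᵀ k) (r u k) (r v k)) ⟩
      sum (λ k → d k * sᵀ k + (d k * r u k + d k * r v k))
        ≡⟨ ∑-distrib-+ {n} (λ k → d k * sᵀ k) (λ k → d k * r u k + d k * r v k) ⟩
      Wᵀ + sum (λ k → d k * r u k + d k * r v k)
        ≡⟨ cong (_+_ Wᵀ) (trans (∑-distrib-+ {n} (λ k → d k * r u k) (λ k → d k * r v k))
             (cong₂ _+_ (sum-cong-≗ λ k → cong (d k *_) (r-sym u k)) (sum-cong-≗ λ k → cong (d k *_) (r-sym v k)))) ⟩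
      Wᵀ + (sᵀ u + sᵀ v) ∎))
      where
      distrib′ = solve 4 (λ d s x y → d :* (s :+ (x :+ y)) := d :* s :+ (d :* x :+ d :* y)) refl
    second : sum (λ k → inv c * (L⁺.d k * q k)) ≡ inv c * (fromℕ 4 * Φ)
    second = trans (sum-*ˡ (inv c) (λ k → L⁺.d k * q k)) (cong (inv c *_) (trans
      (sum-cong-≗ λ k → trans (sym (sum-*ˡ (L⁺.d k) (λ z → L⁺.d z * ((φ z - φ k) * (φ z - φ k)))))
        (sum-cong-≗ λ z → reorder (L⁺.d k) (L⁺.d z) (φ z) (φ k)))
      Φ⁺))
      where
      reorder = solve 4 (λ x y p q → x :* (y :* ((p :- q) :* (p :- q))) := x :* y :* ((q :- p) :* (q :- p))) refl

  0<N : 0ℚ < N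
  0<N = ℚ.<-≤-trans 0<1 (subst (1ℚ ≤_) (sum-const n) (term≤sum {n} {λ _ → 1ℚ} (λ _ → ℚ.<⇒≤ 0<1) u))

  0<N-1 : 0ℚ < N - 1ℚ
  0<N-1 = ℚ.*-cancelˡ-<-nonNeg (fromℕ 2) (subst (0ℚ <_) (trans sum-d (double N)) (Hitting.0<D treeResistance u))
    where
    double = solve 1 (λ N → # 2 :* N :- # 2 := # 2 :* (N :- con 1ℚ)) refl

  -- The outer factors clear the degree sums 2 N and 2 (N - 1), the ½ in `kemeny` and the 1/c in
  -- `r⁺`.
  kemeny-change : fromℕ 4 * (N * (N - 1ℚ)) * (c * (𝒦⁺ - 𝒦ᵀ)) ≡
    c * ((N - 1ℚ) * (fromℕ 4 * Y - fromℕ 4 * (N - 1ℚ) + fromℕ 2 * ℓ) - fromℕ 4 * Ω + fromℕ 2 * ((N - 1ℚ) * (fromℕ 2 * N - 1ℚ)))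
      - fromℕ 4 * ((N - 1ℚ) * Φ)
  kemeny-change = begin
    fromℕ 4 * (N * m) * (c * (½ * W⁺ * inv (sum L⁺.d) - ½ * Wᵀ * inv (sum d)))
      ≡⟨ cong₂ (λ x y → fromℕ 4 * (N * m) * (c * (½ * W⁺ * inv x - ½ * Wᵀ * inv y))) sum-d⁺-one (trans sum-d (double N)) ⟩
    fromℕ 4 * (N * m) * (c * (½ * W⁺ * i₁ - ½ * Wᵀ * i₂))
      ≡⟨ regroup N m c W⁺ Wᵀ i₁ i₂ ⟩
    c * (m * W⁺ * (fromℕ 2 * N * i₁) - N * Wᵀ * (fromℕ 2 * m * i₂))
      ≡⟨ cong₂ (λ x y → c * (m * W⁺ * x - N * Wᵀ * y)) (*-inv (>⇒≢ (0<-* {fromℕ 2} (ℚ.positive⁻¹ (fromℕ 2)) 0<N)))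
           (*-inv (>⇒≢ (0<-* {fromℕ 2} (ℚ.positive⁻¹ (fromℕ 2)) 0<N-1))) ⟩
    c * (m * W⁺ * 1ℚ - N * Wᵀ * 1ℚ)
      ≡⟨ cong (λ x → c * (m * x * 1ℚ - N * Wᵀ * 1ℚ)) W-cycle ⟩
    c * (m * (Wᵀ + X - fromℕ 4 * (inv c * Φ)) * 1ℚ - N * Wᵀ * 1ℚ)
      ≡⟨ extract N c Wᵀ X (inv c) Φ ⟩
    c * (m * X - Wᵀ) - fromℕ 4 * (m * Φ) * (c * inv c)
      ≡⟨ cong₂ (λ x y → c * (m * X - x) - fromℕ 4 * (m * Φ) * y) W-tree c-inv ⟩
    c * (m * X - (fromℕ 4 * Ω - fromℕ 2 * (N * m) - fromℕ 2 * (m * m))) - fromℕ 4 * (m * Φ) * 1ℚ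
      ≡⟨ final c N ℓ Y Ω Φ ⟩
    c * (m * (fromℕ 4 * Y - fromℕ 4 * m + fromℕ 2 * ℓ) - fromℕ 4 * Ω + fromℕ 2 * (m * (fromℕ 2 * N - 1ℚ))) - fromℕ 4 * (m * Φ) ∎
    where
    open ≡-Reasoning
    m = N - 1ℚ
    i₁ = inv (fromℕ 2 * N)
    i₂ = inv (fromℕ 2 * m)
    X = fromℕ 4 * Y - fromℕ 4 * m + fromℕ 2 * ℓ
    double = solve 1 (λ N → # 2 :* N :- # 2 := # 2 :* (N :- con 1ℚ)) refl
    regroup = solve 7 (λ N m c W⁺ W i₁ i₂ →
      # 4 :* (N :* m) :* (c :* (con ½ :* W⁺ :* i₁ :- con ½ :* W :* i₂)) :=
      c :* (m :* W⁺ :* (# 2 :* N :* i₁) :- N :* W :* (# 2 :* m :* i₂))) refl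
    extract = solve 6 (λ N c W X i Φ →
      c :* ((N :- con 1ℚ) :* (W :+ X :- # 4 :* (i :* Φ)) :* con 1ℚ :- N :* W :* con 1ℚ) :=
      c :* ((N :- con 1ℚ) :* X :- W) :- # 4 :* ((N :- con 1ℚ) :* Φ) :* (c :* i)) refl
    final = solve 6 (λ c N ℓ Y Ω Φ →
      c :* ((N :- con 1ℚ) :* (# 4 :* Y :- # 4 :* (N :- con 1ℚ) :+ # 2 :* ℓ) :- (# 4 :* Ω :- # 2 :* (N :* (N :- con 1ℚ)) :- # 2 :* ((N :- con 1ℚ) :* (N :- con 1ℚ)))) :- # 4 :* ((N :- con 1ℚ) :* Φ) :* con 1ℚ :=
      c :* ((N :- con 1ℚ) :* (# 4 :* Y :- # 4 :* (N :- con 1ℚ) :+ # 2 :* ℓ) :- # 4 :* Ω :+ # 2 :* ((N :- con 1ℚ) :* (# 2 :* N :- con 1ℚ))) :- # 4 :* ((N :- con 1ℚ) :* Φ)) refl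

  C : ℕ
  C = suc (ρ u v)

  m : ℚ
  m = N - 1ℚ

  0≤m : 0ℚ ≤ m
  0≤m = ℚ.<⇒≤ 0<N-1

  module K = Cost C (ρ u v) refl m

  -- Applied twice: to the projection onto the u-v path in an arbitrary tree and to `foot` in a
  -- broom. Both positions can be read off from `φ`.
  module _ (pos : Fin n → Fin C) (φ-pos : ∀ a → φ a ≡ ½ * ℓ - fromℕ (toℕ (pos a))) where

    p : Fin n → ℕ
    p a = toℕ (pos a)

    k : Fin C → ℚ
    k i = sum λ a → δ (pos a) i

    y : Fin n → ℚ
    y a = r a u + r a v

    Ψ total : ℚ
    Ψ = sum λ a → sum λ b → gap (p a) (p b)
    total = sum λ i → sum λ j → k i * k j * K.cost i j

    -- r a b ≤ roof a b for a ≢ b is the four-point condition; the term δ a b corrects the diagonal.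
    floored roof : Fin n → Fin n → ℚ
    floored a b = r b a + δ b a * (y a - ℓ)
    roof a b = ½ * (y a + y b) - ℓ + gap (p a) (p b)

    total≡ : total ≡ K.c * Ψ + m * Φ
    total≡ = begin
      total
        ≡⟨ sym (pushforward₂ pos K.cost) ⟩
      sum (λ a → sum λ b → K.c * gap (p a) (p b) + m * (gap (p a) (p b) * gap (p a) (p b)))
        ≡⟨ sum-cong-≗ (λ a → trans (∑-distrib-+ {n} (λ b → K.c * gap (p a) (p b)) (λ b → m * (gap (p a) (p b) * gap (p a) (p b))))
             (cong₂ _+_ (sum-*ˡ K.c (λ b → gap (p a) (p b)))
               (trans (sum-*ˡ m (λ b → gap (p a) (p b) * gap (p a) (p b))) (cong (m *_) (sum-cong-≗ λ b → square a b))))) ⟩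
      sum (λ a → K.c * sum (λ b → gap (p a) (p b)) + m * sum (λ b → (φ a - φ b) * (φ a - φ b)))
        ≡⟨ trans (∑-distrib-+ {n} (λ a → K.c * sum (λ b → gap (p a) (p b))) (λ a → m * sum (λ b → (φ a - φ b) * (φ a - φ b))))
             (cong₂ _+_ (sum-*ˡ K.c (λ a → sum (λ b → gap (p a) (p b)))) (sum-*ˡ m (λ a → sum (λ b → (φ a - φ b) * (φ a - φ b))))) ⟩
      K.c * Ψ + m * Φ ∎
      where
      open ≡-Reasoning
      shift = solve 3 (λ h x y → (x :- y) :* (x :- y) := (h :- x :- (h :- y)) :* (h :- x :- (h :- y))) refl
      square : ∀ a b → gap (p a) (p b) * gap (p a) (p b) ≡ (φ a - φ b) * (φ a - φ b)
      square a b = trans (gap-square (p a) (p b)) (trans (shift (½ * ℓ) (fromℕ (p a)) (fromℕ (p b)))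
        (cong₂ (λ x y → (x - y) * (x - y)) (sym (φ-pos a)) (sym (φ-pos b))))

    sum-floored : sum (λ a → sum (floored a)) ≡ Ω + (Y - N * ℓ)
    sum-floored = begin
      sum (λ a → sum (floored a))
        ≡⟨ sum-cong-≗ (λ a → trans (∑-distrib-+ {n} (λ b → r b a) (λ b → δ b a * (y a - ℓ))) (cong (_+_ (D a)) (sum-δ a (λ _ → y a - ℓ)))) ⟩
      sum (λ a → D a + (y a - ℓ))
        ≡⟨ trans (∑-distrib-+ {n} D (λ a → y a - ℓ)) (cong (_+_ Ω) (trans (sum-minus {n} y (λ _ → ℓ)) (cong (_-_ Y) (sum-constant n ℓ)))) ⟩
      Ω + (Y - N * ℓ) ∎
      where open ≡-Reasoning

    sum-roof : sum (λ a → sum (roof a)) ≡ N * (Y - N * ℓ) + Ψ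
    sum-roof = begin
      sum (λ a → sum (roof a))
        ≡⟨ sum-cong-≗ (λ a → trans (∑-distrib-+ {n} (λ b → ½ * (y a + y b) - ℓ) (λ b → gap (p a) (p b))) (cong (_+ sum (λ b → gap (p a) (p b))) (row a))) ⟩
      sum (λ a → N * ½ * y a + (½ * Y - N * ℓ) + sum (λ b → gap (p a) (p b)))
        ≡⟨ trans (∑-distrib-+ {n} (λ a → N * ½ * y a + (½ * Y - N * ℓ)) (λ a → sum (λ b → gap (p a) (p b))))
             (cong (_+ Ψ) (trans (∑-distrib-+ {n} (λ a → N * ½ * y a) (λ _ → ½ * Y - N * ℓ)) (cong₂ _+_ (sum-*ˡ (N * ½) y) (sum-constant n (½ * Y - N * ℓ))))) ⟩
      N * ½ * Y + N * (½ * Y - N * ℓ) + Ψ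
        ≡⟨ cong (_+ Ψ) (collect N Y ℓ) ⟩
      N * (Y - N * ℓ) + Ψ ∎
      where
      open ≡-Reasoning
      collect = solve 3 (λ N Y ℓ → N :* con ½ :* Y :+ N :* (con ½ :* Y :- N :* ℓ) := N :* (Y :- N :* ℓ)) refl
      split = solve 3 (λ x y ℓ → con ½ :* (x :+ y) :- ℓ := (con ½ :* x :- ℓ) :+ con ½ :* y) refl
      gather = solve 4 (λ N x ℓ Y → N :* (con ½ :* x :- ℓ) :+ con ½ :* Y := N :* con ½ :* x :+ (con ½ :* Y :- N :* ℓ)) refl
      row : ∀ a → sum (λ b → ½ * (y a + y b) - ℓ) ≡ N * ½ * y a + (½ * Y - N * ℓ)
      row a = trans (sum-cong-≗ λ b → split (y a) (y b) ℓ)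
        (trans (∑-distrib-+ {n} (λ _ → ½ * y a - ℓ) (λ b → ½ * y b))
          (trans (cong₂ _+_ (sum-constant n (½ * y a - ℓ)) (sum-*ˡ ½ y)) (gather N (y a) ℓ Y)))

    base : ℚ
    base = c * (m * (fromℕ 4 * (ℓ * N) - fromℕ 4 * m + fromℕ 2 * ℓ) + fromℕ 2 * (m * (fromℕ 2 * N - 1ℚ)))

    -- `Ω` and `Y` are eliminated in favour of `floored` and `roof`. All that the tree contributes
    -- beyond N, ℓ and the positions then sits in one difference, nonnegative by `floored≤roof` and
    -- zero for brooms by `roof≡floored`.
    change-slack : fromℕ 4 * (N * m) * (c * (𝒦⁺ - 𝒦ᵀ)) ≡
      base - fromℕ 4 * total + fromℕ 4 * c * (sum (λ a → sum (roof a)) - sum (λ a → sum (floored a)))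
    change-slack = trans kemeny-change (trans (arrange N ℓ Y Ω Φ Ψ)
      (cong₂ (λ x y → base - fromℕ 4 * x + fromℕ 4 * c * y) (sym total≡) (cong₂ _-_ (sym sum-roof) (sym sum-floored))))
      where
      arrange = solve 6 (λ N ℓ Y Ω Φ Ψ →
        (con 1ℚ :+ ℓ) :* ((N :- con 1ℚ) :* (# 4 :* Y :- # 4 :* (N :- con 1ℚ) :+ # 2 :* ℓ) :- # 4 :* Ω :+ # 2 :* ((N :- con 1ℚ) :* (# 2 :* N :- con 1ℚ))) :- # 4 :* ((N :- con 1ℚ) :* Φ) :=
        (con 1ℚ :+ ℓ) :* ((N :- con 1ℚ) :* (# 4 :* (ℓ :* N) :- # 4 :* (N :- con 1ℚ) :+ # 2 :* ℓ) :+ # 2 :* ((N :- con 1ℚ) :* (# 2 :* N :- con 1ℚ))) :- # 4 :* ((con 1ℚ :+ ℓ) :* Ψ :+ (N :- con 1ℚ) :* Φ) :+ # 4 :* (con 1ℚ :+ ℓ) :* (N :* (Y :- N :* ℓ) :+ Ψ :- (Ω :+ (Y :- N :* ℓ)))) refl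

  extremeCost : ℚ → ℚ → ℚ
  extremeCost X q = K.pathCost + fromℕ 2 * (X * K.endCost) + (K.c + m * K.L) * (K.L * (fromℕ 2 * q))

  -- Closed forms for all sums over the path turn the extreme value into the quartic. The parameter
  -- θ stays free: `lower` takes the parity of n - c, a broom the square of the difference of its
  -- leaf numbers.
  base-quartic : ∀ {base} → base ≡ c * (m * (fromℕ 4 * (ℓ * N) - fromℕ 4 * m + fromℕ 2 * ℓ) + fromℕ 2 * (m * (fromℕ 2 * N - 1ℚ))) →
    ∀ θ q → fromℕ 4 * q ≡ (N - c) * (N - c) - θ →
    fromℕ 3 * (base - fromℕ 4 * extremeCost (N - c) q) ≡ fromℕ 2 * quartic N c θ
  base-quartic {b} refl θ q 4q≡ = begin
    fromℕ 3 * (b - fromℕ 4 * extremeCost (N - c) q)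
      ≡⟨ regroup b K.pathCost (N - c) c K.S₁ m K.S₂ ℓ q ⟩
    fromℕ 3 * b - fromℕ 2 * (fromℕ 6 * K.pathCost) - fromℕ 4 * ((N - c) * (fromℕ 3 * (c * (fromℕ 2 * K.S₁)) + m * (fromℕ 6 * K.S₂)))
      - fromℕ 6 * ((c + m * ℓ) * (ℓ * (fromℕ 4 * q)))
      ≡⟨ cong₂ (λ x y → fromℕ 3 * b - fromℕ 2 * x - fromℕ 4 * ((N - c) * (fromℕ 3 * (c * (fromℕ 2 * K.S₁)) + m * (fromℕ 6 * K.S₂))) - fromℕ 6 * ((c + m * ℓ) * (ℓ * y))) K.6pathCost 4q≡ ⟩
    fromℕ 3 * b - fromℕ 2 * (c * (fromℕ 2 * (c * (c * c - 1ℚ))) + m * (c * c * (c * c - 1ℚ))) - fromℕ 4 * ((N - c) * (fromℕ 3 * (c * (fromℕ 2 * K.S₁)) + m * (fromℕ 6 * K.S₂)))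
      - fromℕ 6 * ((c + m * ℓ) * (ℓ * ((N - c) * (N - c) - θ)))
      ≡⟨ cong₂ (λ x y → fromℕ 3 * b - fromℕ 2 * (c * (fromℕ 2 * (c * (c * c - 1ℚ))) + m * (c * c * (c * c - 1ℚ))) - fromℕ 4 * ((N - c) * (fromℕ 3 * (c * x) + m * y)) - fromℕ 6 * ((c + m * ℓ) * (ℓ * ((N - c) * (N - c) - θ)))) K.2S₁ K.6S₂ ⟩
    fromℕ 3 * b - fromℕ 2 * (c * (fromℕ 2 * (c * (c * c - 1ℚ))) + m * (c * c * (c * c - 1ℚ))) - fromℕ 4 * ((N - c) * (fromℕ 3 * (c * (c * ℓ)) + m * (c * ℓ * (fromℕ 2 * ℓ + 1ℚ))))
      - fromℕ 6 * ((c + m * ℓ) * (ℓ * ((N - c) * (N - c) - θ)))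
      ≡⟨ final N ℓ θ ⟩
    fromℕ 2 * quartic N c θ ∎
    where
    open ≡-Reasoning
    regroup = solve 9 (λ b P X c S₁ m S₂ ℓ q →
      # 3 :* (b :- # 4 :* (P :+ # 2 :* (X :* (c :* S₁ :+ m :* S₂)) :+ (c :+ m :* ℓ) :* (ℓ :* (# 2 :* q)))) :=
      # 3 :* b :- # 2 :* (# 6 :* P) :- # 4 :* (X :* (# 3 :* (c :* (# 2 :* S₁)) :+ m :* (# 6 :* S₂))) :- # 6 :* ((c :+ m :* ℓ) :* (ℓ :* (# 4 :* q)))) refl
    final = solve 3 (λ N ℓ θ →
      let c = con 1ℚ :+ ℓ
          m = N :- con 1ℚ
      in # 3 :* (c :* (m :* (# 4 :* (ℓ :* N) :- # 4 :* m :+ # 2 :* ℓ) :+ # 2 :* (m :* (# 2 :* N :- con 1ℚ))))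
         :- # 2 :* (c :* (# 2 :* (c :* (c :* c :- con 1ℚ))) :+ m :* (c :* c :* (c :* c :- con 1ℚ)))
         :- # 4 :* ((N :- c) :* (# 3 :* (c :* (c :* ℓ)) :+ m :* (c :* ℓ :* (# 2 :* ℓ :+ con 1ℚ))))
         :- # 6 :* ((c :+ m :* ℓ) :* (ℓ :* ((N :- c) :* (N :- c) :- θ)))
         := # 2 :* :quartic N c θ) refl

  module _ (star : ∀ i j → Star (Adj G) i j) where

    ℓ′ : ℕ
    ℓ′ = ρ u v

    triangle : ∀ a b k → ρ a b ℕ.≤ ρ a k ℕ.+ ρ b k
    triangle a b k with fourPoint a b k k
    ... | inj₁ h = ℕ.≤-trans (ℕ.m≤m+n (ρ a b) (ρ k k)) h
    ... | inj₂ h = ℕ.≤-trans (ℕ.m≤m+n (ρ a b) (ρ k k)) h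

    -- Here `p` is the distance from u of the projection of `a` onto the u-v path, (r a u - r a v +
    -- ℓ) / 2, encoded without subtraction and halving. That such a `p` exists is a parity
    -- statement, proved by walking from u.
    Position : Fin n → ℕ → Set
    Position a p = ρ a u ℕ.+ ℓ′ ≡ ρ a v ℕ.+ (p ℕ.+ p)

    position-step : ∀ {a b p} → Adj G a b → Position a p → ∃ (Position b)
    position-step {a} {b} {p} ab e with ρ-adj u ab | ρ-adj v ab
    ... | inj₁ eu | inj₁ ev = p , ℕ.suc-injective (trans (sym (cong (ℕ._+ ℓ′) eu)) (trans e (cong (ℕ._+ (p ℕ.+ p)) ev)))
    ... | inj₂ eu | inj₂ ev = p , trans (cong (ℕ._+ ℓ′) eu) (trans (cong suc e) (sym (cong (ℕ._+ (p ℕ.+ p)) ev)))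
    ... | inj₂ eu | inj₁ ev = suc p , trans (cong (ℕ._+ ℓ′) eu) (trans (cong suc (trans e (cong (ℕ._+ (p ℕ.+ p)) ev)))
          (trans (sym (ℕ.+-suc (suc (ρ b v)) (p ℕ.+ p))) (trans (sym (ℕ.+-suc (ρ b v) (suc (p ℕ.+ p)))) (cong (λ x → ρ b v ℕ.+ suc x) (sym (ℕ.+-suc p p))))))
    -- Moving back from position 0 would contradict the triangle inequality for b, u and v.
    position-step {a} {b} {zero} ab e | inj₁ eu | inj₂ ev = contradiction (begin-strict
        ρ b v               ≤⟨ triangle b v u ⟩
        ρ b u ℕ.+ ρ v u     ≡⟨ cong (ρ b u ℕ.+_) (ρ-sym v u) ⟩
        ρ b u ℕ.+ ℓ′        <⟨ ℕ.n<1+n _ ⟩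
        suc (ρ b u) ℕ.+ ℓ′  ≡⟨ cong (ℕ._+ ℓ′) (sym eu) ⟩
        ρ a u ℕ.+ ℓ′        ≡⟨ trans e (ℕ.+-identityʳ _) ⟩
        ρ a v               <⟨ ℕ.n<1+n _ ⟩
        suc (ρ a v)         ≡⟨ sym ev ⟩
        ρ b v               ∎) (ℕ.<-irrefl refl)
      where open ℕ.≤-Reasoning
    position-step {a} {b} {suc p} ab e | inj₁ eu | inj₂ ev = p , ℕ.suc-injective (begin
        suc (ρ b u) ℕ.+ ℓ′             ≡⟨ cong (ℕ._+ ℓ′) (sym eu) ⟩
        ρ a u ℕ.+ ℓ′                   ≡⟨ e ⟩
        ρ a v ℕ.+ suc (p ℕ.+ suc p)    ≡⟨ cong (λ x → ρ a v ℕ.+ suc x) (ℕ.+-suc p p) ⟩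
        ρ a v ℕ.+ suc (suc (p ℕ.+ p))  ≡⟨ trans (ℕ.+-suc _ _) (cong suc (ℕ.+-suc _ _)) ⟩
        suc (suc (ρ a v) ℕ.+ (p ℕ.+ p)) ≡⟨ cong (λ x → suc (x ℕ.+ (p ℕ.+ p))) (sym ev) ⟩
        suc (ρ b v ℕ.+ (p ℕ.+ p))      ∎)
      where open ≡-Reasoning

    position-walk : ∀ {a b} → Star (Adj G) a b → ∃ (Position a) → ∃ (Position b)
    position-walk ε             e       = e
    position-walk (ab ◅ rest) (p , e) = position-walk rest (position-step {p = p} ab e)

    at-u : Position u 0
    at-u = trans (cong (ℕ._+ ℓ′) (ρ-diag u)) (sym (ℕ.+-identityʳ ℓ′))

    position : ∀ a → ∃ (Position a)
    position a = position-walk (star u a) (0 , at-u)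

    p₀ : Fin n → ℕ
    p₀ a = proj₁ (position a)

    halves-≤ : ∀ {x y} → x ℕ.+ x ℕ.≤ y ℕ.+ y → x ℕ.≤ y
    halves-≤ {x} {y} h with ℕ.≤-total x y
    ... | inj₁ x≤y = x≤y
    ... | inj₂ y≤x = ℕ.+-cancelˡ-≤ x x y (ℕ.≤-trans h (ℕ.+-monoˡ-≤ y y≤x))

    p₀≤ℓ : ∀ a → p₀ a ℕ.≤ ℓ′
    p₀≤ℓ a = halves-≤ (ℕ.+-cancelˡ-≤ (ρ a v) _ _ (begin
        ρ a v ℕ.+ (p₀ a ℕ.+ p₀ a)  ≡⟨ sym (proj₂ (position a)) ⟩
        ρ a u ℕ.+ ℓ′               ≤⟨ ℕ.+-monoˡ-≤ ℓ′ (triangle a u v) ⟩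
        ρ a v ℕ.+ ℓ′ ℕ.+ ℓ′        ≡⟨ ℕ.+-assoc (ρ a v) ℓ′ ℓ′ ⟩
        ρ a v ℕ.+ (ℓ′ ℕ.+ ℓ′)      ∎))
      where open ℕ.≤-Reasoning

    ρ-lipschitz : ∀ {a b} k → Adj G a b → ρ a k ℕ.≤ suc (ρ b k)
    ρ-lipschitz k ab with ρ-adj k ab
    ... | inj₁ e = ℕ.≤-reflexive e
    ... | inj₂ e = ℕ.≤-trans (ℕ.n≤1+n _) (ℕ.≤-trans (ℕ.≤-reflexive (sym e)) (ℕ.n≤1+n _))

    p₀-step : ∀ {a b} → Adj G a b → p₀ b ℕ.≤ suc (p₀ a)
    p₀-step {a} {b} ab = halves-≤ (ℕ.+-cancelˡ-≤ (ρ b v) _ _ (begin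
        ρ b v ℕ.+ (p₀ b ℕ.+ p₀ b)               ≡⟨ sym (proj₂ (position b)) ⟩
        ρ b u ℕ.+ ℓ′                            ≤⟨ ℕ.+-monoˡ-≤ ℓ′ (ρ-lipschitz u (Growth.Adj-sym G ab)) ⟩
        suc (ρ a u) ℕ.+ ℓ′                      ≡⟨ cong suc (proj₂ (position a)) ⟩
        suc (ρ a v ℕ.+ (p₀ a ℕ.+ p₀ a))         ≤⟨ s≤s (ℕ.+-monoˡ-≤ (p₀ a ℕ.+ p₀ a) (ρ-lipschitz v ab)) ⟩
        suc (suc (ρ b v) ℕ.+ (p₀ a ℕ.+ p₀ a))   ≡⟨ sym (trans (ℕ.+-suc (ρ b v) _) (cong suc (trans (cong (ρ b v ℕ.+_) (ℕ.+-suc (p₀ a) (p₀ a))) (ℕ.+-suc (ρ b v) _)))) ⟩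
        ρ b v ℕ.+ (suc (p₀ a) ℕ.+ suc (p₀ a))   ∎))
      where open ℕ.≤-Reasoning

    intermediate : ∀ {a b} i → Star (Adj G) a b → p₀ a ℕ.≤ i → i ℕ.≤ p₀ b → ∃ λ x → p₀ x ≡ i
    intermediate {a} i ε a≤i i≤a = a , ℕ.≤-antisym a≤i i≤a
    intermediate {a} i (ac ◅ rest) a≤i i≤b with ℕ.m≤n⇒m<n∨m≡n a≤i
    ... | inj₂ a≡i = a , a≡i
    ... | inj₁ a<i = intermediate i rest (ℕ.≤-trans (p₀-step ac) a<i) i≤b

    p₀-u : p₀ u ℕ.≤ 0
    p₀-u = halves-≤ (ℕ.+-cancelˡ-≤ ℓ′ _ _ (ℕ.≤-reflexive (trans (sym (proj₂ (position u))) at-u)))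

    p₀-v : ℓ′ ℕ.≤ p₀ v
    p₀-v = halves-≤ (ℕ.≤-reflexive (trans (cong (ℕ._+ ℓ′) (ρ-sym u v)) (trans (proj₂ (position v)) (cong (ℕ._+ (p₀ v ℕ.+ p₀ v)) (ρ-diag v)))))

    pos : Fin n → Fin C
    pos a = Fin.fromℕ< (s≤s (p₀≤ℓ a))

    toℕ-pos : ∀ a → toℕ (pos a) ≡ p₀ a
    toℕ-pos a = Fin.toℕ-fromℕ< (s≤s (p₀≤ℓ a))

    -- A discrete intermediate value argument: along a walk from u to v the position goes from 0 to
    -- ℓ and never rises by more than 1 at a step. Hence all weights are at least 1 and `extra` is
    -- nonnegative.
    pos-surjective : ∀ i → ∃ λ a → pos a ≡ i
    pos-surjective i with intermediate (toℕ i) (star u v) (ℕ.≤-trans p₀-u z≤n) (ℕ.≤-trans (ℕ.≤-pred (Fin.toℕ<n i)) p₀-v)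
    ... | a , e = a , Fin.toℕ-injective (trans (toℕ-pos a) e)

    φ-pos : ∀ a → φ a ≡ ½ * ℓ - fromℕ (toℕ (pos a))
    φ-pos a = begin
      ½ * (r a v - r a u)                         ≡⟨ move (r a v) (r a u) ℓ ⟩
      ½ * (r a v + ℓ - (r a u + ℓ))               ≡⟨ cong (λ x → ½ * (r a v + ℓ - x)) lifted ⟩
      ½ * (r a v + ℓ - (r a v + (q + q)))         ≡⟨ simp (r a v) ℓ q ⟩
      ½ * ℓ - q                                   ≡⟨ cong (λ x → ½ * ℓ - fromℕ x) (sym (toℕ-pos a)) ⟩
      ½ * ℓ - fromℕ (toℕ (pos a))                 ∎
      where
      open ≡-Reasoning
      q = fromℕ (p₀ a)
      move = solve 3 (λ x y l → con ½ :* (x :- y) := con ½ :* (x :+ l :- (y :+ l))) refl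
      simp = solve 3 (λ x l q → con ½ :* (x :+ l :- (x :+ (q :+ q))) := con ½ :* l :- q) refl
      lifted : r a u + ℓ ≡ r a v + (q + q)
      lifted = trans (sym (fromℕ-+ (ρ a u) ℓ′)) (trans (cong fromℕ (proj₂ (position a)))
        (trans (fromℕ-+ (ρ a v) (p₀ a ℕ.+ p₀ a)) (cong (_+_ (r a v)) (fromℕ-+ (p₀ a) (p₀ a)))))

    weight : Fin C → ℚ
    weight = k pos φ-pos

    extra : Fin C → ℚ
    extra i = weight i - 1ℚ

    0≤extra : ∀ i → 0ℚ ≤ extra i
    0≤extra i = ≤⇒0≤ (hit (pos-surjective i))
      where
      hit : (∃ λ a → pos a ≡ i) → 1ℚ ≤ weight i
      hit (a , pos-a≡i) = ℚ.≤-trans (ℚ.≤-reflexive (sym (trans (cong (λ j → δ j i) pos-a≡i) (δ-refl i))))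
        (term≤sum {f = λ b → δ (pos b) i} (λ b → 0≤δ (pos b) i) a)

    sum-extra : sum extra ≡ N - K.c
    sum-extra = trans (sum-minus {C} weight (λ _ → 1ℚ)) (cong₂ _-_
      (trans (sum-cong-≗ λ i → sym (ℚ.*-identityʳ (weight i))) (trans (sym (pushforward pos (λ _ → 1ℚ))) (sum-const n)))
      (trans (sum-const C) K.c≡))

    integral-extra : ∀ i → Integral (extra i)
    integral-extra i = integral-minus (integral-sum λ a → integral-δ (pos a) i) (+ 1 , refl)

    -- The weights minus 1 are nonnegative and sum to n - c.
    C≤n : C ℕ.≤ n
    C≤n = fromℕ-cancel-≤ {C} {n} (subst (_≤ N) (sym K.c≡) (0≤⇒≤ (subst (0ℚ ≤_) sum-extra (0≤-sum 0≤extra))))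

    spare : ℕ
    spare = n ℕ.∸ C

    spare≡ : fromℕ spare ≡ N - K.c
    spare≡ = trans (fromℕ-∸ C≤n) (cong (_-_ N) K.c≡)

    -- `q` is the product of the halves of `spare`, one rounded down and one rounded up: the leaf
    -- numbers of the balanced broom.
    θ q : ℚ
    θ = parityTerm spare
    q = inv (fromℕ 4) * (fromℕ spare * fromℕ spare - θ)

    4q≡ : fromℕ 4 * q ≡ (N - K.c) * (N - K.c) - θ
    4q≡ = trans (sym (ℚ.*-assoc (fromℕ 4) (inv (fromℕ 4)) (fromℕ spare * fromℕ spare - θ))) (trans (ℚ.*-identityˡ (fromℕ spare * fromℕ spare - θ))
      (cong (λ x → x * x - θ) spare≡))

    total≤ : total pos φ-pos ≤ extremeCost (N - K.c) q
    total≤ = subst₂ _≤_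
      (sum-cong-≗ λ i → sum-cong-≗ λ j → cong₂ (λ x y → x * y * K.cost i j) (restore (weight i)) (restore (weight j)))
      (cong (λ X → extremeCost X q) sum-extra)
      (K.weighted-cost≤ 0≤m extra 0≤extra integral-extra q λ {E} int →
        *-cancelˡ-≤ {r = fromℕ 4} (ℚ.positive⁻¹ (fromℕ 4)) (subst₂ _≤_
          (cong (λ x → fromℕ 4 * (E * (x - E))) (trans spare≡ (sym sum-extra)))
          (trans (cong (λ x → x * x - θ) spare≡) (sym 4q≡))
          (quarter-bound spare int)))
      where
      restore = solve 1 (λ w → con 1ℚ :+ (w :- con 1ℚ) := w) refl

    diff≤gap : ∀ x y → fromℕ x - fromℕ y ≤ gap x y
    diff≤gap x y = go (ℕ.≤-total x y)
      where
      flip = solve 2 (λ x y → con 0ℚ :- (x :- y) := y :- x) refl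
      go : x ℕ.≤ y ⊎ y ℕ.≤ x → fromℕ x - fromℕ y ≤ gap x y
      go (inj₁ x≤y) = ℚ.≤-trans (≤-via (flip (fromℕ x) (fromℕ y)) (≤⇒0≤ (fromℕ-mono-≤ {x} {y} x≤y))) (0≤gap x y)
      go (inj₂ y≤x) = ℚ.≤-reflexive (sym (trans (cong fromℕ (ℕ.m≤n⇒∣n-m∣≡n∸m y≤x)) (fromℕ-∸ y≤x)))

    -- In either alternative the right-hand side is half the sum of the four distances plus a
    -- difference of values of `φ`, that is, of positions, which is at most their gap.
    four-point-roof : ∀ a b → r b a + ℓ ≤ ½ * (r a u + r a v + (r b u + r b v)) + gap (toℕ (pos a)) (toℕ (pos b))
    four-point-roof a b = go (fourPoint b a u v)
      where
      pa pb : ℕ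
      pa = toℕ (pos a)
      pb = toℕ (pos b)
      half g : ℚ
      half = ½ * (r a u + r a v + (r b u + r b v))
      g = gap pa pb
      lift : ∀ x y → ρ b a ℕ.+ ℓ′ ℕ.≤ x ℕ.+ y → r b a + ℓ ≤ fromℕ x + fromℕ y
      lift x y h = subst₂ _≤_ (fromℕ-+ (ρ b a) ℓ′) (fromℕ-+ x y) (fromℕ-mono-≤ {ρ b a ℕ.+ ℓ′} {x ℕ.+ y} h)
      shape₁ = solve 4 (λ bu av au bv → bu :+ av := con ½ :* (au :+ av :+ (bu :+ bv)) :+ (con ½ :* (av :- au) :- con ½ :* (bv :- bu))) refl
      shape₂ = solve 4 (λ bu av au bv → bv :+ au := con ½ :* (au :+ av :+ (bu :+ bv)) :+ (con ½ :* (bv :- bu) :- con ½ :* (av :- au))) refl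
      cancel = solve 3 (λ h x y → h :- x :- (h :- y) := y :- x) refl
      φ-diff : ∀ a b → φ a - φ b ≡ fromℕ (toℕ (pos b)) - fromℕ (toℕ (pos a))
      φ-diff a b = trans (cong₂ _-_ (φ-pos a) (φ-pos b)) (cancel (½ * ℓ) (fromℕ (toℕ (pos a))) (fromℕ (toℕ (pos b))))
      go : (ρ b a ℕ.+ ℓ′ ℕ.≤ ρ b u ℕ.+ ρ a v) ⊎ (ρ b a ℕ.+ ℓ′ ℕ.≤ ρ b v ℕ.+ ρ a u) → r b a + ℓ ≤ half + g
      go (inj₁ h) = begin
        r b a + ℓ                      ≤⟨ lift (ρ b u) (ρ a v) h ⟩
        r b u + r a v                  ≡⟨ shape₁ (r b u) (r a v) (r a u) (r b v) ⟩
        half + (φ a - φ b)             ≡⟨ cong (_+_ half) (φ-diff a b) ⟩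
        half + (fromℕ pb - fromℕ pa)   ≤⟨ ℚ.+-monoʳ-≤ half (diff≤gap pb pa) ⟩
        half + gap pb pa               ≡⟨ cong (_+_ half) (gap-sym pb pa) ⟩
        half + g                       ∎
        where open ℚ.≤-Reasoning
      go (inj₂ h) = begin
        r b a + ℓ                      ≤⟨ lift (ρ b v) (ρ a u) h ⟩
        r b v + r a u                  ≡⟨ shape₂ (r b u) (r a v) (r a u) (r b v) ⟩
        half + (φ b - φ a)             ≡⟨ cong (_+_ half) (φ-diff b a) ⟩
        half + (fromℕ pa - fromℕ pb)   ≤⟨ ℚ.+-monoʳ-≤ half (diff≤gap pa pb) ⟩
        half + g                       ∎
        where open ℚ.≤-Reasoning

    floored≤roof : ∀ a b → floored pos φ-pos a b ≤ roof pos φ-pos a b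
    floored≤roof a b = go (b ≟ a)
      where
      half = ½ * (r a u + r a v + (r b u + r b v))
      g = gap (toℕ (pos a)) (toℕ (pos b))
      go : Dec (b ≡ a) → r b a + δ b a * (r a u + r a v - ℓ) ≤ half - ℓ + g
      go (yes refl) = ℚ.≤-reflexive (trans (cong₂ (λ x e → x + e * (r a u + r a v - ℓ)) (r-diag a) (δ-refl a))
          (trans (diag (r a u + r a v) ℓ) (cong (λ x → half - ℓ + fromℕ x) (sym (ℕ.∣n-n∣≡0 (toℕ (pos a)))))))
        where
        diag = solve 2 (λ y l → con 0ℚ :+ con 1ℚ :* (y :- l) := con ½ :* (y :+ y) :- l :+ con 0ℚ) refl
      go (no b≢a) = ≤-via (trans (cong (λ e → half - ℓ + g - (r b a + e * (r a u + r a v - ℓ))) (δ-≢ b≢a))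
          (off half ℓ g (r b a) (r a u + r a v - ℓ))) (≤⇒0≤ (four-point-roof a b))
        where
        off = solve 5 (λ h l g x y → h :- l :+ g :- (x :+ con 0ℚ :* y) := h :+ g :- (x :+ l)) refl

    lower : fromℕ 2 * quartic N K.c θ ≤ fromℕ 3 * (fromℕ 4 * (N * m) * (K.c * (𝒦⁺ - 𝒦ᵀ)))
    lower = subst₂ _≤_ (base-quartic {b} refl θ q 4q≡) (cong (fromℕ 3 *_) (sym (change-slack pos φ-pos)))
      (*-monoˡ-≤ {b - fromℕ 4 * extreme} {b - fromℕ 4 * t + fromℕ 4 * K.c * (Σroof - Σfloored)} (0≤fromℕ 3)
        (≤-via (shape b t extreme K.c Σroof Σfloored)
          (0≤-* (0≤fromℕ 4) (0≤-+ (≤⇒0≤ total≤) (0≤-* K.0≤c (≤⇒0≤ (sum-mono λ a → sum-mono λ b → floored≤roof a b)))))))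
      where
      b t extreme Σroof Σfloored : ℚ
      b = base pos φ-pos
      t = total pos φ-pos
      extreme = extremeCost (N - K.c) q
      Σroof = sum λ a → sum (roof pos φ-pos a)
      Σfloored = sum λ a → sum (floored pos φ-pos a)
      shape = solve 6 (λ b t e c x y → b :- # 4 :* t :+ # 4 :* c :* (x :- y) :- (b :- # 4 :* e) := # 4 :* (e :- t :+ c :* (x :- y))) refl

    change-lower : prefactor n * fParity n spare (+ C) ≤ 𝒦⁺ - 𝒦ᵀ
    change-lower = Prefactor.prefactor-≤ n 0<N 0<N-1 spare (ρ u v) (𝒦⁺ - 𝒦ᵀ)
      (subst₂ (λ z θ → fromℕ 2 * quartic N z θ ≤ fromℕ 3 * (fromℕ 4 * (N * m) * (z * (𝒦⁺ - 𝒦ᵀ))))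
        (sym (fromℕ-suc (ρ u v))) (parityTerm≡θ spare) lower)

-- Double brooms

sum-toℕ-+ : ∀ a b (f : ℕ → ℚ) → sum {a ℕ.+ b} (f ∘ toℕ) ≡ sum {a} (f ∘ toℕ) + sum {b} (λ i → f (a ℕ.+ toℕ i))
sum-toℕ-+ zero    b f = sym (ℚ.+-identityˡ (sum {b} (f ∘ toℕ)))
sum-toℕ-+ (suc a) b f = trans (cong (_+_ (f 0)) (sum-toℕ-+ a b (f ∘ suc)))
  (sym (ℚ.+-assoc (f 0) (sum {a} (f ∘ suc ∘ toℕ)) (sum {b} (λ i → f (suc (a ℕ.+ toℕ i))))))

δℕ : ℕ → ℕ → ℚ
δℕ s t with s ℕ.≟ t
... | yes _ = 1ℚ
... | no _  = 0ℚ

δ-toℕ : ∀ {n} (i j : Fin n) → δ i j ≡ δℕ (toℕ i) (toℕ j)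
δ-toℕ i j with i ≟ j | toℕ i ℕ.≟ toℕ j
... | yes _    | yes _ = refl
... | no _     | no _  = refl
... | yes refl | no ≢  = contradiction refl ≢
... | no i≢j   | yes e = contradiction (Fin.toℕ-injective e) i≢j

sum-δℕ : ∀ {n s} → s ℕ.< n → sum {n} (λ i → δℕ (toℕ i) s) ≡ 1ℚ
sum-δℕ {n} {s} s<n = trans (sum-cong-≗ {n} λ i → trans
    (cong (δℕ (toℕ i)) (sym (Fin.toℕ-fromℕ< s<n)))
    (trans (sym (δ-toℕ i (Fin.fromℕ< s<n))) (sym (ℚ.*-identityʳ (δ i (Fin.fromℕ< s<n))))))
  (sum-δ (Fin.fromℕ< s<n) (λ _ → 1ℚ))

∣suc-∣ : ∀ {b z} → b ℕ.≤ z → ℕ.∣ suc z - b ∣ ≡ suc ℕ.∣ z - b ∣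
∣suc-∣ {b} {z} b≤z = trans (ℕ.m≤n⇒∣n-m∣≡n∸m (ℕ.m≤n⇒m≤1+n b≤z))
  (trans (ℕ.+-∸-assoc 1 b≤z) (cong suc (sym (ℕ.m≤n⇒∣n-m∣≡n∸m b≤z))))

-- A path 0, …, ℓ with x leaves attached to the vertex 0 and y leaves attached to the vertex ℓ.
module Broom (ℓ x y : ℕ) (2≤ℓ : 2 ℕ.≤ ℓ) where

  n : ℕ
  n = suc ℓ ℕ.+ (x ℕ.+ y)

  -- Vertices are numbered along the path, then come the x leaves at 0, then the y leaves at ℓ.
  -- `foot` is the projection to the path and `leaf` the distance from it.
  foot leaf : ℕ → ℕ
  foot i with i ℕ.≤? ℓ
  ... | yes _ = i
  ... | no _  with i ℕ.<? suc ℓ ℕ.+ x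
  ...   | yes _ = 0
  ...   | no _  = ℓ
  leaf i with i ℕ.≤? ℓ
  ... | yes _ = 0
  ... | no _  = 1

  foot-path : ∀ {i} → i ℕ.≤ ℓ → foot i ≡ i
  foot-path {i} i≤ℓ with i ℕ.≤? ℓ
  ... | yes _  = refl
  ... | no i≰ℓ = contradiction i≤ℓ i≰ℓ

  leaf-path : ∀ {i} → i ℕ.≤ ℓ → leaf i ≡ 0
  leaf-path {i} i≤ℓ with i ℕ.≤? ℓ
  ... | yes _  = refl
  ... | no i≰ℓ = contradiction i≤ℓ i≰ℓ

  leaf-off : ∀ {i} → ¬ i ℕ.≤ ℓ → leaf i ≡ 1
  leaf-off {i} i≰ℓ with i ℕ.≤? ℓ
  ... | yes i≤ℓ = contradiction i≤ℓ i≰ℓ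
  ... | no _    = refl

  foot-left : ∀ {i} → i ℕ.< x → foot (suc ℓ ℕ.+ i) ≡ 0
  foot-left {i} i<x with suc ℓ ℕ.+ i ℕ.≤? ℓ
  ... | yes ≤ℓ = contradiction ≤ℓ (ℕ.<⇒≱ (ℕ.m≤m+n (suc ℓ) i))
  ... | no _   with suc ℓ ℕ.+ i ℕ.<? suc ℓ ℕ.+ x
  ...   | yes _ = refl
  ...   | no ≮  = contradiction (ℕ.+-monoʳ-< (suc ℓ) i<x) ≮

  foot-right : ∀ i → foot (suc ℓ ℕ.+ (x ℕ.+ i)) ≡ ℓ
  foot-right i with suc ℓ ℕ.+ (x ℕ.+ i) ℕ.≤? ℓ
  ... | yes ≤ℓ = contradiction ≤ℓ (ℕ.<⇒≱ (ℕ.m≤m+n (suc ℓ) (x ℕ.+ i)))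
  ... | no _   with suc ℓ ℕ.+ (x ℕ.+ i) ℕ.<? suc ℓ ℕ.+ x
  ...   | yes i< = contradiction i< (ℕ.≤⇒≯ (ℕ.+-monoʳ-≤ (suc ℓ) (ℕ.m≤m+n x i)))
  ...   | no _  = refl

  foot≤ℓ : ∀ i → foot i ℕ.≤ ℓ
  foot≤ℓ i with i ℕ.≤? ℓ
  ... | yes i≤ℓ = i≤ℓ
  ... | no _    with i ℕ.<? suc ℓ ℕ.+ x
  ...   | yes _ = z≤n
  ...   | no _  = ℕ.≤-refl

  r₀ : ℕ → ℕ → ℕ
  r₀ i j with i ℕ.≟ j
  ... | yes _ = 0
  ... | no _  = leaf i ℕ.+ leaf j ℕ.+ ℕ.∣ foot i - foot j ∣

  r₀-diag : ∀ i → r₀ i i ≡ 0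
  r₀-diag i with i ℕ.≟ i
  ... | yes _  = refl
  ... | no i≢i = contradiction refl i≢i

  r₀-≢ : ∀ {i j} → i ≢ j → r₀ i j ≡ leaf i ℕ.+ leaf j ℕ.+ ℕ.∣ foot i - foot j ∣
  r₀-≢ {i} {j} i≢j with i ℕ.≟ j
  ... | yes i≡j = contradiction i≡j i≢j
  ... | no _    = refl

  r₀-sym : ∀ i j → r₀ i j ≡ r₀ j i
  r₀-sym i j with i ℕ.≟ j
  ... | yes refl = sym (r₀-diag i)
  ... | no i≢j   = sym (trans (r₀-≢ (i≢j ∘ sym)) (cong₂ ℕ._+_ (ℕ.+-comm (leaf j) (leaf i)) (ℕ.∣-∣-comm (foot j) (foot i))))

  r₀-zero : ∀ i j → r₀ i j ≡ 0 → i ≡ j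
  r₀-zero i j e with i ℕ.≟ j
  ... | yes i≡j = i≡j
  ... | no i≢j  with i ℕ.≤? ℓ | j ℕ.≤? ℓ
  ...   | yes i≤ℓ | yes j≤ℓ = ℕ.∣m-n∣≡0⇒m≡n e

  r₀-path : ∀ {i} j → i ℕ.≤ ℓ → r₀ i j ≡ leaf j ℕ.+ ℕ.∣ i - foot j ∣
  r₀-path {i} j i≤ℓ with i ℕ.≟ j
  ... | yes refl = sym (cong₂ ℕ._+_ (leaf-path i≤ℓ) (trans (cong ℕ.∣ i -_∣ (foot-path i≤ℓ)) (ℕ.∣n-n∣≡0 i)))
  ... | no _     = cong₂ (λ a b → a ℕ.+ leaf j ℕ.+ ℕ.∣ b - foot j ∣) (leaf-path i≤ℓ) (foot-path i≤ℓ)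

  -- The neighbour to which a vertex is attached when the broom is grown in the order of the
  -- numbers.
  parent : ℕ → ℕ
  parent z with z ℕ.≤? ℓ
  ... | yes _ = ℕ.pred z
  ... | no _  = foot z

  parent≤ : ∀ z → parent (suc z) ℕ.≤ z
  parent≤ z with suc z ℕ.≤? ℓ
  ... | yes _ = ℕ.≤-refl
  ... | no z≰ = ℕ.≤-trans (foot≤ℓ (suc z)) (ℕ.≤-pred (ℕ.≰⇒> z≰))

  -- This is the recursion of `dist` at a new leaf, for the explicit formula `r₀`.
  r₀-parent : ∀ z {b} → b ℕ.≤ z → r₀ (suc z) b ≡ suc (r₀ (parent (suc z)) b)
  r₀-parent z {b} b≤z with suc z ℕ.≤? ℓ
  ... | yes z<ℓ = trans (r₀-path b z<ℓ) (trans
        (cong₂ (λ s t → s ℕ.+ ℕ.∣ suc z - t ∣) (leaf-path b≤ℓ) (foot-path b≤ℓ))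
        (trans (∣suc-∣ b≤z) (cong suc (sym (trans (r₀-path b z≤ℓ) (cong₂ (λ s t → s ℕ.+ ℕ.∣ z - t ∣) (leaf-path b≤ℓ) (foot-path b≤ℓ)))))))
    where
    z≤ℓ : z ℕ.≤ ℓ
    z≤ℓ = ℕ.≤-trans (ℕ.n≤1+n z) z<ℓ
    b≤ℓ : b ℕ.≤ ℓ
    b≤ℓ = ℕ.≤-trans b≤z z≤ℓ
  ... | no z≰ = trans (r₀-≢ (ℕ.<⇒≢ (s≤s b≤z) ∘ sym)) (trans
        (cong (λ s → s ℕ.+ leaf b ℕ.+ ℕ.∣ foot (suc z) - foot b ∣) (leaf-off z≰))
        (cong suc (sym (r₀-path b (foot≤ℓ (suc z))))))

  -- Edges are the pairs at formula distance 1. With `r₀-parent`, an earlier neighbour then has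
  -- distance 0 from the parent and is the parent.
  broom : Graph n
  broom = record
    { adj    = λ i j → r₀ (toℕ i) (toℕ j) ℕ.≡ᵇ 1
    ; symm   = λ i j → cong (ℕ._≡ᵇ 1) (r₀-sym (toℕ i) (toℕ j))
    ; irrefl = λ i → cong (ℕ._≡ᵇ 1) (r₀-diag (toℕ i))
    }

  open Growth broom

  initial : ∀ m → m ℕ.< n → List (Fin n)
  initial zero    m<n = Fin.fromℕ< m<n ∷ []
  initial (suc m) m<n = Fin.fromℕ< m<n ∷ initial m (ℕ.<-trans (ℕ.n<1+n m) m<n)

  initial⁻ : ∀ m m<n {q} → q ∈ initial m m<n → toℕ q ℕ.≤ m
  initial⁻ zero    m<n (here refl) = ℕ.≤-reflexive (Fin.toℕ-fromℕ< m<n)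
  initial⁻ (suc m) m<n (here refl) = ℕ.≤-reflexive (Fin.toℕ-fromℕ< m<n)
  initial⁻ (suc m) m<n (there q∈)  = ℕ.m≤n⇒m≤1+n (initial⁻ m _ q∈)

  initial⁺ : ∀ m m<n {q} → toℕ q ℕ.≤ m → q ∈ initial m m<n
  initial⁺ zero    m<n q≤m = here (Fin.toℕ-injective (trans (ℕ.n≤0⇒n≡0 q≤m) (sym (Fin.toℕ-fromℕ< m<n))))
  initial⁺ (suc m) m<n q≤m with ℕ.m≤n⇒m<n∨m≡n q≤m
  ... | inj₁ (s≤s q≤m′) = there (initial⁺ m _ q≤m′)
  ... | inj₂ q≡m        = here (Fin.toℕ-injective (trans q≡m (sym (Fin.toℕ-fromℕ< m<n))))

  module Vertex (m : ℕ) (m<n : suc m ℕ.< n) where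
    z p : Fin n
    z = Fin.fromℕ< m<n
    p = Fin.fromℕ< (ℕ.<-trans (s≤s (parent≤ m)) m<n)
    toℕ-z : toℕ z ≡ suc m
    toℕ-z = Fin.toℕ-fromℕ< m<n
    toℕ-p : toℕ p ≡ parent (suc m)
    toℕ-p = Fin.toℕ-fromℕ< (ℕ.<-trans (s≤s (parent≤ m)) m<n)
    below : m ℕ.< n
    below = ℕ.<-trans (ℕ.n<1+n m) m<n
    r₀-z : ∀ {q} → q ∈ initial m below → r₀ (toℕ z) (toℕ q) ≡ suc (r₀ (toℕ p) (toℕ q))
    r₀-z {q} q∈ = trans (cong (λ s → r₀ s (toℕ q)) toℕ-z)
      (trans (r₀-parent m (initial⁻ m below q∈)) (cong (λ s → suc (r₀ s (toℕ q))) (sym toℕ-p)))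
    z∉ : z ∉ initial m below
    z∉ z∈ = ℕ.<-irrefl refl (subst (ℕ._≤ m) toℕ-z (initial⁻ m below z∈))
    p∈ : p ∈ initial m below
    p∈ = initial⁺ m below (subst (ℕ._≤ m) (sym toℕ-p) (parent≤ m))
    zp : Adj broom z p
    zp = ℕ.≡⇒≡ᵇ (r₀ (toℕ z) (toℕ p)) 1 (trans (r₀-z p∈) (cong suc (r₀-diag (toℕ p))))
    only : ∀ {q} → q ∈ initial m below → Adj broom z q → q ≡ p
    only {q} q∈ zq = sym (Fin.toℕ-injective (r₀-zero (toℕ p) (toℕ q)
      (ℕ.suc-injective (trans (sym (r₀-z q∈)) (ℕ.≡ᵇ⇒≡ (r₀ (toℕ z) (toℕ q)) 1 zq)))))

  built : ∀ m m<n → Built (initial m m<n)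
  built zero    m<n = root _
  built (suc m) m<n = grow (built m below) z∉ p∈ zp only
    where open Vertex m m<n

  dist-r₀ : ∀ m m<n {a b} → a ∈ initial m m<n → b ∈ initial m m<n → dist (built m m<n) a b ≡ r₀ (toℕ a) (toℕ b)
  dist-r₀ zero    m<n (here refl) (here refl) = sym (r₀-diag (toℕ (Fin.fromℕ< m<n)))
  dist-r₀ (suc m) m<n = go
    where
    open Vertex m m<n
    open Step (built m below) z∉ p∈ zp only
    go : ∀ {a b} → a ∈ z ∷ initial m below → b ∈ z ∷ initial m below → dist B⁺ a b ≡ r₀ (toℕ a) (toℕ b)
    go (here refl) (here refl) = trans (dist-diag B⁺ z) (sym (r₀-diag (toℕ z)))
    go (here refl) (there b∈)  = trans (dist-new (∈⇒≢ b∈)) (trans (cong suc (dist-r₀ m below p∈ b∈)) (sym (r₀-z b∈)))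
    go {a} (there a∈) (here refl) = trans (dist-new′ (∈⇒≢ a∈)) (trans (cong suc (trans (dist-r₀ m below a∈ p∈) (r₀-sym (toℕ a) (toℕ p))))
      (trans (sym (r₀-z a∈)) (r₀-sym (toℕ z) (toℕ a))))
    go (there a∈)  (there b∈)  = trans (dist-old (∈⇒≢ a∈) (∈⇒≢ b∈)) (dist-r₀ m below a∈ b∈)

  whole : Built (initial (ℓ ℕ.+ (x ℕ.+ y)) ℕ.≤-refl)
  whole = built (ℓ ℕ.+ (x ℕ.+ y)) ℕ.≤-refl

  all∈ : ∀ i → i ∈ initial (ℓ ℕ.+ (x ℕ.+ y)) ℕ.≤-refl
  all∈ i = initial⁺ _ _ (ℕ.≤-pred (Fin.toℕ<n i))

  isTree : IsTree broom
  isTree = built-isTree broom zero whole all∈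

  metric : TreeMetric broom
  metric = treeMetric broom whole all∈

  open TreeMetric metric using (ρ)

  ρ-r₀ : ∀ a b → ρ a b ≡ r₀ (toℕ a) (toℕ b)
  ρ-r₀ a b = dist-r₀ _ _ (all∈ a) (all∈ b)

  ℓ<n : ℓ ℕ.< n
  ℓ<n = ℕ.m≤m+n (suc ℓ) (x ℕ.+ y)

  u v : Fin n
  u = zero
  v = Fin.fromℕ< ℓ<n

  toℕ-v : toℕ v ≡ ℓ
  toℕ-v = Fin.toℕ-fromℕ< ℓ<n

  ρ-u : ∀ a → ρ a u ≡ leaf (toℕ a) ℕ.+ foot (toℕ a)
  ρ-u a = trans (ρ-r₀ a u) (trans (r₀-sym (toℕ a) 0) (r₀-path (toℕ a) z≤n))

  ρ-v : ∀ a → ρ a v ≡ leaf (toℕ a) ℕ.+ (ℓ ℕ.∸ foot (toℕ a))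
  ρ-v a = trans (ρ-r₀ a v) (trans (r₀-sym (toℕ a) (toℕ v)) (trans (cong (λ s → r₀ s (toℕ a)) toℕ-v)
    (trans (r₀-path (toℕ a) ℕ.≤-refl) (cong (leaf (toℕ a) ℕ.+_) (ℕ.m≤n⇒∣n-m∣≡n∸m (foot≤ℓ (toℕ a)))))))

  ρ-uv : ρ u v ≡ ℓ
  ρ-uv = trans (ρ-v u) (cong₂ (λ s t → s ℕ.+ (ℓ ℕ.∸ t)) (leaf-path z≤n) (foot-path z≤n))

  u≢v : u ≢ v
  u≢v u≡v = contradiction (subst (2 ℕ.≤_) (trans (sym toℕ-v) (cong toℕ (sym u≡v))) 2≤ℓ) λ ()

  nonadj : ¬ Adj broom u v
  nonadj uv = contradiction (subst (2 ℕ.≤_) (trans (sym ρ-uv) (trans (ρ-r₀ u v) (ℕ.≡ᵇ⇒≡ (r₀ 0 (toℕ v)) 1 uv))) 2≤ℓ) λ { (s≤s ()) }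

  module B = Change broom metric u v u≢v nonadj
  open B using (r; φ)

  pos : Fin n → Fin B.C
  pos a = Fin.fromℕ< (s≤s (subst (foot (toℕ a) ℕ.≤_) (sym ρ-uv) (foot≤ℓ (toℕ a))))

  toℕ-pos : ∀ a → toℕ (pos a) ≡ foot (toℕ a)
  toℕ-pos a = Fin.toℕ-fromℕ< (s≤s (subst (foot (toℕ a) ℕ.≤_) (sym ρ-uv) (foot≤ℓ (toℕ a))))

  height at : Fin n → ℚ
  height a = fromℕ (leaf (toℕ a))
  at a = fromℕ (toℕ (pos a))

  r-u : ∀ a → r a u ≡ height a + at a
  r-u a = trans (cong fromℕ (ρ-u a)) (trans (fromℕ-+ (leaf (toℕ a)) (foot (toℕ a)))
    (cong (λ t → height a + fromℕ t) (sym (toℕ-pos a))))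

  r-v : ∀ a → r a v ≡ height a + (B.ℓ - at a)
  r-v a = trans (cong fromℕ (ρ-v a)) (trans (fromℕ-+ (leaf (toℕ a)) (ℓ ℕ.∸ foot (toℕ a)))
    (cong (_+_ (height a)) (trans (fromℕ-∸ (foot≤ℓ (toℕ a)))
      (cong₂ (λ s t → fromℕ s - fromℕ t) (sym ρ-uv) (sym (toℕ-pos a))))))

  r-off : ∀ {a b} → a ≢ b → r b a ≡ height a + height b + gap (toℕ (pos a)) (toℕ (pos b))
  r-off {a} {b} a≢b = begin
    r b a                                                       ≡⟨ cong fromℕ (trans (TreeMetric.ρ-sym metric b a) (trans (ρ-r₀ a b) (r₀-≢ (a≢b ∘ Fin.toℕ-injective)))) ⟩
    fromℕ (leaf i ℕ.+ leaf j ℕ.+ ℕ.∣ foot i - foot j ∣)         ≡⟨ fromℕ-+ (leaf i ℕ.+ leaf j) ℕ.∣ foot i - foot j ∣ ⟩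
    fromℕ (leaf i ℕ.+ leaf j) + gap (foot i) (foot j)           ≡⟨ cong₂ _+_ (fromℕ-+ (leaf i) (leaf j)) (cong₂ gap (sym (toℕ-pos a)) (sym (toℕ-pos b))) ⟩
    height a + height b + gap (toℕ (pos a)) (toℕ (pos b))       ∎
    where
    open ≡-Reasoning
    i = toℕ a
    j = toℕ b

  φ-pos : ∀ a → φ a ≡ ½ * B.ℓ - at a
  φ-pos a = trans (cong₂ (λ s t → ½ * (s - t)) (r-v a) (r-u a)) (simp (height a) B.ℓ (at a))
    where
    simp = solve 3 (λ h l p → con ½ :* (h :+ (l :- p) :- (h :+ p)) := con ½ :* l :- p) refl

  path-sum : ∀ a → r a u + r a v ≡ fromℕ 2 * height a + B.ℓ
  path-sum a = trans (cong₂ _+_ (r-u a) (r-v a)) (simp (height a) B.ℓ (at a))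
    where
    simp = solve 3 (λ h l p → h :+ p :+ (h :+ (l :- p)) := # 2 :* h :+ l) refl

  -- Two distinct vertices are joined through their feet, so the four-point bound is exact; deeper
  -- branches would allow shortcuts. On the diagonal, `y a - ℓ` is twice the height.
  roof≡floored : ∀ a b → B.roof pos φ-pos a b ≡ B.floored pos φ-pos a b
  roof≡floored a b = trans (cong₂ (λ s t → ½ * (s + t) - B.ℓ + g) (path-sum a) (path-sum b))
    (trans (go (a ≟ b)) (cong (λ s → r b a + δ b a * (s - B.ℓ)) (sym (path-sum a))))
    where
    g = gap (toℕ (pos a)) (toℕ (pos b))
    go : Dec (a ≡ b) → ½ * (fromℕ 2 * height a + B.ℓ + (fromℕ 2 * height b + B.ℓ)) - B.ℓ + g
                     ≡ r b a + δ b a * (fromℕ 2 * height a + B.ℓ - B.ℓ)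
    go (yes refl) = trans (cong (λ t → ½ * (fromℕ 2 * height a + B.ℓ + (fromℕ 2 * height a + B.ℓ)) - B.ℓ + fromℕ t) (ℕ.∣n-n∣≡0 (toℕ (pos a))))
      (trans (diag (height a) B.ℓ) (cong₂ (λ s e → s + e * (fromℕ 2 * height a + B.ℓ - B.ℓ)) (sym (B.r-diag a)) (sym (δ-refl a))))
      where
      diag = solve 2 (λ h l → con ½ :* (# 2 :* h :+ l :+ (# 2 :* h :+ l)) :- l :+ con 0ℚ := con 0ℚ :+ con 1ℚ :* (# 2 :* h :+ l :- l)) refl
    go (no a≢b) = trans (off (height a) (height b) B.ℓ g) (cong₂ (λ s e → s + e * (fromℕ 2 * height a + B.ℓ - B.ℓ))
      (sym (r-off a≢b)) (sym (δ-≢ (a≢b ∘ sym))))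
      where
      off = solve 4 (λ h k l g →
        con ½ :* (# 2 :* h :+ l :+ (# 2 :* k :+ l)) :- l :+ g :=
        h :+ k :+ g :+ con 0ℚ :* (# 2 :* h :+ l :- l)) refl

  X Y : ℚ
  X = fromℕ x
  Y = fromℕ y

  o z : Fin B.C
  o = zero
  z = Fin.fromℕ< (ℕ.n<1+n (ρ u v))

  toℕ-z : toℕ z ≡ ρ u v
  toℕ-z = Fin.toℕ-fromℕ< (ℕ.n<1+n (ρ u v))

  weight≡ : ∀ i → B.k pos φ-pos i ≡ 1ℚ + B.K.ends o z refl toℕ-z X Y i
  weight≡ i = begin
    sum (λ a → δ (pos a) i)
      ≡⟨ sum-cong-≗ {n} (λ a → trans (δ-toℕ (pos a) i) (cong (λ s → δℕ s t) (toℕ-pos a))) ⟩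
    sum {n} (λ a → δℕ (foot (toℕ a)) t)
      ≡⟨ sum-toℕ-+ (suc ℓ) (x ℕ.+ y) (λ a → δℕ (foot a) t) ⟩
    sum {suc ℓ} (λ a → δℕ (foot (toℕ a)) t) + sum {x ℕ.+ y} (λ a → δℕ (foot (suc ℓ ℕ.+ toℕ a)) t)
      ≡⟨ cong₂ _+_ onPath (trans (sum-toℕ-+ x y (λ a → δℕ (foot (suc ℓ ℕ.+ a)) t)) (cong₂ _+_ onLeft onRight)) ⟩
    1ℚ + (X * δℕ t 0 + Y * δℕ t ℓ)
      ≡⟨ cong₂ (λ d e → 1ℚ + (X * d + Y * e)) (sym (δ-toℕ i o)) (trans (cong (δℕ t) (sym (trans toℕ-z ρ-uv))) (sym (δ-toℕ i z))) ⟩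
    1ℚ + (X * δ i o + Y * δ i z) ∎
    where
    open ≡-Reasoning
    t = toℕ i
    δℕ-sym : ∀ s t → δℕ s t ≡ δℕ t s
    δℕ-sym s t with s ℕ.≟ t | t ℕ.≟ s
    ... | yes _ | yes _ = refl
    ... | no _  | no _  = refl
    ... | yes e | no ≢  = contradiction (sym e) ≢
    ... | no ≢  | yes e = contradiction (sym e) ≢
    t< : t ℕ.< suc ℓ
    t< = subst (λ s → t ℕ.< suc s) ρ-uv (Fin.toℕ<n i)
    onPath : sum {suc ℓ} (λ a → δℕ (foot (toℕ a)) t) ≡ 1ℚ
    onPath = trans (sum-cong-≗ {suc ℓ} λ a → cong (λ s → δℕ s t) (foot-path (ℕ.≤-pred (Fin.toℕ<n a)))) (sum-δℕ t<)
    onLeft : sum {x} (λ a → δℕ (foot (suc ℓ ℕ.+ toℕ a)) t) ≡ X * δℕ t 0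
    onLeft = trans (sum-cong-≗ {x} λ a → trans (cong (λ s → δℕ s t) (foot-left (Fin.toℕ<n a))) (δℕ-sym 0 t)) (sum-constant x (δℕ t 0))
    onRight : sum {y} (λ a → δℕ (foot (suc ℓ ℕ.+ (x ℕ.+ toℕ a))) t) ≡ Y * δℕ t ℓ
    onRight = trans (sum-cong-≗ {y} λ a → trans (cong (λ s → δℕ s t) (foot-right (toℕ a))) (δℕ-sym ℓ t)) (sum-constant y (δℕ t ℓ))

  N-c : B.N - B.K.c ≡ X + Y
  N-c = trans (cong₂ _-_ (trans (fromℕ-+ (suc ℓ) (x ℕ.+ y)) (cong₂ _+_ (cong (fromℕ ∘ suc) (sym ρ-uv)) (fromℕ-+ x y))) refl)
    (trans (cong (λ s → s + (X + Y) - B.K.c) (fromℕ-suc (ρ u v))) (cancel B.K.c (X + Y)))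
    where
    cancel = solve 2 (λ c s → c :+ s :- c := s) refl

  total≡ : B.total pos φ-pos ≡ B.extremeCost (B.N - B.K.c) (X * Y)
  total≡ = trans (sum-cong-≗ λ i → sum-cong-≗ λ j → cong₂ (λ s t → s * t * B.K.cost i j) (weight≡ i) (weight≡ j))
    (trans (B.K.ends-cost o z refl toℕ-z X Y) (cong (λ s → B.extremeCost s (X * Y)) (sym N-c)))

  change≡ : fromℕ 3 * (fromℕ 4 * (B.N * B.m) * (fromℕ (suc ℓ) * (B.𝒦⁺ - B.𝒦ᵀ)))
            ≡ fromℕ 2 * quartic B.N (fromℕ (suc ℓ)) ((X - Y) * (X - Y))
  change≡ = subst (λ c → fromℕ 3 * (fromℕ 4 * (B.N * B.m) * (c * (B.𝒦⁺ - B.𝒦ᵀ))) ≡ fromℕ 2 * quartic B.N c ((X - Y) * (X - Y)))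
    (sym (trans (cong (fromℕ ∘ suc) (sym ρ-uv)) (fromℕ-suc (ρ u v))))
    (begin
      fromℕ 3 * (fromℕ 4 * (B.N * B.m) * (B.c * (B.𝒦⁺ - B.𝒦ᵀ)))
        ≡⟨ cong (fromℕ 3 *_) (B.change-slack pos φ-pos) ⟩
      fromℕ 3 * (b - fromℕ 4 * B.total pos φ-pos + fromℕ 4 * B.c * (sum (λ a → sum (B.roof pos φ-pos a)) - Σfloored))
        ≡⟨ cong₂ (λ s t → fromℕ 3 * (b - fromℕ 4 * s + fromℕ 4 * B.c * (t - Σfloored))) total≡ (sum-cong-≗ λ a → sum-cong-≗ λ b → roof≡floored a b) ⟩
      fromℕ 3 * (b - fromℕ 4 * E + fromℕ 4 * B.c * (Σfloored - Σfloored))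
        ≡⟨ simp b E B.c Σfloored ⟩
      fromℕ 3 * (b - fromℕ 4 * E)
        ≡⟨ B.base-quartic {b} refl ((X - Y) * (X - Y)) (X * Y) (trans (square X Y) (cong (λ s → s * s - (X - Y) * (X - Y)) (sym N-c))) ⟩
      fromℕ 2 * quartic B.N B.c ((X - Y) * (X - Y)) ∎)
    where
    open ≡-Reasoning
    b E Σfloored : ℚ
    b = B.base pos φ-pos
    E = B.extremeCost (B.N - B.K.c) (X * Y)
    Σfloored = sum λ a → sum (B.floored pos φ-pos a)
    simp = solve 4 (λ b E c s → # 3 :* (b :- # 4 :* E :+ # 4 :* c :* (s :- s)) := # 3 :* (b :- # 4 :* E)) refl
    square = solve 2 (λ X Y → # 4 :* (X :* Y) := (X :+ Y) :* (X :+ Y) :- (X :- Y) :* (X :- Y)) refl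

  connected⁺ : Connected B.G⁺
  connected⁺ = proj₁ (proj₁ isTree) , λ i j → widen (proj₂ (proj₁ isTree) i j)
    where
    widen : ∀ {i j} → Star (Adj broom) i j → Star (Adj B.G⁺) i j
    widen ε = ε
    widen {i} (_◅_ {j = k} ik rest) = ∨-left (adj broom i k) ik ◅ widen rest
      where
      ∨-left : ∀ b {b′} → T b → T (b ∨ b′)
      ∨-left true _ = tt

  kemenyChange : KemenyChange n (B.𝒦⁺ - B.𝒦ᵀ)
  kemenyChange = record
    { tree       = broom
    ; isTree     = isTree
    ; u          = u
    ; v          = v
    ; u≢v        = u≢v
    ; nonadj     = nonadj
    ; κT         = B.𝒦ᵀ
    ; κG         = B.𝒦⁺
    ; kemenyTree = Hitting.isKemeny B.treeResistance (proj₁ isTree)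
    ; kemenyPlus = Hitting.isKemeny B.cycleResistance connected⁺
    ; difference = refl
    }

  attained : ∀ k → (X - Y) * (X - Y) ≡ θParity k → KemenyChange n (prefactor n * fParity n k (+ suc ℓ))
  attained k sq = subst (KemenyChange n)
    (sym (Prefactor.prefactor-≡ n B.0<N B.0<N-1 k ℓ (B.𝒦⁺ - B.𝒦ᵀ) (trans change≡ (cong (λ θ → fromℕ 2 * quartic B.N (fromℕ (suc ℓ)) θ) sq))))
    kemenyChange

-- Here c is the length of the cycle closed by the new edge, and k vertices lie off it. As u and v
-- are neither equal nor adjacent, their distance is at least 2, hence c ≥ 3. The given constants κT
-- and κG are identified by `kemeny-unique`.
kemenyChange-lower : ∀ {n d} → KemenyChange n d →
  ∃₂ λ c k → 3 ℕ.≤ c × n ≡ c ℕ.+ k × prefactor n * fParity n k (+ c) ≤ d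
kemenyChange-lower {n} {d} ch = suc (ρ u v) , Change.spare tree M u v u≢v nonadj star , s≤s 2≤ρ ,
  sym (ℕ.m+[n∸m]≡n (Change.C≤n tree M u v u≢v nonadj star)) ,
  ℚ.≤-trans (Change.change-lower tree M u v u≢v nonadj star)
    (ℚ.≤-reflexive (trans (cong₂ _-_
      (sym (Hitting.kemeny-unique (Change.cycleResistance tree M u v u≢v nonadj) kemenyPlus))
      (sym (Hitting.kemeny-unique (Change.treeResistance tree M u v u≢v nonadj) kemenyTree))) (sym difference)))
  where
  open KemenyChange ch
  star : ∀ i j → Star (Adj tree) i j
  star = proj₂ (proj₁ isTree)
  M : TreeMetric tree
  M = treeMetric tree (proj₁ (proj₂ (isTree-built tree isTree))) (proj₂ (proj₂ (isTree-built tree isTree)))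
  open TreeMetric M using (ρ; ρ-zero; ρ-one)
  at-least-two : ∀ k → k ≢ 0 → k ≢ 1 → 2 ℕ.≤ k
  at-least-two zero          k≢0 _   = contradiction refl k≢0
  at-least-two (suc zero)    _   k≢1 = contradiction refl k≢1
  at-least-two (suc (suc k)) _   _   = s≤s (s≤s z≤n)
  2≤ρ : 2 ℕ.≤ ρ u v
  2≤ρ = at-least-two (ρ u v) (u≢v ∘ ρ-zero) (nonadj ∘ ρ-one)

balanced : ∀ k → ∃₂ λ x y → x ℕ.+ y ≡ k × (fromℕ x - fromℕ y) * (fromℕ x - fromℕ y) ≡ θParity k
balanced zero          = 0 , 0 , refl , refl
balanced (suc zero)    = 0 , 1 , refl , refl
balanced (suc (suc k)) with balanced k
... | x , y , x+y≡k , sq = suc x , suc y , cong suc (trans (ℕ.+-suc x y) (cong suc x+y≡k)) ,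
  trans (cong₂ (λ a b → (a - b) * (a - b)) (fromℕ-suc x) (fromℕ-suc y)) (trans (shift (fromℕ x) (fromℕ y)) sq)
  where
  shift = solve 2 (λ x y → (con 1ℚ :+ x :- (con 1ℚ :+ y)) :* (con 1ℚ :+ x :- (con 1ℚ :+ y)) := (x :- y) :* (x :- y)) refl

kemenyChange-attained : ∀ {n} c k → 3 ℕ.≤ c → n ≡ c ℕ.+ k → KemenyChange n (prefactor n * fParity n k (+ c))
kemenyChange-attained {n} (suc ℓ) k (s≤s 2≤ℓ) n≡ with balanced k
... | x , y , refl , sq = subst (λ n → KemenyChange n (prefactor n * fParity n k (+ suc ℓ))) (sym n≡) (Broom.attained ℓ x y 2≤ℓ k sq)

-- The optimal cycle length

-- Both values are multiplied by c (c + 2), which turns the comparison of f(c) and f(c + 2) into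
-- that of (c + 2) Q(c) and c Q(c + 2) for the quartic Q.
module Steps (n : ℕ) (23≤n : 23 ℕ.≤ n) (K : ℕ) where

  private
    N : ℚ
    N = fromℕ n
    f : ℕ → ℚ
    f c = fParity n K (+ c)
    Q : ℚ → ℚ
    Q c = quartic N c (θParity K)

    fromℕ-2+ : ∀ c → fromℕ (suc (suc c)) ≡ fromℕ c + fromℕ 2
    fromℕ-2+ c = trans (cong fromℕ (ℕ.+-comm 2 c)) (fromℕ-+ c 2)

    linear : ∀ a c b → fromℕ (a ℕ.* c ℕ.+ b) ≡ fromℕ a * fromℕ c + fromℕ b
    linear a c b = trans (fromℕ-+ (a ℕ.* c) b) (cong (_+ fromℕ b) (fromℕ-* a c))

    module _ (c : ℕ) (3≤c : 3 ℕ.≤ c) where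
      z : ℚ
      z = fromℕ c
      0<z : 0ℚ < z
      0<z = ℚ.<-≤-trans (0<fromℕ-suc 2) (fromℕ-mono-≤ {3} {c} 3≤c)
      0<z+2 : 0ℚ < z + fromℕ 2
      0<z+2 = subst (0ℚ <_) (fromℕ-2+ c) (0<fromℕ-suc (suc c))
      here′ : z * (z + fromℕ 2) * f c ≡ (z + fromℕ 2) * Q z
      here′ = trans (swap z (z + fromℕ 2) (f c)) (cong ((z + fromℕ 2) *_) (fParity-quartic n K (+ c) (>⇒≢ 0<z)))
        where
        swap = solve 3 (λ x y w → x :* y :* w := y :* (x :* w)) refl
      next : z * (z + fromℕ 2) * f (suc (suc c)) ≡ z * Q (z + fromℕ 2)
      next = trans (ℚ.*-assoc z (z + fromℕ 2) (f (suc (suc c)))) (cong (z *_)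
        (subst (λ w → w * f (suc (suc c)) ≡ Q w) (fromℕ-2+ c) (fParity-quartic n K (+ suc (suc c)) (>⇒≢ (0<fromℕ-suc (suc c))))))

  f-down : ∀ c → 3 ℕ.≤ c → 4 ℕ.* c ℕ.+ 7 ℕ.≤ 3 ℕ.* n → f (suc (suc c)) ≤ f c
  f-down c 3≤c h = *-cancelˡ-≤ {f (suc (suc c))} {f c} (0<-* (0<z c 3≤c) (0<z+2 c 3≤c))
    (subst₂ _≤_ (sym (next c 3≤c)) (sym (here′ c 3≤c))
      (quartic-down N (fromℕ c) (θParity K) (≤⇒0≤ (fromℕ-mono-≤ {3} {c} 3≤c))
        (subst (0ℚ ≤_) (sym (shape N (fromℕ c)))
          (≤⇒0≤ (subst₂ _≤_ (linear 4 c 7) (fromℕ-* 3 n) (fromℕ-mono-≤ {4 ℕ.* c ℕ.+ 7} {3 ℕ.* n} h))))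
        (0≤θ K) (0≤1-θ K)))
    where
    shape = solve 2 (λ N c → # 3 :* N :- # 4 :* c :- # 7 := # 3 :* N :- (# 4 :* c :+ # 7)) refl

  f-up : ∀ c → 3 ℕ.≤ c → 3 ℕ.* n ℕ.+ 2 ℕ.≤ 4 ℕ.* c → f c ≤ f (suc (suc c))
  f-up c 3≤c h = *-cancelˡ-≤ {f c} {f (suc (suc c))} (0<-* (0<z c 3≤c) (0<z+2 c 3≤c))
    (subst₂ _≤_ (sym (here′ c 3≤c)) (sym (next c 3≤c))
      (quartic-up N (fromℕ c) (θParity K) (≤⇒0≤ (fromℕ-mono-≤ {23} {n} 23≤n)) (0≤fromℕ c)
        (subst (0ℚ ≤_) (sym (shape N (fromℕ c)))
          (≤⇒0≤ (subst₂ _≤_ (linear 3 n 2) (fromℕ-* 4 c) (fromℕ-mono-≤ {3 ℕ.* n ℕ.+ 2} {4 ℕ.* c} h))))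
        (0≤θ K) (0≤1-θ K)))
    where
    shape = solve 2 (λ N c → # 4 :* c :- # 3 :* N :- # 2 := # 4 :* c :- (# 3 :* N :+ # 2)) refl

-- The number 2 j + c, in the form on which `fParity` computes.
skip : ℕ → ℕ → ℕ
skip zero    c = c
skip (suc j) c = suc (suc (skip j c))

skip≥ : ∀ j c → c ℕ.≤ skip j c
skip≥ zero    c = ℕ.≤-refl
skip≥ (suc j) c = ℕ.m≤n⇒m≤1+n (ℕ.m≤n⇒m≤1+n (skip≥ j c))

skip-+ : ∀ j a b → skip j a ℕ.+ b ≡ skip j (a ℕ.+ b)
skip-+ zero    a b = refl
skip-+ (suc j) a b = cong (2 ℕ.+_) (skip-+ j a b)

+-skip : ∀ j a b → a ℕ.+ skip j b ≡ skip j (a ℕ.+ b)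
+-skip zero    a b = refl
+-skip (suc j) a b = trans (ℕ.+-suc a _) (trans (cong suc (ℕ.+-suc a _)) (cong (2 ℕ.+_) (+-skip j a b)))

skip-suc : ∀ j c → skip j (suc c) ≡ suc (skip j c)
skip-suc zero    c = refl
skip-suc (suc j) c = cong (2 ℕ.+_) (skip-suc j c)

fParity-skip : ∀ n j K z → fParity n (skip j K) z ≡ fParity n K z
fParity-skip n zero    K z = refl
fParity-skip n (suc j) K z = fParity-skip n j K z

+-as-skip : ∀ k c → ∃ λ j → (k ℕ.+ c ≡ skip j c) ⊎ (k ℕ.+ c ≡ suc (skip j c))
+-as-skip zero          c = 0 , inj₁ refl
+-as-skip (suc zero)    c = 0 , inj₂ refl
+-as-skip (suc (suc k)) c with +-as-skip k c
... | j , inj₁ e = suc j , inj₁ (cong (2 ℕ.+_) e)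
... | j , inj₂ e = suc j , inj₂ (cong (2 ℕ.+_) e)

-- F is the integer part of c*, and its successor the ceiling.
module Optimum (n : ℕ) (23≤n : 23 ℕ.≤ n) (F K : ℕ) (n≡ : n ≡ F ℕ.+ K)
               (F≤ : 4 ℕ.* F ℕ.≤ 3 ℕ.* n ℕ.+ 1) (≤F+1 : 3 ℕ.* n ℕ.+ 2 ℕ.≤ 4 ℕ.* suc F) where

  open Steps n 23≤n

  f : ℕ → ℕ → ℚ
  f K c = fParity n K (+ c)

  descend : ∀ K j {c} → 3 ℕ.≤ c → 4 ℕ.* skip j c ℕ.≤ 3 ℕ.* n ℕ.+ 1 → f K (skip j c) ≤ f K c
  descend K zero    3≤c h = ℚ.≤-refl
  descend K (suc j) {c} 3≤c h = ℚ.≤-trans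
    (f-down K (skip j c) (ℕ.≤-trans 3≤c (skip≥ j c)) (ℕ.+-cancelʳ-≤ 1 (4 ℕ.* skip j c ℕ.+ 7) (3 ℕ.* n)
      (ℕ.≤-trans (ℕ.≤-reflexive (eight (skip j c))) h)))
    (descend K j 3≤c (ℕ.≤-trans (ℕ.*-monoʳ-≤ 4 (ℕ.m≤n⇒m≤1+n (ℕ.n≤1+n (skip j c)))) h))
    where
    eight : ∀ c → 4 ℕ.* c ℕ.+ 7 ℕ.+ 1 ≡ 4 ℕ.* suc (suc c)
    eight c = trans (ℕ.+-assoc (4 ℕ.* c) 7 1) (trans (sym (ℕ.*-distribˡ-+ 4 c 2)) (cong (4 ℕ.*_) (ℕ.+-comm c 2)))

  ascend : ∀ K j {c} → 3 ℕ.≤ c → 3 ℕ.* n ℕ.+ 2 ℕ.≤ 4 ℕ.* c → f K c ≤ f K (skip j c)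
  ascend K zero    3≤c h = ℚ.≤-refl
  ascend K (suc j) {c} 3≤c h = ℚ.≤-trans (ascend K j 3≤c h)
    (f-up K (skip j c) (ℕ.≤-trans 3≤c (skip≥ j c)) (ℕ.≤-trans h (ℕ.*-monoʳ-≤ 4 (skip≥ j c))))

  -- From 71 = 3 · 23 + 2 ≤ 4 (F + 1). It keeps F - 1, the shortest of the four cycles, at length 3
  -- or more.
  17≤F : 17 ℕ.≤ F
  17≤F = ℕ.≤-pred (ℕ.*-cancelˡ-< 4 17 (suc F) (ℕ.≤-trans (ℕ.≤-trans (ℕ.m≤m+n 69 2) (ℕ.+-monoˡ-≤ 2 (ℕ.*-monoʳ-≤ 3 23≤n))) ≤F+1))

  -- The longest of the four cycles has to fit: 4 F + 8 ≤ 3 n + 9 ≤ 4 n.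
  F+2≤n : F ℕ.+ 2 ℕ.≤ n
  F+2≤n = ℕ.*-cancelˡ-≤ 4 (begin
    4 ℕ.* (F ℕ.+ 2)        ≡⟨ ℕ.*-distribˡ-+ 4 F 2 ⟩
    4 ℕ.* F ℕ.+ 8          ≤⟨ ℕ.+-monoˡ-≤ 8 F≤ ⟩
    3 ℕ.* n ℕ.+ 1 ℕ.+ 8    ≡⟨ ℕ.+-assoc (3 ℕ.* n) 1 8 ⟩
    3 ℕ.* n ℕ.+ 9          ≤⟨ ℕ.+-monoʳ-≤ (3 ℕ.* n) (ℕ.≤-trans (ℕ.m≤m+n 9 14) 23≤n) ⟩
    3 ℕ.* n ℕ.+ n          ≡⟨ ℕ.+-comm (3 ℕ.* n) n ⟩
    4 ℕ.* n                ∎)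
    where open ℕ.≤-Reasoning

  r : ℕ
  r = n ℕ.∸ (F ℕ.+ 2)

  n≡F+2+r : n ≡ F ℕ.+ 2 ℕ.+ r
  n≡F+2+r = sym (ℕ.m+[n∸m]≡n F+2≤n)

  K≡ : K ≡ suc (suc r)
  K≡ = ℕ.+-cancelˡ-≡ F K (suc (suc r)) (trans (sym n≡) (trans n≡F+2+r (ℕ.+-assoc F 2 r)))

  3≤F : 3 ℕ.≤ F
  3≤F = ℕ.≤-trans (ℕ.m≤m+n 3 14) 17≤F

  G : ℕ
  G = ℕ.pred F

  F≡ : F ≡ suc G
  F≡ = sym (ℕ.suc-pred F {{ℕ.>-nonZero (ℕ.≤-trans (s≤s z≤n) 3≤F)}})

  3≤G : 3 ℕ.≤ G
  3≤G = ℕ.≤-pred (subst (4 ℕ.≤_) F≡ (ℕ.≤-trans (ℕ.m≤m+n 4 13) 17≤F))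

  candidate₁ : KemenyChange n (prefactor n * f K F)
  candidate₁ = kemenyChange-attained F K 3≤F n≡

  -- Off this cycle lie `r` vertices, two fewer than `K`; `fParity` sees only the parity.
  candidate₂ : KemenyChange n (prefactor n * f K (F ℕ.+ 2))
  candidate₂ = subst (λ k → KemenyChange n (prefactor n * fParity n k (+ (F ℕ.+ 2)))) (sym K≡)
    (kemenyChange-attained (F ℕ.+ 2) r (ℕ.≤-trans 3≤F (ℕ.m≤m+n F 2)) n≡F+2+r)

  candidate₃ : KemenyChange n (prefactor n * f (suc K) (suc F))
  candidate₃ = subst (λ k → KemenyChange n (prefactor n * fParity n k (+ suc F))) (sym (cong suc K≡))
    (kemenyChange-attained (suc F) (suc r) (ℕ.m≤n⇒m≤1+n 3≤F)
      (trans n≡F+2+r (trans (ℕ.+-assoc F 2 r) (ℕ.+-suc F (suc r)))))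

  candidate₄ : KemenyChange n (prefactor n * f (suc K) G)
  candidate₄ = kemenyChange-attained G (suc K) 3≤G (trans n≡ (trans (cong (ℕ._+ K) F≡) (sym (ℕ.+-suc G K))))

  0≤prefactor : 0ℚ ≤ prefactor n
  0≤prefactor = 0≤inv (0<-* {fromℕ 6 * fromℕ n} (0<-* {fromℕ 6} (0<fromℕ-suc 5) 0<N) 0<N-1)
    where
    0<N : 0ℚ < fromℕ n
    0<N = ℚ.<-≤-trans (0<fromℕ-suc 22) (fromℕ-mono-≤ {23} {n} 23≤n)
    0<N-1 : 0ℚ < fromℕ n - 1ℚ
    0<N-1 = ℚ.<-≤-trans (0<fromℕ-suc 21) (ℚ.+-monoˡ-≤ (- 1ℚ) (fromℕ-mono-≤ {23} {n} 23≤n))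

  p : ℚ
  p = prefactor n

  scale : ∀ {x y} → x ≤ y → p * x ≤ p * y
  scale = *-monoˡ-≤ 0≤prefactor

  -- The cycle length moves towards F in steps of 2, which keeps the parity of n - c. From below it
  -- stops at F or F - 1, from above at F + 1 or F + 2.
  nearest : ∀ {d} → KemenyChange n d →
    (p * f K F ≤ d ⊎ p * f K (F ℕ.+ 2) ≤ d) ⊎ (p * f (suc K) (suc F) ≤ d ⊎ p * f (suc K) G ≤ d)
  nearest {d} ch = go (ℕ.≤-total c F)
    where
    low = kemenyChange-lower ch
    c k : ℕ
    c = proj₁ low
    k = proj₁ (proj₂ low)
    3≤c : 3 ℕ.≤ c
    3≤c = proj₁ (proj₂ (proj₂ low))
    n≡c+k : n ≡ c ℕ.+ k
    n≡c+k = proj₁ (proj₂ (proj₂ (proj₂ low)))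
    below : ∀ {x} → x ≤ f k c → p * x ≤ d
    below h = ℚ.≤-trans (scale h) (proj₂ (proj₂ (proj₂ (proj₂ low))))
    same : ∀ j {a} → k ≡ skip j a → f a c ≡ f k c
    same j {a} e = trans (sym (fParity-skip n j a (+ c))) (cong (λ k → f k c) (sym e))
    same′ : ∀ j {a} → a ≡ skip j k → f a c ≡ f k c
    same′ j {a} e = trans (cong (λ k → f k c) e) (fParity-skip n j k (+ c))
    go : c ℕ.≤ F ⊎ F ℕ.≤ c → _
    go (inj₁ c≤F) with +-as-skip (F ℕ.∸ c) c
    ... | j , inj₁ e = inj₁ (inj₁ (below (subst₂ _≤_ (cong (f K) (sym F≡skip)) (same j k≡)
          (descend K j 3≤c (subst (λ F → 4 ℕ.* F ℕ.≤ 3 ℕ.* n ℕ.+ 1) F≡skip F≤)))))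
      where
      F≡skip : F ≡ skip j c
      F≡skip = trans (sym (ℕ.m∸n+n≡m c≤F)) e
      k≡ : k ≡ skip j K
      k≡ = ℕ.+-cancelˡ-≡ c k (skip j K) (trans (sym n≡c+k) (trans n≡ (trans (cong (ℕ._+ K) F≡skip)
        (trans (skip-+ j c K) (sym (+-skip j c K))))))
    ... | j , inj₂ e = inj₂ (inj₂ (below (subst₂ _≤_ (cong (f (suc K)) (sym G≡skip)) (same j k≡)
          (descend (suc K) j 3≤c (ℕ.≤-trans (ℕ.*-monoʳ-≤ 4 (ℕ.≤-trans (ℕ.≤-reflexive (sym G≡skip)) (ℕ.pred[n]≤n {F}))) F≤)))))
      where
      F≡skip : F ≡ suc (skip j c)
      F≡skip = trans (sym (ℕ.m∸n+n≡m c≤F)) e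
      G≡skip : G ≡ skip j c
      G≡skip = cong ℕ.pred F≡skip
      k≡ : k ≡ skip j (suc K)
      k≡ = ℕ.+-cancelˡ-≡ c k (skip j (suc K)) (trans (sym n≡c+k) (trans n≡ (trans (cong (ℕ._+ K) F≡skip)
        (trans (cong suc (skip-+ j c K)) (trans (sym (skip-suc j (c ℕ.+ K))) (trans (cong (skip j) (sym (ℕ.+-suc c K))) (sym (+-skip j c (suc K)))))))))
    go (inj₂ F≤c) with ℕ.m≤n⇒m<n∨m≡n F≤c
    ... | inj₂ F≡c = inj₁ (inj₁ (below (ℚ.≤-reflexive (trans (cong (f K) F≡c)
          (cong (λ k → f k c) (ℕ.+-cancelˡ-≡ c K k (trans (cong (ℕ._+ K) (sym F≡c)) (trans (sym n≡) n≡c+k))))))))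
    ... | inj₁ F<c with +-as-skip (c ℕ.∸ suc F) (suc F)
    ...   | j , inj₁ e = inj₂ (inj₁ (below (subst (f (suc K) (suc F) ≤_)
            (trans (cong (f (suc K)) (sym c≡skip)) (same′ (suc j) (trans (cong suc K≡skip) (cong suc (skip-suc j k)))))
            (ascend (suc K) j (ℕ.m≤n⇒m≤1+n 3≤F) ≤F+1))))
      where
      c≡skip : c ≡ skip j (suc F)
      c≡skip = trans (sym (ℕ.m∸n+n≡m F<c)) e
      K≡skip : K ≡ skip j (suc k)
      K≡skip = ℕ.+-cancelˡ-≡ F K (skip j (suc k)) (trans (sym n≡) (trans n≡c+k (trans (cong (ℕ._+ k) c≡skip)
        (trans (skip-+ j (suc F) k) (trans (cong (skip j) (sym (ℕ.+-suc F k))) (sym (+-skip j F (suc k))))))))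
    ...   | j , inj₂ e = inj₁ (inj₂ (below (subst₂ _≤_ (cong (f K) (ℕ.+-comm 2 F))
            (trans (cong (f K) (sym c≡skip)) (same′ (suc j) (trans K≡skip (trans (skip-suc j (suc k)) (cong suc (skip-suc j k))))))
            (ascend K j {suc (suc F)} (ℕ.m≤n⇒m≤1+n (ℕ.m≤n⇒m≤1+n 3≤F)) (ℕ.≤-trans ≤F+1 (ℕ.*-monoʳ-≤ 4 (ℕ.n≤1+n (suc F))))))))
      where
      c≡skip : c ≡ skip j (suc (suc F))
      c≡skip = trans (sym (ℕ.m∸n+n≡m F<c)) (trans e (sym (skip-suc j (suc F))))
      K≡skip : K ≡ skip j (suc (suc k))
      K≡skip = ℕ.+-cancelˡ-≡ F K (skip j (suc (suc k))) (trans (sym n≡) (trans n≡c+k (trans (cong (ℕ._+ k) c≡skip)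
        (trans (skip-+ j (suc (suc F)) k) (trans (cong (skip j) (sym (trans (ℕ.+-suc F (suc k)) (cong suc (ℕ.+-suc F k))))) (sym (+-skip j F (suc (suc k)))))))))

  minimum : IsMinimum (KemenyChange n) (p * (f K F ⊓ f K (F ℕ.+ 2) ⊓ f (suc K) (suc F) ⊓ f (suc K) G))
  minimum = attained , bound
    where
    w x y z : ℚ
    w = f K F
    x = f K (F ℕ.+ 2)
    y = f (suc K) (suc F)
    z = f (suc K) G
    select : ∀ {a b} → KemenyChange n (p * a) → KemenyChange n (p * b) → KemenyChange n (p * (a ⊓ b))
    select {a} {b} ca cb = go (ℚ.⊓-sel a b)
      where
      go : a ⊓ b ≡ a ⊎ a ⊓ b ≡ b → KemenyChange n (p * (a ⊓ b))
      go (inj₁ e) = subst (λ m → KemenyChange n (p * m)) (sym e) ca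
      go (inj₂ e) = subst (λ m → KemenyChange n (p * m)) (sym e) cb
    attained : KemenyChange n (p * (w ⊓ x ⊓ y ⊓ z))
    attained = select {w ⊓ x ⊓ y} {z} (select {w ⊓ x} {y} (select {w} {x} candidate₁ candidate₂) candidate₃) candidate₄
    ≤y : w ⊓ x ⊓ y ⊓ z ≤ w ⊓ x ⊓ y
    ≤y = ℚ.p⊓q≤p (w ⊓ x ⊓ y) z
    ≤x : w ⊓ x ⊓ y ⊓ z ≤ w ⊓ x
    ≤x = ℚ.≤-trans ≤y (ℚ.p⊓q≤p (w ⊓ x) y)
    bound : ∀ d → KemenyChange n d → p * (w ⊓ x ⊓ y ⊓ z) ≤ d
    bound d ch = go (nearest ch)
      where
      go : (p * w ≤ d ⊎ p * x ≤ d) ⊎ (p * y ≤ d ⊎ p * z ≤ d) → p * (w ⊓ x ⊓ y ⊓ z) ≤ d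
      go (inj₁ (inj₁ h)) = ℚ.≤-trans (scale (ℚ.≤-trans ≤x (ℚ.p⊓q≤p w x))) h
      go (inj₁ (inj₂ h)) = ℚ.≤-trans (scale (ℚ.≤-trans ≤x (ℚ.p⊓q≤q w x))) h
      go (inj₂ (inj₁ h)) = ℚ.≤-trans (scale (ℚ.≤-trans ≤y (ℚ.p⊓q≤q (w ⊓ x) y))) h
      go (inj₂ (inj₂ h)) = ℚ.≤-trans (scale (ℚ.p⊓q≤q (w ⊓ x ⊓ y) z)) h

  -- The value 48 n + 21 lies strictly between 16 (3 n + 1) and 16 (3 n + 2). So `c* n` is never an
  -- integer, and the two integer bounds on F fix its floor and ceiling.
  64c* : fromℕ 64 * c* n ≡ fromℕ 48 * fromℕ n + fromℕ 21
  64c* = trans (cong (λ x → fromℕ 64 * (x * inv (fromℕ 4) + fromℕ 21 * inv (fromℕ 64))) (fromℕ-* 3 n)) (shape (fromℕ n))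
    where
    shape = solve 1 (λ N → # 64 :* (# 3 :* N :* con (+ 1 / 4) :+ # 21 :* con (+ 1 / 64)) := # 48 :* N :+ # 21) refl

  F<c* : fromℕ F < c* n
  F<c* = ℚ.*-cancelˡ-<-nonNeg (fromℕ 64) (subst (fromℕ 64 * fromℕ F <_) (sym 64c*) (ℚ.≤-<-trans
    (subst₂ _≤_ (lhs (fromℕ F)) (rhs (fromℕ n)) (*-monoˡ-≤ (0≤fromℕ 16) (subst₂ _≤_ (fromℕ-* 4 F) (trans (fromℕ-+ (3 ℕ.* n) 1) (cong (_+ 1ℚ) (fromℕ-* 3 n)))
      (fromℕ-mono-≤ {4 ℕ.* F} {3 ℕ.* n ℕ.+ 1} F≤))))
    (ℚ.+-monoʳ-< (fromℕ 48 * fromℕ n) 16<21)))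
    where
    lhs = solve 1 (λ x → # 16 :* (# 4 :* x) := # 64 :* x) refl
    rhs = solve 1 (λ x → # 16 :* (# 3 :* x :+ con 1ℚ) := # 48 :* x :+ # 16) refl
    16<21 : fromℕ 16 < fromℕ 21
    16<21 = subst (_< fromℕ 21) (ℚ.+-identityʳ (fromℕ 16)) (ℚ.+-monoʳ-< (fromℕ 16) (0<fromℕ-suc 4))

  c*<F+1 : c* n < fromℕ (suc F)
  c*<F+1 = ℚ.*-cancelˡ-<-nonNeg (fromℕ 64) (subst (_< fromℕ 64 * fromℕ (suc F)) (sym 64c*) (ℚ.<-≤-trans
    (ℚ.+-monoʳ-< (fromℕ 48 * fromℕ n) 21<32)
    (subst₂ _≤_ (lhs (fromℕ n)) (rhs (fromℕ (suc F))) (*-monoˡ-≤ (0≤fromℕ 16) (subst₂ _≤_ (trans (fromℕ-+ (3 ℕ.* n) 2) (cong (_+ fromℕ 2) (fromℕ-* 3 n)))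
      (fromℕ-* 4 (suc F)) (fromℕ-mono-≤ {3 ℕ.* n ℕ.+ 2} {4 ℕ.* suc F} ≤F+1))))))
    where
    lhs = solve 1 (λ x → # 16 :* (# 3 :* x :+ # 2) := # 48 :* x :+ # 32) refl
    rhs = solve 1 (λ x → # 16 :* (# 4 :* x) := # 64 :* x) refl
    21<32 : fromℕ 21 < fromℕ 32
    21<32 = subst (_< fromℕ 32) (ℚ.+-identityʳ (fromℕ 21)) (ℚ.+-monoʳ-< (fromℕ 21) (0<fromℕ-suc 10))

  floor-c* : floor (c* n) ≡ + F
  floor-c* = floor-unique (c* n) (+ F) (ℚ.<⇒≤ F<c*) c*<F+1

  ceiling-c* : ceiling (c* n) ≡ + suc F
  ceiling-c* = ceiling-unique (c* n) (+ suc F) (subst (_< c* n) (sym back) F<c*) (ℚ.<⇒≤ c*<F+1)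
    where
    back : fromℕ (suc F) - 1ℚ ≡ fromℕ F
    back = trans (cong (_- 1ℚ) (fromℕ-suc F)) (cancel (fromℕ F))
      where
      cancel = solve 1 (λ x → con 1ℚ :+ x :- con 1ℚ := x) refl

  -- `e` and `o` stand for whichever of `fₑ` and `fₒ` belongs to K and to K + 1, so both cases of
  -- the theorem are instances.
  minimum-c* : ∀ {e o : ℤ → ℚ} → (∀ z → fParity n K z ≡ e z) → (∀ z → fParity n (suc K) z ≡ o z) →
    IsMinimum (KemenyChange n)
      (p * (e (floor (c* n)) ⊓ e (floor (c* n) ℤ.+ + 2) ⊓ o (ceiling (c* n)) ⊓ o (ceiling (c* n) ℤ.- + 2)))
  minimum-c* {e} {o} e≡ o≡ = subst₂ (λ x y → IsMinimum (KemenyChange n) (p * (e x ⊓ e (x ℤ.+ + 2) ⊓ o y ⊓ o (y ℤ.- + 2))))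
    (sym floor-c*) (sym ceiling-c*)
    (subst (λ m → IsMinimum (KemenyChange n) (p * m))
      (cong₂ _⊓_ (cong₂ _⊓_ (cong₂ _⊓_ (e≡ (+ F)) (e≡ (+ (F ℕ.+ 2)))) (o≡ (+ suc F))) (trans (cong (fParity n (suc K)) G≡) (o≡ (+ suc F ℤ.- + 2))))
      minimum)
    where
    G≡ : + G ≡ + suc F ℤ.- + 2
    -- Once F is a successor, the integer subtraction computes.
    G≡ = sym (cong (λ F → + suc F ℤ.- + 2) F≡)

-- For n = 8 q + s the bounds on the integer part shift by 24 q, so it is 6 q plus the one for s.
-- Then n - ⌊c*⌋ is 2 q + κ, with the parity of κ.
minimum-mod-8 : ∀ {n} s F κ → 23 ℕ.≤ n → n % 8 ≡ s → s ≡ F ℕ.+ κ → 4 ℕ.* F ℕ.≤ 3 ℕ.* s ℕ.+ 1 → 3 ℕ.* s ℕ.+ 2 ℕ.≤ 4 ℕ.* suc F →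
  ∀ {e o : ℤ → ℚ} → (∀ z → fParity n κ z ≡ e z) → (∀ z → fParity n (suc κ) z ≡ o z) →
  IsMinimum (KemenyChange n)
    (prefactor n * (e (floor (c* n)) ⊓ e (floor (c* n) ℤ.+ + 2) ⊓ o (ceiling (c* n)) ⊓ o (ceiling (c* n) ℤ.- + 2)))
minimum-mod-8 {n} s F κ 23≤n n%8≡s refl F≤ ≤F+1 e≡ o≡ =
  Optimum.minimum-c* n 23≤n (q ℕ.* 6 ℕ.+ F) (q ℕ.* 2 ℕ.+ κ) (trans n≡ (split q F κ))
    (subst₂ ℕ._≤_ (low q F) (trans (high q s 1) (cong (λ n → 3 ℕ.* n ℕ.+ 1) (sym n≡))) (ℕ.+-monoʳ-≤ (q ℕ.* 24) F≤))
    (subst₂ ℕ._≤_ (trans (high q s 2) (cong (λ n → 3 ℕ.* n ℕ.+ 2) (sym n≡))) (trans (low q (suc F)) (cong (4 ℕ.*_) (ℕ.+-suc (q ℕ.* 6) F)))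
      (ℕ.+-monoʳ-≤ (q ℕ.* 24) ≤F+1))
    (λ z → trans (periodic q κ z) (e≡ z)) (λ z → trans (cong (λ K → fParity n K z) (sym (ℕ.+-suc (q ℕ.* 2) κ))) (trans (periodic q (suc κ) z) (o≡ z)))
  where
  q : ℕ
  q = n ℕ./ 8
  n≡ : n ≡ s ℕ.+ q ℕ.* 8
  n≡ = trans (ℕ.m≡m%n+[m/n]*n n 8) (cong (ℕ._+ q ℕ.* 8) n%8≡s)
  split : ∀ q F κ → F ℕ.+ κ ℕ.+ q ℕ.* 8 ≡ q ℕ.* 6 ℕ.+ F ℕ.+ (q ℕ.* 2 ℕ.+ κ)
  split = ℕRing.solve-∀
  low : ∀ q F → q ℕ.* 24 ℕ.+ 4 ℕ.* F ≡ 4 ℕ.* (q ℕ.* 6 ℕ.+ F)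
  low = ℕRing.solve-∀
  high : ∀ q s k → q ℕ.* 24 ℕ.+ (3 ℕ.* s ℕ.+ k) ≡ 3 ℕ.* (s ℕ.+ q ℕ.* 8) ℕ.+ k
  high = ℕRing.solve-∀
  periodic : ∀ q κ z → fParity n (q ℕ.* 2 ℕ.+ κ) z ≡ fParity n κ z
  periodic zero    κ z = refl
  periodic (suc q) κ z = periodic q κ z

theorem4p2 : (n : ℕ) → 23 ℕ.≤ n →
    (n % 8 ∈ 0 ∷ 1 ∷ 6 ∷ 7 ∷ [] →
    IsMinimum (KemenyChange n)
    (prefactor n * (fₑ n (floor (c* n)) ⊓ fₑ n (floor (c* n) ℤ.+ + 2)
    ⊓ fₒ n (ceiling (c* n)) ⊓ fₒ n (ceiling (c* n) ℤ.- + 2))))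
    ×
    (n % 8 ∈ 2 ∷ 3 ∷ 4 ∷ 5 ∷ [] →
    IsMinimum (KemenyChange n)
    (prefactor n * (fₒ n (floor (c* n)) ⊓ fₒ n (floor (c* n) ℤ.+ + 2)
    ⊓ fₑ n (ceiling (c* n)) ⊓ fₑ n (ceiling (c* n) ℤ.- + 2))))
theorem4p2 n 23≤n = even , odd
  where
  even : n % 8 ∈ 0 ∷ 1 ∷ 6 ∷ 7 ∷ [] → _
  -- The three numbers are the residue s, ⌊(3 s + 1) / 4⌋ and their difference, which is even for
  -- these residues and odd for the other four.
  even (here e)                         = minimum-mod-8 0 0 0 23≤n e refl (ℕ.≤ᵇ⇒≤ 0 1 tt) (ℕ.≤ᵇ⇒≤ 2 4 tt) (λ _ → refl) (λ _ → refl)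
  even (there (here e))                 = minimum-mod-8 1 1 0 23≤n e refl (ℕ.≤ᵇ⇒≤ 4 4 tt) (ℕ.≤ᵇ⇒≤ 5 8 tt) (λ _ → refl) (λ _ → refl)
  even (there (there (here e)))         = minimum-mod-8 6 4 2 23≤n e refl (ℕ.≤ᵇ⇒≤ 16 19 tt) (ℕ.≤ᵇ⇒≤ 20 20 tt) (λ _ → refl) (λ _ → refl)
  even (there (there (there (here e)))) = minimum-mod-8 7 5 2 23≤n e refl (ℕ.≤ᵇ⇒≤ 20 22 tt) (ℕ.≤ᵇ⇒≤ 23 24 tt) (λ _ → refl) (λ _ → refl)
  odd : n % 8 ∈ 2 ∷ 3 ∷ 4 ∷ 5 ∷ [] → _
  odd (here e)                          = minimum-mod-8 2 1 1 23≤n e refl (ℕ.≤ᵇ⇒≤ 4 7 tt) (ℕ.≤ᵇ⇒≤ 8 8 tt) (λ _ → refl) (λ _ → refl)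
  odd (there (here e))                  = minimum-mod-8 3 2 1 23≤n e refl (ℕ.≤ᵇ⇒≤ 8 10 tt) (ℕ.≤ᵇ⇒≤ 11 12 tt) (λ _ → refl) (λ _ → refl)
  odd (there (there (here e)))          = minimum-mod-8 4 3 1 23≤n e refl (ℕ.≤ᵇ⇒≤ 12 13 tt) (ℕ.≤ᵇ⇒≤ 14 16 tt) (λ _ → refl) (λ _ → refl)
  odd (there (there (there (here e))))  = minimum-mod-8 5 4 1 23≤n e refl (ℕ.≤ᵇ⇒≤ 16 16 tt) (ℕ.≤ᵇ⇒≤ 17 20 tt) (λ _ → refl) (λ _ → refl)
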